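{- Let $r\ge 4$ be even, let $q$ be an odd prime power, let $\mathcal L$ be an $m$-cover of $\mathcal Q(r,q)$ and let $\bar{\mathcal L}$ be the set of points of $\mathcal H(r,q^2)$ lying on the extended lines of $\mathcal L$. Then $\bar{\mathcal L}$ is an $(m(q^2-q)+q+1)$-tight set of $\mathcal H(r,q^2)$ if and only if $\mathcal L$ is an $(r-2)$-dual cover of parabolic type $I$.
   Context: $\theta_{n,q}=q^n+\dots+q+1$ for $n\ge0$, $\theta_{ -1,q}=0$; $\theta_{n,q^2}$ is the same expression with $q^2$ in place of $q$. $\mathcal Q(r,q)$ is the parabolic quadric (polar space) of $\Sigma=\mathrm{PG}(r,q)$, $q$ odd, $r\ge4$ even, given by a nondegenerate quadratic form on $\mathbb F_q^{r+1}$ with associated symmetric bilinear form $b$ and orthogonal polarity $\perp$. Lines of $\mathcal Q(r,q)$ are the lines of $\Sigma$ contained in the quadric. An $m$-cover of lines of $\mathcal Q(r,q)$ ($m>0$) is a set $\mathcal L$ of lines of $\mathcal Q(r,q)$ such that every point of $\mathcal Q(r,q)$ lies on exactly $m$ lines of $\mathcal L$. An $m$-cover $\mathcal L$ of $\mathcal Q(r,q)$ is $(r-2)$-dual of parabolic type $I$ if, for every line $\ell$ of $\Sigma$, the number of lines of $\mathcal L$ contained in $\ell^\perp$ equals $\frac{m\theta_{r-5,q}}{q+1}+q^{r-4}$ if $\ell\in\mathcal L$, and equals $\frac{m\theta_{r-5,q}}{q+1}$ if $\ell\notin\mathcal L$ and $|\ell\cap\mathcal Q(r,q)|\in\{0,2,q+1\}$.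 $\Sigma$ is embedded in $\mathrm{PG}(r,q^2)$ by extension of scalars; the extended line of a line $\ell$ of $\Sigma$ is the line of $\mathrm{PG}(r,q^2)$ containing the $q+1$ points of $\ell$. Let $\tau$ be the semilinear involution of $\mathrm{PG}(r,q^2)$ raising coordinates to the $q$-th power (fixing $\Sigma$ pointwise) and $B$ the $\mathbb F_{q^2}$-bilinear extension of $b$. $\mathcal H(r,q^2)$ is the non-degenerate Hermitian variety $\{\langle x\rangle:B(x,\tau(x))=0\}$, with unitary polarity $\langle x\rangle^{\perp_h}=\{y:B(y,\tau(x))=0\}$. A subset $\mathcal X$ of points of $\mathcal H(r,q^2)$ is $i$-tight if for every point $P$ of $\mathcal H(r,q^2)$, $|P^{\perp_h}\cap\mathcal X|$ equals $i\,\theta_{\frac{r-4}{2},q^2}+q^{r-2}$ if $P\in\mathcal X$ and $i\,\theta_{\frac{r-4}{2},q^2}$ if $P\notin\mathcal X$. -}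

module Defs where

open import Level using (0ℓ)
open import Algebra.Bundles using (CommutativeRing)
open import Algebra.Structures using (IsCommutativeRing)
open import Algebra.Morphism.Structures using (IsRingHomomorphism)
import Algebra.Properties.Semiring.Exp as Exp
import Algebra.Properties.Semiring.Sum as Sum
open import Data.Fin.Base using (Fin)
open import Data.Integer.Base using (ℤ; +_; -[1+_])
import Data.Integer.Base as ℤ
open import Data.Nat.Base using (ℕ; zero; suc; _+_; _*_; _∸_; _^_; _/_; _>_)
open import Data.Nat.Divisibility using (_∣_)
open import Data.Nat.Primality using (Prime)
open import Data.Product.Base using (Σ; ∃; ∃₂; _×_; proj₁)
open import Data.Sum.Base using (_⊎_)
open import Data.Vec.Base using (Vec; foldr′; lookup; map; replicate; zipWith; _[_]≔_)
open import Function.Bundles using (Bijection; _⤖_)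
open import Relation.Binary.Bundles using (Setoid)
import Relation.Binary.Construct.On as On
open import Relation.Binary.PropositionalEquality using (_≡_; _≢_)
import Relation.Binary.PropositionalEquality as ≡
open import Relation.Nullary.Negation using (¬_)
open import Relation.Unary using (Pred; _∈_; _∉_; _⊆_)
open import Relation.Unary.Relation.Binary.Equality using (≐-setoid)

IsOddPrimePower : ℕ → Set
IsOddPrimePower q = (∃₂ λ p h → Prime p × q ≡ p ^ suc h) × ¬ (2 ∣ q)

-- θ n q = qⁿ + … + q + 1; among the negative indices only θ₋₁ = 0 is used.
θ : ℤ → ℕ → ℕ
θ (+ zero)   q = 1
θ (+ suc n)  q = q ^ suc n + θ (+ n) q
θ -[1+ _ ]   q = 0

-- "Exactly n elements of S satisfy P": elements are counted up to the
-- equality of S, whatever the proofs of P.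
HasCard : (S : Setoid 0ℓ 0ℓ) → Pred (Setoid.Carrier S) 0ℓ → ℕ → Set
HasCard S P n = Bijection (On.setoid {B = Σ (Setoid.Carrier S) P} S proj₁) (≡.setoid (Fin n))

record FiniteField (q : ℕ) : Set₁ where
  infix  8 -_
  infixl 7 _·_
  infixl 6 _⊕_
  field
    Carrier           : Set
    _⊕_ _·_           : Carrier → Carrier → Carrier
    -_                : Carrier → Carrier
    0# 1#             : Carrier
    isCommutativeRing : IsCommutativeRing _≡_ _⊕_ _·_ -_ 0# 1#
    0≢1               : 0# ≢ 1#
    invertible        : ∀ x → x ≢ 0# → ∃ λ y → x · y ≡ 1#
    order             : Carrier ⤖ Fin q

  commutativeRing : CommutativeRing 0ℓ 0ℓ
  commutativeRing = record { isCommutativeRing = isCommutativeRing }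

  open CommutativeRing commutativeRing public using (_-_; semiring; rawRing)

record FieldEmbedding {q q′} (F : FiniteField q) (K : FiniteField q′) : Set where
  field
    ι              : FiniteField.Carrier F → FiniteField.Carrier K
    isHomomorphism : IsRingHomomorphism (FiniteField.rawRing F) (FiniteField.rawRing K) ι

module Projective {q} (F : FiniteField q) where
  open FiniteField F

  Vector : ℕ → Set
  Vector n = Vec Carrier n

  0ᵛ : ∀ {n} → Vector n
  0ᵛ = replicate _ 0#

  infixl 6 _+ᵛ_
  infixr 7 _·ᵛ_

  _+ᵛ_ : ∀ {n} → Vector n → Vector n → Vector n
  _+ᵛ_ = zipWith _⊕_

  _·ᵛ_ : ∀ {n} → Carrier → Vector n → Vector n
  c ·ᵛ x = map (c ·_) x

  unit : ∀ {n} → Fin n → Vector n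
  unit i = 0ᵛ [ i ]≔ 1#

  combination : ∀ {n k} → Vector k → Vec (Vector n) k → Vector n
  combination cs vs = foldr′ _+ᵛ_ 0ᵛ (zipWith _·ᵛ_ cs vs)

  -- A k-dimensional subspace of the n-dimensional space, given by a basis;
  -- two bases are identified when they have the same span.
  record Subspace (n k : ℕ) : Set where
    field
      basis       : Vec (Vector n) k
      independent : ∀ cs → combination cs basis ≡ 0ᵛ → cs ≡ 0ᵛ

  ⟦_⟧ : ∀ {n k} → Subspace n k → Pred (Vector n) 0ℓ
  ⟦ S ⟧ x = ∃ λ cs → x ≡ combination cs (Subspace.basis S)

  subspaces : ℕ → ℕ → Setoid 0ℓ 0ℓ
  subspaces n k = On.setoid {B = Subspace n k} (≐-setoid (Vector n) 0ℓ) ⟦_⟧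

  -- Points and lines of PG(r,q).
  Point Line : ℕ → Set
  Point r = Subspace (suc r) 1
  Line  r = Subspace (suc r) 2

  points lines : ℕ → Setoid 0ℓ 0ℓ
  points r = subspaces (suc r) 1
  lines  r = subspaces (suc r) 2

  record QuadraticForm (n : ℕ) : Set where
    field
      form : Vector n → Carrier

    -- The associated bilinear form b.
    polar : Vector n → Vector n → Carrier
    polar x y = form (x +ᵛ y) - form x - form y

    field
      form-·   : ∀ a x → form (a ·ᵛ x) ≡ a · a · form x
      polar-+ˡ : ∀ x y z → polar (x +ᵛ y) z ≡ polar x z ⊕ polar y z
      polar-·ˡ : ∀ a x y → polar (a ·ᵛ x) y ≡ a · polar x y

  -- Used only for odd q, where nondegeneracy of the quadratic form is that
  -- of its polar form.
  Nondegenerate : ∀ {n} → QuadraticForm n → Set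
  Nondegenerate Q = ∀ x → (∀ y → QuadraticForm.polar Q x y ≡ 0#) → x ≡ 0ᵛ

module Parabolic {q r} (F : FiniteField q)
                 (Q : Projective.QuadraticForm F (suc r)) where
  open FiniteField F using (0#)
  open Projective F
  open QuadraticForm Q

  -- The vectors representing the points of the quadric, together with 0; a
  -- subspace S lies on the quadric when ⟦ S ⟧ ⊆ Singular.
  Singular : Pred (Vector (suc r)) 0ℓ
  Singular x = form x ≡ 0#

  _^⊥ : ∀ {k} → Subspace (suc r) k → Pred (Vector (suc r)) 0ℓ
  (S ^⊥) x = ∀ {y} → y ∈ ⟦ S ⟧ → polar x y ≡ 0#

  record IsCover (m : ℕ) (𝓛 : Pred (Line r) 0ℓ) : Set where
    field
      positive  : m > 0
      onQuadric : ∀ {ℓ} → ℓ ∈ 𝓛 → ⟦ ℓ ⟧ ⊆ Singular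
      covers    : ∀ (P : Point r) → ⟦ P ⟧ ⊆ Singular →
                  HasCard (lines r) (λ ℓ → ℓ ∈ 𝓛 × ⟦ P ⟧ ⊆ ⟦ ℓ ⟧) m

  -- The number of points of the quadric on ℓ is n.
  MeetsQuadricIn : Line r → ℕ → Set
  MeetsQuadricIn ℓ n = HasCard (points r) (λ P → ⟦ P ⟧ ⊆ ⟦ ℓ ⟧ × ⟦ P ⟧ ⊆ Singular) n

  -- m θ_{r-5,q} / (q+1).  The division is exact for even r ≥ 4: then θ_{r-5,q}
  -- is a sum of r-4 consecutive powers of q, hence divisible by q+1.
  dualNumber : ℕ → ℕ
  dualNumber m = m * θ (r ℤ.⊖ 5) q / suc q

  -- (r-2)-dual of parabolic type I, for an m-cover 𝓛.
  record IsDualTypeI (m : ℕ) (𝓛 : Pred (Line r) 0ℓ) : Set where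
    field
      inside  : ∀ (ℓ : Line r) → ℓ ∈ 𝓛 →
                HasCard (lines r) (λ ℓ′ → ℓ′ ∈ 𝓛 × ⟦ ℓ′ ⟧ ⊆ ℓ ^⊥)
                        (dualNumber m + q ^ (r ∸ 4))
      outside : ∀ (ℓ : Line r) → ℓ ∉ 𝓛 →
                MeetsQuadricIn ℓ 0 ⊎ MeetsQuadricIn ℓ 2 ⊎ MeetsQuadricIn ℓ (q + 1) →
                HasCard (lines r) (λ ℓ′ → ℓ′ ∈ 𝓛 × ⟦ ℓ′ ⟧ ⊆ ℓ ^⊥) (dualNumber m)

module Hermitian {q r} (F : FiniteField q) (K : FiniteField (q ^ 2))
                 (emb : FieldEmbedding F K)
                 (Q : Projective.QuadraticForm F (suc r)) where
  open FiniteField K using (Carrier; _·_; 0#; semiring)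
  open FieldEmbedding emb using (ι)
  open Sum semiring using (sum)
  open Projective K
  private
    module Σ₀ = Projective F

  open Projective.QuadraticForm Q using (polar)

  τ : ∀ {n} → Vector n → Vector n
  τ = map (λ a → Exp._^_ semiring a q)

  -- The K-bilinear extension of polar, from its Gram matrix in the standard basis.
  B : Vector (suc r) → Vector (suc r) → Carrier
  B x y = sum λ i → sum λ j →
            lookup x i · lookup y j · ι (polar (Σ₀.unit i) (Σ₀.unit j))

  𝓗 : Pred (Point r) 0ℓ
  𝓗 P = ∀ {x} → x ∈ ⟦ P ⟧ → B x (τ x) ≡ 0#

  _^⊥ₕ : Point r → Pred (Vector (suc r)) 0ℓ
  (P ^⊥ₕ) y = ∀ {x} → x ∈ ⟦ P ⟧ → B y (τ x) ≡ 0#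

  -- M contains the points of ℓ, that is, M is the extended line of ℓ.
  _Extends_ : Line r → Σ₀.Line r → Set
  M Extends ℓ = ∀ {x} → x ∈ Σ₀.⟦ ℓ ⟧ → map ι x ∈ ⟦ M ⟧

  extendedPoints : Pred (Σ₀.Line r) 0ℓ → Pred (Point r) 0ℓ
  extendedPoints 𝓛 P =
    P ∈ 𝓗 × (∃₂ λ ℓ M → ℓ ∈ 𝓛 × M Extends ℓ × ⟦ P ⟧ ⊆ ⟦ M ⟧)

  record IsTight (i : ℕ) (X : Pred (Point r) 0ℓ) : Set where
    field
      onVariety : X ⊆ 𝓗
      inside    : ∀ P → P ∈ 𝓗 → P ∈ X →
                  HasCard (points r) (λ P′ → P′ ∈ X × ⟦ P′ ⟧ ⊆ P ^⊥ₕ)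
                          (i * θ (+ ((r ∸ 4) / 2)) (q ^ 2) + q ^ (r ∸ 2))
      outside   : ∀ P → P ∈ 𝓗 → P ∉ X →
                  HasCard (points r) (λ P′ → P′ ∈ X × ⟦ P′ ⟧ ⊆ P ^⊥ₕ)
                          (i * θ (+ ((r ∸ 4) / 2)) (q ^ 2))

{-# OPTIONS --safe #-}
module Submission where

-- A vector of PG(r, q²) is uniquely u + ωv with u, v over 𝔽_q, where τ(ω) = - ω
-- and ω² = δ is a nonsquare of 𝔽_q.  A point P = ⟨u + ωv⟩ of H(r, q²) is either a
-- singular point of Σ, or lies on the extension of a single line ℓ = ⟨u, v⟩ of Σ.
-- In the second case P^⊥ meets Σ in ℓ^⊥, and b(u, u) = δ b(v, v); since δ is a
-- nonsquare, ℓ is then totally singular or nondegenerate, and conversely every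
-- such line carries such a P.  In both cases ℓ^⊥ contains equally many singular
-- points.  Counting the incidences between P^⊥ and the extended lines of the
-- cover, each of which meets P^⊥ in q² + 1 points or in one, shows that the number
-- of points of X in P^⊥ is an affine function, independent of P, of the number of
-- lines of the cover in ℓ^⊥: one of them takes its required value if and only if
-- the other does.  When P is a point of Σ, the number of lines of the cover in P^⊥
-- follows from the covering property, and the required value is automatic.
--
-- The numbers of singular points come from a transversal argument: translation by
-- multiples of a singular x permutes the vectors off x^⊥, and exactly one vector of
-- every orbit is singular.

open import Defs
open import Level using (0ℓ)
open import Algebra.Bundles using (CommutativeMonoid; CommutativeRing)
import Algebra.Properties.CommutativeMonoid.Sum as MonoidSum
import Algebra.Properties.CommutativeSemigroup as CommutativeSemigroup
import Algebra.Properties.CommutativeSemiring.Binomial as Binomial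
import Algebra.Properties.CommutativeSemiring.Exp as CommutativeExp
import Algebra.Properties.Semiring.Exp as Exp
import Algebra.Properties.Semiring.Mult as Mult
import Algebra.Properties.Semiring.Sum as Sum
open import Algebra.Morphism.Structures using (IsRingHomomorphism)
open import Data.Empty using (⊥-elim)
open import Data.Fin.Base as Fin using (Fin; zero; suc; punchIn)
open import Data.Fin.Permutation using (Permutation; permutation)
import Data.Fin.Properties as Fin
open import Data.Integer.Base as ℤ using (ℤ)
import Data.Integer.Properties as ℤ
open import Data.List.Base as List using (List; []; _∷_; cartesianProductWith; deduplicate; filter; length)
import Data.List.Membership.Propositional.Properties as Membership
import Data.List.Properties as List
open import Data.List.Relation.Unary.All as All using (All; []; _∷_)
import Data.List.Relation.Unary.All.Properties as All
open import Data.List.Relation.Unary.AllPairs as AllPairs using (AllPairs; []; _∷_)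
import Data.List.Relation.Unary.AllPairs.Properties as AllPairs
open import Data.List.Relation.Unary.Any as Any using (Any; here; there)
import Data.List.Relation.Unary.Any.Properties as Any
open import Data.List.Relation.Unary.Unique.DecSetoid.Properties using (deduplicate-!)
import Data.List.Relation.Unary.Unique.Propositional.Properties as Unique
open import Data.Maybe.Base using (Maybe; just; nothing)
open import Data.Nat.Base as ℕ using (ℕ; zero; suc)
open import Data.Nat.Combinatorics using (_C_; nCn≡1; k![n∸k]!∣n!)
open import Data.Nat.Combinatorics.Specification using (nCk≡n!/k![n-k]!)
open import Data.Nat.DivMod using (_/_; _%_; m/n*n≡m; m*n/n≡m; m≡m%n+[m/n]*n; m%n<n)
open import Data.Nat.Divisibility using (_∣_; divides; ∣⇒≤; m∣m*n; m%n≡0⇒n∣m)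
open import Data.Nat.Primality using (Prime; euclidsLemma; prime⇒nonTrivial)
import Data.Nat.Properties as ℕ
open import Data.Nat.Solver using (module +-*-Solver)
open import Data.Product.Base using (Σ; ∃; ∃₂; _×_; _,_; proj₁; proj₂)
open import Data.Sum.Base using (_⊎_; inj₁; inj₂; [_,_]′)
open import Data.Unit.Base using (⊤; tt)
open import Data.Vec.Base as Vec using (Vec; []; _∷_; lookup)
open import Data.Vec.Functional using (removeAt)
import Data.Vec.Properties as Vec
open import Function.Base using (_∘_; const)
open import Function.Bundles using (Bijection; _⇔_; mk⇔)
open import Relation.Binary.Bundles using (Setoid; DecSetoid)
open import Relation.Binary.Definitions using (DecidableEquality; _Respects_)
import Relation.Binary.PropositionalEquality as ≡
open import Relation.Nullary.Decidable hiding (map)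
open import Relation.Nullary.Negation using (¬_; contradiction)
open import Relation.Unary using (Pred; Decidable; _∩_; _⊆_; _∈_; _∉_)
open import Relation.Unary.Properties using (_∩?_; ∁?)

-- The parameter m(q² - q) + q + 1 is the size of X divided by θ_{(r-2)/2,q²}: the cover has m
-- θ_{(r-2)/2,q²} lines, each with q² - q points off Σ, and the quadric adds its (q + 1)
-- θ_{(r-2)/2,q²} points. In the affine relation the number of lines in ℓ^⊥ has slope q², which
-- turns the jump q^(r-4) of the dual condition into the jump q^(r-2) of tightness. The dual
-- condition is silent on tangent lines, and these are exactly the lines that yield no P off Σ: a
-- basis u, v with b(u, u) = δ b(v, v) of a line with a single singular point would make δ a square.
-- The obstacle is that ℓ^⊥ is degenerate when ℓ is totally singular. What is carried along is
-- therefore only the proportion 1/q of singular vectors, as in odd dimension; it passes between a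
-- subspace and its intersection with x^⊥ for any singular x in it. All counts stay in the natural
-- numbers: points are counted through their nonzero vectors, and a subtraction is moved to the
-- other side of its equation.

-- Solving ring identities with integer coefficients

module IntegerCoefficients (R : CommutativeRing 0ℓ 0ℓ) where
  open import Data.Integer.Base using (+_; -[1+_])
  open CommutativeRing R
  open import Algebra.Properties.Ring ring using (-‿+-comm; -‿involutive; -‿distribʳ-*; -0#≈0#)
  open import Algebra.Properties.CommutativeSemigroup +-commutativeSemigroup using (interchange)
  open import Algebra.Properties.Semiring.Mult.TCOptimised semiring using (×-homo-+; ×1-homo-*) renaming (_×_ to _×ₙ_)
  open import Algebra.Solver.Ring.AlmostCommutativeRing using (fromCommutativeRing; _-Raw-AlmostCommutative⟶_)
  open import Relation.Binary.Reasoning.Setoid setoid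

  -- Normalisation needs coefficients with decidable equality, which ℤ provides for every ring at
  -- once. The optimised multiples make `fromℤ (+ 1)` compute to `1#`, so that `:1` in a solved
  -- identity reads as `1#` itself.
  fromℤ : ℤ → Carrier
  fromℤ (+ n)      = n ×ₙ 1#
  fromℤ (-[1+ n ]) = - (suc n ×ₙ 1#)

  fromℤ-neg : ∀ i → fromℤ (ℤ.- i) ≈ - fromℤ i
  fromℤ-neg (+ zero)   = sym -0#≈0#
  fromℤ-neg (+ suc n)  = refl
  fromℤ-neg (-[1+ n ]) = sym (-‿involutive _)

  fromℤ-⊖ : ∀ m n → fromℤ (m ℤ.⊖ n) ≈ m ×ₙ 1# - n ×ₙ 1#
  fromℤ-⊖ m       zero    = sym (trans (+-congˡ -0#≈0#) (+-identityʳ _))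
  fromℤ-⊖ zero    (suc n) = sym (+-identityˡ _)
  fromℤ-⊖ (suc m) (suc n) = begin
    fromℤ (suc m ℤ.⊖ suc n)               ≡⟨ ≡.cong fromℤ (ℤ.[1+m]⊖[1+n]≡m⊖n m n) ⟩
    fromℤ (m ℤ.⊖ n)                       ≈⟨ fromℤ-⊖ m n ⟩
    m ×ₙ 1# - n ×ₙ 1#                       ≈⟨ +-identityˡ _ ⟨
    0# + (m ×ₙ 1# - n ×ₙ 1#)                ≈⟨ +-congʳ (-‿inverseʳ 1#) ⟨
    (1# - 1#) + (m ×ₙ 1# - n ×ₙ 1#)         ≈⟨ interchange 1# (- 1#) (m ×ₙ 1#) (- (n ×ₙ 1#)) ⟩
    (1# + m ×ₙ 1#) + (- 1# + - (n ×ₙ 1#))   ≈⟨ +-congˡ (-‿+-comm 1# (n ×ₙ 1#)) ⟩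
    (1# + m ×ₙ 1#) - (1# + n ×ₙ 1#)         ≈⟨ +-cong (×-homo-+ 1# 1 m) (-‿cong (×-homo-+ 1# 1 n)) ⟨
    suc m ×ₙ 1# - suc n ×ₙ 1#               ∎

  fromℤ-+ : ∀ i j → fromℤ (i ℤ.+ j) ≈ fromℤ i + fromℤ j
  fromℤ-+ (+ m)      (+ n)      = ×-homo-+ 1# m n
  fromℤ-+ (+ m)      (-[1+ n ]) = fromℤ-⊖ m (suc n)
  fromℤ-+ (-[1+ m ]) (+ n)      = trans (fromℤ-⊖ n (suc m)) (+-comm _ _)
  fromℤ-+ (-[1+ m ]) (-[1+ n ]) = begin
    - (suc (suc (m ℕ.+ n)) ×ₙ 1#)    ≡⟨ ≡.cong (λ k → - (k ×ₙ 1#)) (ℕ.+-suc (suc m) n) ⟨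
    - ((suc m ℕ.+ suc n) ×ₙ 1#)      ≈⟨ -‿cong (×-homo-+ 1# (suc m) (suc n)) ⟩
    - (suc m ×ₙ 1# + suc n ×ₙ 1#)     ≈⟨ -‿+-comm _ _ ⟨
    - (suc m ×ₙ 1#) - (suc n ×ₙ 1#)   ∎

  private
    *-neg : ∀ i j → fromℤ (i ℤ.* j) ≈ fromℤ i * fromℤ j → fromℤ (i ℤ.* (ℤ.- j)) ≈ fromℤ i * fromℤ (ℤ.- j)
    *-neg i j eq = begin
      fromℤ (i ℤ.* (ℤ.- j))    ≡⟨ ≡.cong fromℤ (ℤ.neg-distribʳ-* i j) ⟨
      fromℤ (ℤ.- (i ℤ.* j))    ≈⟨ fromℤ-neg (i ℤ.* j) ⟩
      - fromℤ (i ℤ.* j)        ≈⟨ -‿cong eq ⟩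
      - (fromℤ i * fromℤ j)    ≈⟨ -‿distribʳ-* _ _ ⟩
      fromℤ i * - fromℤ j      ≈⟨ *-congˡ (fromℤ-neg j) ⟨
      fromℤ i * fromℤ (ℤ.- j)  ∎

    pos-* : ∀ m n → fromℤ (+ m ℤ.* + n) ≈ m ×ₙ 1# * n ×ₙ 1#
    pos-* m n = trans (reflexive (≡.cong fromℤ (≡.sym (ℤ.pos-* m n)))) (×1-homo-* m n)

  fromℤ-* : ∀ i j → fromℤ (i ℤ.* j) ≈ fromℤ i * fromℤ j
  fromℤ-* (+ m)      (+ n)      = pos-* m n
  fromℤ-* (+ m)      (-[1+ n ]) = *-neg (+ m) (+ suc n) (pos-* m (suc n))
  fromℤ-* (-[1+ m ]) j          = begin
    fromℤ (-[1+ m ] ℤ.* j)          ≡⟨ ≡.cong fromℤ (ℤ.*-comm -[1+ m ] j) ⟩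
    fromℤ (j ℤ.* (ℤ.- (+ suc m)))   ≈⟨ *-neg j (+ suc m) (swapped j) ⟩
    fromℤ j * fromℤ -[1+ m ]        ≈⟨ *-comm _ _ ⟩
    fromℤ -[1+ m ] * fromℤ j        ∎
    where
    swapped : ∀ j → fromℤ (j ℤ.* + suc m) ≈ fromℤ j * fromℤ (+ suc m)
    swapped (+ n)      = pos-* n (suc m)
    swapped (-[1+ n ]) = begin
      fromℤ (-[1+ n ] ℤ.* + suc m)        ≡⟨ ≡.cong fromℤ (ℤ.*-comm -[1+ n ] (+ suc m)) ⟩
      fromℤ (+ suc m ℤ.* -[1+ n ])        ≈⟨ *-neg (+ suc m) (+ suc n) (pos-* (suc m) (suc n)) ⟩
      fromℤ (+ suc m) * fromℤ -[1+ n ]    ≈⟨ *-comm _ _ ⟩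
      fromℤ -[1+ n ] * fromℤ (+ suc m)    ∎

  morphism : ℤ.+-*-rawRing -Raw-AlmostCommutative⟶ fromCommutativeRing R
  morphism = record
    { ⟦_⟧    = fromℤ
    ; +-homo = fromℤ-+
    ; *-homo = fromℤ-*
    ; -‿homo = fromℤ-neg
    ; 0-homo = refl
    ; 1-homo = refl
    }

  private
    coefficients≟ : ∀ i j → Maybe (fromℤ i ≈ fromℤ j)
    coefficients≟ i j with i ℤ.≟ j
    ... | yes i≡j = just (reflexive (≡.cong fromℤ i≡j))
    ... | no  _   = nothing

  open import Algebra.Solver.Ring ℤ.+-*-rawRing (fromCommutativeRing R) morphism coefficients≟ public
    using (Polynomial; solve; _:=_; _:+_; _:*_; _:-_; :-_; con)

  :0 :1 : ∀ {n} → Polynomial n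
  :0 = con (+ 0)
  :1 = con (+ 1)

open import Data.Nat.Base using (_+_; _*_; _≤_; _<_; s≤s; z≤n; _∸_; _!)
open ≡ hiding (setoid)

-- Double counting over finite setoids

module Counting where
  open import Data.List.Base using (map; allFin; tabulate; _++_)
  open import Data.List.Properties using (length-tabulate; map-tabulate)
  open import Data.List.Membership.Setoid.Properties using (∈-filter⁺; ∈-filter⁻; ∈-lookup; index-injective)
  open import Data.Nat.Properties hiding (_≟_)
  open import Algebra.Properties.CommutativeSemigroup +-commutativeSemigroup using (interchange)

  private variable
    A B : Set
    P Q : Set

  -- Iverson bracket. Cardinalities are sums of it, so that every double count becomes an instance
  -- of `∑-swap`.
  ⟨_⟩ : Dec P → ℕ
  ⟨ yes _ ⟩ = 1
  ⟨ no _ ⟩  = 0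

  ⟨⟩-yes : (d : Dec P) → P → ⟨ d ⟩ ≡ 1
  ⟨⟩-yes (yes _) p = refl
  ⟨⟩-yes (no ¬p) p = contradiction p ¬p

  ⟨⟩-no : (d : Dec P) → ¬ P → ⟨ d ⟩ ≡ 0
  ⟨⟩-no (yes p) ¬p = contradiction p ¬p
  ⟨⟩-no (no _)  ¬p = refl

  ⟨⟩-cong : (d : Dec P) (e : Dec Q) → (P → Q) → (Q → P) → ⟨ d ⟩ ≡ ⟨ e ⟩
  ⟨⟩-cong (yes p) e f g = sym (⟨⟩-yes e (f p))
  ⟨⟩-cong (no ¬p) e f g = sym (⟨⟩-no e (¬p ∘ g))

  ⟨⟩-mono : (d : Dec P) (e : Dec Q) → (P → Q) → ⟨ d ⟩ ≤ ⟨ e ⟩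
  ⟨⟩-mono (yes p) e f = ≤-reflexive (sym (⟨⟩-yes e (f p)))
  ⟨⟩-mono (no ¬p) e f = z≤n

  ⟨⟩-× : (d : Dec P) (e : Dec Q) → ⟨ d ×-dec e ⟩ ≡ ⟨ d ⟩ * ⟨ e ⟩
  ⟨⟩-× (yes _) (yes _) = refl
  ⟨⟩-× (yes _) (no _)  = refl
  ⟨⟩-× (no _)  _       = refl

  ⟨⟩-split : (d : Dec P) (e : Dec Q) → ⟨ d ⟩ ≡ ⟨ d ×-dec e ⟩ + ⟨ d ×-dec ¬? e ⟩
  ⟨⟩-split (yes _) (yes _) = refl
  ⟨⟩-split (yes _) (no _)  = refl
  ⟨⟩-split (no _)  _       = refl

  -- A summand may be rewritten under the property that its indicator guards; off that property both
  -- sides are 0.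
  ⟨⟩*-cong : (d : Dec P) {m n : ℕ} → (P → m ≡ n) → ⟨ d ⟩ * m ≡ ⟨ d ⟩ * n
  ⟨⟩*-cong (yes p) f = cong (_+ 0) (f p)
  ⟨⟩*-cong (no _)  f = refl

  ∑ : List A → (A → ℕ) → ℕ
  ∑ []       f = 0
  ∑ (x ∷ xs) f = f x + ∑ xs f

  syntax ∑ xs (λ x → e) = ∑[ x ∈ xs ] e

  ∑-cong : (xs : List A) {f g : A → ℕ} → (∀ x → f x ≡ g x) → ∑ xs f ≡ ∑ xs g
  ∑-cong []       eq = refl
  ∑-cong (x ∷ xs) eq = cong₂ _+_ (eq x) (∑-cong xs eq)

  ∑-cong-All : {P : Pred A 0ℓ} {xs : List A} {f g : A → ℕ} → All P xs → (∀ x → P x → f x ≡ g x) → ∑ xs f ≡ ∑ xs g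
  ∑-cong-All []         eq = refl
  ∑-cong-All (px ∷ pxs) eq = cong₂ _+_ (eq _ px) (∑-cong-All pxs eq)

  ∑-mono : (xs : List A) {f g : A → ℕ} → (∀ x → f x ≤ g x) → ∑ xs f ≤ ∑ xs g
  ∑-mono []       le = z≤n
  ∑-mono (x ∷ xs) le = +-mono-≤ (le x) (∑-mono xs le)

  ∑-+ : (xs : List A) (f g : A → ℕ) → ∑ xs (λ x → f x + g x) ≡ ∑ xs f + ∑ xs g
  ∑-+ []       f g = refl
  ∑-+ (x ∷ xs) f g = trans (cong (f x + g x +_) (∑-+ xs f g)) (interchange (f x) (g x) (∑ xs f) (∑ xs g))

  ∑-*ˡ : (xs : List A) (c : ℕ) (f : A → ℕ) → ∑ xs (λ x → c * f x) ≡ c * ∑ xs f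
  ∑-*ˡ []       c f = sym (*-zeroʳ c)
  ∑-*ˡ (x ∷ xs) c f = trans (cong (c * f x +_) (∑-*ˡ xs c f)) (sym (*-distribˡ-+ c (f x) (∑ xs f)))

  ∑-*ʳ : (xs : List A) (c : ℕ) (f : A → ℕ) → ∑ xs (λ x → f x * c) ≡ ∑ xs f * c
  ∑-*ʳ xs c f = trans (∑-cong xs (λ x → *-comm (f x) c)) (trans (∑-*ˡ xs c f) (*-comm c (∑ xs f)))

  ∑-const : (xs : List A) (c : ℕ) → ∑ xs (const c) ≡ length xs * c
  ∑-const []       c = refl
  ∑-const (x ∷ xs) c = cong (c +_) (∑-const xs c)

  ∑-zero : (xs : List A) → ∑ xs (const 0) ≡ 0
  ∑-zero xs = trans (∑-const xs 0) (*-zeroʳ (length xs))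

  ∑-swap : (xs : List A) (ys : List B) (f : A → B → ℕ) →
           ∑ xs (λ x → ∑ ys (f x)) ≡ ∑ ys (λ y → ∑ xs (λ x → f x y))
  ∑-swap []       ys f = sym (∑-zero ys)
  ∑-swap (x ∷ xs) ys f = trans (cong (∑ ys (f x) +_) (∑-swap xs ys f)) (sym (∑-+ ys (f x) _))

  ∑-++ : (xs ys : List A) (f : A → ℕ) → ∑ (xs ++ ys) f ≡ ∑ xs f + ∑ ys f
  ∑-++ []       ys f = refl
  ∑-++ (x ∷ xs) ys f = trans (cong (f x +_) (∑-++ xs ys f)) (sym (+-assoc (f x) _ _))

  ∑-map : (g : B → A) (xs : List B) (f : A → ℕ) → ∑ (map g xs) f ≡ ∑ xs (f ∘ g)
  ∑-map g []       f = refl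
  ∑-map g (x ∷ xs) f = cong (f (g x) +_) (∑-map g xs f)

  ∑-tabulate : ∀ {n} (g : Fin n → A) (f : A → ℕ) → ∑ (tabulate g) f ≡ ∑ (allFin n) (f ∘ g)
  ∑-tabulate g f = trans (cong (λ xs → ∑ xs f) (sym (map-tabulate (λ i → i) g))) (∑-map g (allFin _) f)

  ∑-cartesianProductWith : {C : Set} (g : A → B → C) (xs : List A) (ys : List B) (f : C → ℕ) →
    ∑ (cartesianProductWith g xs ys) f ≡ ∑ xs (λ x → ∑ ys (λ y → f (g x y)))
  ∑-cartesianProductWith g []       ys f = refl
  ∑-cartesianProductWith g (x ∷ xs) ys f =
    trans (∑-++ (map (g x) ys) _ f)
          (cong₂ _+_ (∑-map (g x) ys f) (∑-cartesianProductWith g xs ys f))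

  ∑≢0⇒Any : {P : Pred A 0ℓ} (P? : Decidable P) (xs : List A) → ∑ xs (λ x → ⟨ P? x ⟩) ≢ 0 → Any P xs
  ∑≢0⇒Any P? []       n = contradiction refl n
  ∑≢0⇒Any P? (x ∷ xs) n with P? x
  ... | yes p = here p
  ... | no _  = there (∑≢0⇒Any P? xs n)

  count-filter : {P Q : Pred A 0ℓ} (P? : Decidable P) (Q? : Decidable Q) (xs : List A) →
    ∑ (filter P? xs) (λ x → ⟨ Q? x ⟩) ≡ ∑ xs (λ x → ⟨ P? x ×-dec Q? x ⟩)
  count-filter P? Q? []       = refl
  count-filter P? Q? (x ∷ xs) with P? x
  ... | yes p = cong₂ _+_ (⟨⟩-cong (Q? x) (yes p ×-dec Q? x) (p ,_) proj₂) (count-filter P? Q? xs)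
  ... | no _  = count-filter P? Q? xs

  length-filter-∑ : {P : Pred A 0ℓ} (P? : Decidable P) (xs : List A) →
    length (filter P? xs) ≡ ∑ xs (λ x → ⟨ P? x ⟩)
  length-filter-∑ P? []       = refl
  length-filter-∑ P? (x ∷ xs) with P? x
  ... | yes _ = cong suc (length-filter-∑ P? xs)
  ... | no _  = length-filter-∑ P? xs

  -- The list is exhaustive and free of repetitions only up to `_≈_`, because points and lines are
  -- bases identified by their span.
  record Finite (S : DecSetoid 0ℓ 0ℓ) : Set where
    open DecSetoid S renaming (Carrier to X; refl to ≈-refl; sym to ≈-sym; trans to ≈-trans; reflexive to ≈-reflexive)
    field
      elements : List X
      unique   : AllPairs (λ x y → ¬ (x ≈ y)) elements
      complete : ∀ a → Any (a ≈_) elements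

    count : {P : Pred X 0ℓ} → Decidable P → ℕ
    count P? = ∑ elements (λ x → ⟨ P? x ⟩)

    count-≈ : ∀ a → count (λ x → x ≟ a) ≡ 1
    count-≈ a = go unique (complete a)
      where
      none : ∀ {x xs} → a ≈ x → All (λ y → ¬ (x ≈ y)) xs → ∑ xs (λ x → ⟨ x ≟ a ⟩) ≡ 0
      none a≈x []       = refl
      none a≈x (_∷_ {y} ¬p ps) with y ≟ a
      ... | yes y≈a = contradiction (≈-sym (≈-trans y≈a a≈x)) ¬p
      ... | no _    = none a≈x ps
      absent : ∀ {x xs} → All (λ y → ¬ (x ≈ y)) xs → Any (a ≈_) xs → ¬ (x ≈ a)
      absent (x≉y ∷ _) (here a≈y) x≈a = x≉y (≈-trans x≈a a≈y)
      absent (_ ∷ ps)  (there i)  x≈a = absent ps i x≈a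
      go : ∀ {xs} → AllPairs (λ x y → ¬ (x ≈ y)) xs → Any (a ≈_) xs → ∑ xs (λ x → ⟨ x ≟ a ⟩) ≡ 1
      go (_∷_ {x} ps u) (here a≈x) = cong₂ _+_ (⟨⟩-yes (x ≟ a) (≈-sym a≈x)) (none a≈x ps)
      go (_∷_ {x} ps u) (there i)  = cong₂ _+_ (⟨⟩-no (x ≟ a) (absent ps i)) (go u i)

    count-unique : {P : Pred X 0ℓ} (P? : Decidable P) → P Respects _≈_ → ∀ {a} → P a → (∀ {x} → P x → x ≈ a) → count P? ≡ 1
    count-unique P? resp {a} pa unq =
      trans (∑-cong elements λ x → ⟨⟩-cong (P? x) (x ≟ a) unq (λ x≈a → resp (≈-sym x≈a) pa)) (count-≈ a)

    ∃? : {P : Pred X 0ℓ} → Decidable P → P Respects _≈_ → Dec (∃ P)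
    ∃? P? resp = map′ Any.satisfied (λ (a , pa) → Any.map (λ a≈x → resp a≈x pa) (complete a)) (Any.any? P? elements)

    sift : ∀ a {f : X → ℕ} → (∀ {x} → x ≈ a → f x ≡ f a) → ∑[ x ∈ elements ] (⟨ x ≟ a ⟩ * f x) ≡ f a
    sift a {f} f-cong = begin
      ∑[ x ∈ elements ] (⟨ x ≟ a ⟩ * f x)  ≡⟨ ∑-cong elements (λ x → ⟨⟩*-cong (x ≟ a) f-cong) ⟩
      ∑[ x ∈ elements ] (⟨ x ≟ a ⟩ * f a)  ≡⟨ ∑-*ʳ elements (f a) _ ⟩
      count (_≟ a) * f a                     ≡⟨ cong (_* f a) (count-≈ a) ⟩
      1 * f a                                ≡⟨ *-identityˡ (f a) ⟩
      f a                                    ∎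
      where open ≡-Reasoning

    module _ {P : Pred X 0ℓ} (P? : Decidable P) (resp : P Respects _≈_) where

      -- Pairs of an element x and an index i with x ≈ `from i` are counted twice: an x in P has
      -- exactly one index, an x outside P has none, and every index has one x.
      HasCard⇒count : ∀ {n} → HasCard setoid P n → count P? ≡ n
      HasCard⇒count {n} card = begin
        count P?                                                    ≡⟨ ∑-cong elements pointwise ⟩
        ∑[ x ∈ elements ] ∑[ i ∈ allFin n ] ⟨ x ≟ proj₁ (from i) ⟩  ≡⟨ ∑-swap elements (allFin n) _ ⟩
        ∑[ i ∈ allFin n ] count (_≟ proj₁ (from i))  ≡⟨ ∑-cong (allFin n) (λ i → count-≈ (proj₁ (from i))) ⟩
        ∑[ i ∈ allFin n ] 1                                         ≡⟨ ∑-const (allFin n) 1 ⟩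
        length (allFin n) * 1                                       ≡⟨ *-identityʳ _ ⟩
        length (allFin n)                                           ≡⟨ length-tabulate (λ i → i) ⟩
        n                                                           ∎
        where
        open ≡-Reasoning
        open Bijection card using (to; injective; surjective) renaming (cong to to-cong)
        from : Fin n → Σ X P
        from i = proj₁ (surjective i)
        to-from : ∀ i → to (from i) ≡ i
        to-from i = proj₂ (surjective i) ≈-refl
        one : ∀ {n} (j : Fin n) → ∑[ i ∈ allFin n ] ⟨ i Fin.≟ j ⟩ ≡ 1
        one {suc n} zero    = cong suc (trans (∑-tabulate {n = n} suc (λ i → ⟨ i Fin.≟ zero ⟩)) (∑-zero (allFin n)))
        one {suc n} (suc j) = trans (∑-tabulate {n = n} suc (λ i → ⟨ i Fin.≟ suc j ⟩))
          (trans (∑-cong (allFin n) λ i → ⟨⟩-cong (suc i Fin.≟ suc j) (i Fin.≟ j) Fin.suc-injective (cong suc)) (one j))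
        pointwise : ∀ x → ⟨ P? x ⟩ ≡ ∑[ i ∈ allFin n ] ⟨ x ≟ proj₁ (from i) ⟩
        pointwise x with P? x
        ... | yes px = sym (trans (∑-cong (allFin n) (λ i → ⟨⟩-cong (x ≟ proj₁ (from i)) (i Fin.≟ to (x , px))
                         (λ eq → trans (sym (to-from i)) (to-cong (≈-sym eq)))
                         (λ { refl → injective (sym (to-from (to (x , px)))) }))) (one (to (x , px))))
        ... | no ¬px = sym (trans (∑-cong (allFin n) (λ i → ⟨⟩-no (x ≟ proj₁ (from i))
            (λ eq → ¬px (resp (≈-sym eq) (proj₂ (from i)))))) (∑-zero (allFin n)))

      -- The bijection sends an element to its position in the filtered list. Absence of repetitions
      -- makes the position depend on the class alone.
      count⇒HasCard : ∀ {n} → count P? ≡ n → HasCard setoid P n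
      count⇒HasCard {n} eq = subst (HasCard setoid P) (trans (length-filter-∑ P? elements) eq) record
        { to        = λ (x , px) → Any.index (member px)
        ; cong      = λ {x} {y} x≈y → index-cong unique′ (member (proj₂ x)) (member (proj₂ y)) x≈y
        ; bijective = (λ {x} {y} → index-injective setoid (member (proj₂ x)) (member (proj₂ y)))
                    , λ i → (List.lookup xs i , proj₂ (∈-filter⁻ setoid P? resp {xs = elements} (∈-lookup setoid xs i)))
                          , λ {z} z≈ → trans (index-cong unique′ (member (proj₂ z)) (∈-lookup setoid xs i) z≈)
                              (index-∈-lookup xs i)
        }
        where
        xs = filter P? elements
        unique′ = AllPairs.filter⁺ P? unique
        member : ∀ {a} → P a → Any (a ≈_) xs
        member {a} pa = ∈-filter⁺ setoid P? resp (complete a) pa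
        index-∈-lookup : ∀ ys i → Any.index (∈-lookup setoid ys i) ≡ i
        index-∈-lookup (y ∷ ys) zero    = refl
        index-∈-lookup (y ∷ ys) (suc i) = cong suc (index-∈-lookup ys i)
        apart : ∀ {a b x ys} → All (λ y → ¬ (x ≈ y)) ys → a ≈ x → Any (b ≈_) ys → ¬ (a ≈ b)
        apart (x≉y ∷ _) a≈x (here b≈y) a≈b = x≉y (≈-trans (≈-sym a≈x) (≈-trans a≈b b≈y))
        apart (_ ∷ ps)  a≈x (there i)  a≈b = apart ps a≈x i a≈b
        index-cong : ∀ {ys a b} → AllPairs (λ x y → ¬ (x ≈ y)) ys → (p : Any (a ≈_) ys)
            (q : Any (b ≈_) ys) → a ≈ b → Any.index p ≡ Any.index q
        index-cong u       (here _)    (here _)    a≈b = refl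
        index-cong (p ∷ u) (here a≈x)  (there j)   a≈b = contradiction a≈b (apart p a≈x j)
        index-cong (p ∷ u) (there i)   (here b≈x)  a≈b = contradiction (≈-sym a≈b) (apart p b≈x i)
        index-cong (p ∷ u) (there i)   (there j)   a≈b = cong suc (index-cong u i j a≈b)

    -- Membership in P amounts to equality with one of the finitely many enumerated elements, and
    -- that equality is decidable.
    HasCard⇒decidable : {P : Pred X 0ℓ} → P Respects _≈_ → ∀ {n} → HasCard setoid P n → Decidable P
    HasCard⇒decidable {P} resp {n} card x = map′ back hit (Fin.any? (λ i → x ≟ proj₁ (from i)))
      where
      open Bijection card using (to; injective; surjective)
      from : Fin n → Σ X P
      from i = proj₁ (surjective i)
      back : (∃ λ i → x ≈ proj₁ (from i)) → P x
      back (i , x≈) = resp (≈-sym x≈) (proj₂ (from i))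
      hit : P x → ∃ λ i → x ≈ proj₁ (from i)
      hit px = to (x , px) , injective {x , px} {from (to (x , px))}
          (sym (proj₂ (surjective (to (x , px))) {from (to (x , px))} ≈-refl))

    nonzero⇒∃ : {P : Pred X 0ℓ} (P? : Decidable P) → count P? ≢ 0 → ∃ P
    nonzero⇒∃ P? n = Any.satisfied (∑≢0⇒Any P? elements n)

  module _ {S T : DecSetoid 0ℓ 0ℓ} (FS : Finite S) (FT : Finite T) where
    private
      module S = DecSetoid S
      module T = DecSetoid T
      module FS = Finite FS
      module FT = Finite FT

    -- The two implications make `g` and `h` inverse bijections up to the equalities. Inserting the
    -- indicator of y ≈ g x and exchanging the sums transports the sum.
    ∑-reindex : (g : S.Carrier → T.Carrier) (h : T.Carrier → S.Carrier) →
      (∀ {x y} → T._≈_ (g x) y → S._≈_ x (h y)) → (∀ {x y} → S._≈_ x (h y) → T._≈_ (g x) y) →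
      (f : T.Carrier → ℕ) → (∀ {x y} → T._≈_ x y → f x ≡ f y) →
      ∑ FS.elements (λ x → f (g x)) ≡ ∑ FT.elements f
    ∑-reindex g h to from f f-cong = begin
      ∑[ x ∈ FS.elements ] f (g x)
        ≡⟨ ∑-cong FS.elements (λ x → FT.sift (g x) f-cong) ⟨
      ∑[ x ∈ FS.elements ] ∑[ y ∈ FT.elements ] (⟨ y T.≟ g x ⟩ * f y)
        ≡⟨ ∑-swap FS.elements FT.elements _ ⟩
      ∑[ y ∈ FT.elements ] ∑[ x ∈ FS.elements ] (⟨ y T.≟ g x ⟩ * f y)
        ≡⟨ ∑-cong FT.elements (λ y → trans (∑-*ʳ FS.elements (f y) _) (cong (_* f y)
             (trans (∑-cong FS.elements λ x → ⟨⟩-cong (y T.≟ g x) (x S.≟ h y) (λ e → to (T.sym e)) (λ e → T.sym (from e)))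
                    (FS.count-≈ (h y))))) ⟩
      ∑[ y ∈ FT.elements ] (1 * f y)
        ≡⟨ ∑-cong FT.elements (λ y → *-identityˡ (f y)) ⟩
      ∑ FT.elements f ∎
      where open ≡-Reasoning

  module _ {S : DecSetoid 0ℓ 0ℓ} (fin : Finite S) where
    open DecSetoid S renaming (Carrier to X; sym to ≈-sym; trans to ≈-trans)
    open Finite fin

    distinct⇒2≤count : {P : Pred X 0ℓ} (P? : Decidable P) → P Respects _≈_ → ∀ {a b} → P a → P b → ¬ (a ≈ b) → 2 ≤ count P?
    distinct⇒2≤count P? resp {a} {b} pa pb a≉b = begin
      2                                                    ≡⟨ cong₂ _+_ (count-≈ a) (count-≈ b) ⟨
      count (_≟ a) + count (_≟ b)                          ≡⟨ ∑-+ elements _ _ ⟨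
      ∑[ x ∈ elements ] (⟨ x ≟ a ⟩ + ⟨ x ≟ b ⟩)            ≤⟨ ∑-mono elements pointwise ⟩
      count P?                                             ∎
      where
      open ≤-Reasoning
      pointwise : ∀ x → ⟨ x ≟ a ⟩ + ⟨ x ≟ b ⟩ ≤ ⟨ P? x ⟩
      pointwise x with x ≟ a
      ... | yes x≈a = ≤-reflexive (trans (cong suc (⟨⟩-no (x ≟ b) (λ x≈b → a≉b (≈-trans (≈-sym x≈a) x≈b))))
          (sym (⟨⟩-yes (P? x) (resp (≈-sym x≈a) pa))))
      ... | no _    = ⟨⟩-mono (x ≟ b) (P? x) (λ x≈b → resp (≈-sym x≈b) pb)

    2≤count⇒≉ : {P : Pred X 0ℓ} (P? : Decidable P) → 2 ≤ count P? → ∀ a → ∃ λ x → P x × ¬ (x ≈ a)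
    2≤count⇒≉ P? 2≤ a with Any.any? (λ x → P? x ×-dec ¬? (x ≟ a)) elements
    ... | yes p = Any.satisfied p
    ... | no ¬p = contradiction (≤-trans 2≤ (≤-trans (bound elements (λ i → ¬p i)) (≤-reflexive (count-≈ a)))) λ { (s≤s ()) }
      where
      bound : ∀ xs → ¬ Any (λ x → _ × ¬ (x ≈ a)) xs → ∑[ x ∈ xs ] ⟨ P? x ⟩ ≤ ∑[ x ∈ xs ] ⟨ x ≟ a ⟩
      bound []       ¬p = z≤n
      bound (x ∷ xs) ¬p = +-mono-≤ (⟨⟩-mono (P? x) (x ≟ a) (λ px → decidable-stable (x ≟ a)
          (λ x≉a → ¬p (here (px , x≉a))))) (bound xs (λ i → ¬p (there i)))

    count-cong : {P Q : Pred X 0ℓ} (P? : Decidable P) (Q? : Decidable Q) → (∀ {x} → P x → Q x) →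
        (∀ {x} → Q x → P x) → count P? ≡ count Q?
    count-cong P? Q? f g = ∑-cong elements (λ x → ⟨⟩-cong (P? x) (Q? x) f g)

    count-split : {P Q : Pred X 0ℓ} (P? : Decidable P) (Q? : Decidable Q) → count P? ≡ count (P? ∩? Q?) + count (P? ∩? ∁? Q?)
    count-split P? Q? = trans (∑-cong elements (λ x → ⟨⟩-split (P? x) (Q? x))) (∑-+ elements _ _)

    count-pair : {P : Pred X 0ℓ} (P? : Decidable P) → P Respects _≈_ → ∀ {a b} → P a → P b → ¬ (a ≈ b) →
        (∀ {x} → P x → x ≈ a ⊎ x ≈ b) → count P? ≡ 2
    count-pair P? resp {a} {b} pa pb a≉b only = ≤-antisym upper (distinct⇒2≤count P? resp pa pb a≉b)
      where
      open ≤-Reasoning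
      pointwise : ∀ x (d : Dec _) → ⟨ d ⟩ ≤ ⟨ x ≟ a ⟩ + ⟨ x ≟ b ⟩
      pointwise x (no _)   = z≤n
      pointwise x (yes px) with only px
      ... | inj₁ x≈a = ≤-trans (≤-reflexive (sym (⟨⟩-yes (x ≟ a) x≈a))) (m≤m+n _ _)
      ... | inj₂ x≈b = ≤-trans (≤-reflexive (sym (⟨⟩-yes (x ≟ b) x≈b))) (m≤n+m _ _)
      upper : count P? ≤ 2
      upper = begin
        count P?                                       ≤⟨ ∑-mono elements (λ x → pointwise x (P? x)) ⟩
        ∑[ x ∈ elements ] (⟨ x ≟ a ⟩ + ⟨ x ≟ b ⟩)      ≡⟨ ∑-+ elements _ _ ⟩
        count (_≟ a) + count (_≟ b)                    ≡⟨ cong₂ _+_ (count-≈ a) (count-≈ b) ⟩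
        2                                              ∎

open Counting

-- Vectors and subspaces over a finite field

vec-finite : {A : Set} {_≟_ : DecidableEquality A} → Finite (decSetoid _≟_) → ∀ n → Finite
    (decSetoid {A = Vec A n} (Vec.≡-dec _≟_))
vec-finite fin zero    = record { elements = [] ∷ [] ; unique = [] ∷ [] ; complete = λ { [] → here refl } }
vec-finite fin (suc n) = record
  { elements = cartesianProductWith _∷_ F.elements Fⁿ.elements
  ; unique   = Unique.cartesianProductWith⁺ _∷_ Vec.∷-injective F.unique Fⁿ.unique
  ; complete = λ { (a ∷ as) → Membership.∈-cartesianProductWith⁺ _∷_ (F.complete a) (Fⁿ.complete as) }
  }
  where
  module F = Finite fin
  module Fⁿ = Finite (vec-finite fin n)

length-vec-finite : {A : Set} {_≟_ : DecidableEquality A} (fin : Finite (decSetoid _≟_)) → ∀ n →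
  length (Finite.elements (vec-finite fin n)) ≡ length (Finite.elements fin) ℕ.^ n
length-vec-finite fin zero    = refl
length-vec-finite fin (suc n) = begin
  length xs                                ≡⟨ ℕ.*-identityʳ _ ⟨
  length xs * 1                            ≡⟨ ∑-const xs 1 ⟨
  ∑ xs (const 1)                           ≡⟨ ∑-cartesianProductWith _∷_ F.elements Fⁿ.elements (const 1) ⟩
  ∑ F.elements (λ _ → ∑ Fⁿ.elements (const 1))  ≡⟨ ∑-const F.elements _ ⟩
  length F.elements * ∑ Fⁿ.elements (const 1)  ≡⟨ cong (length F.elements *_)
      (trans (∑-const Fⁿ.elements 1) (ℕ.*-identityʳ _)) ⟩
  length F.elements * length Fⁿ.elements   ≡⟨ cong (length F.elements *_) (length-vec-finite fin n) ⟩
  length F.elements ℕ.^ suc n                ∎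
  where
  open ≡-Reasoning
  module F = Finite fin
  module Fⁿ = Finite (vec-finite fin n)
  xs = Finite.elements (vec-finite fin (suc n))

module FieldTheory {q} (F : FiniteField q) where
  open FiniteField F public
  open Projective F public
  open IntegerCoefficients commutativeRing public
  open CommutativeRing commutativeRing public using
    ( +-assoc; +-comm; +-identityˡ; +-identityʳ; -‿inverseˡ; -‿inverseʳ
    ; *-assoc; *-comm; *-identityˡ; *-identityʳ; distribˡ; distribʳ; zeroˡ; zeroʳ )

  private module order = Bijection order

  infix 4 _≟_ _≟ᵛ_
  _≟_ : DecidableEquality Carrier
  x ≟ y = map′ order.injective (cong order.to) (order.to x Fin.≟ order.to y)

  scalars : Finite (decSetoid _≟_)
  scalars = record
    { elements = List.tabulate from
    ; unique   = Unique.tabulate⁺ λ {i} {j} eq → trans (sym (to-from i)) (trans (cong order.to eq) (to-from j))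
    ; complete = λ a → Any.tabulate⁺ (order.to a) (order.injective (sym (to-from (order.to a))))
    }
    where
    from : Fin q → Carrier
    from i = proj₁ (order.surjective i)
    to-from : ∀ i → order.to (from i) ≡ i
    to-from i = proj₂ (order.surjective i) refl
  module scalars = Finite scalars

  length-scalars : length scalars.elements ≡ q
  length-scalars = List.length-tabulate _

  _≟ᵛ_ : ∀ {n} → DecidableEquality (Vector n)
  _≟ᵛ_ = Vec.≡-dec _≟_

  vectors : ∀ n → Finite (decSetoid {A = Vector n} _≟ᵛ_)
  vectors = vec-finite scalars
  module vectors {n} = Finite (vectors n)

  length-vectors : ∀ n → length (vectors.elements {n}) ≡ q ℕ.^ n
  length-vectors n = trans (length-vec-finite scalars n) (cong (ℕ._^ n) length-scalars)

  resp≡ : {A : Set} {P : Pred A 0ℓ} → P Respects _≡_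
  resp≡ refl p = p

  ∃ᵛ? : ∀ {n} {P : Pred (Vector n) 0ℓ} → Decidable P → Dec (∃ P)
  ∃ᵛ? P? = vectors.∃? P? resp≡

  ∀ᵛ? : ∀ {n} {P Q : Pred (Vector n) 0ℓ} → Decidable P → Decidable Q → Dec (P ⊆ Q)
  ∀ᵛ? P? Q? = map′ (λ ¬∃ {x} px → decidable-stable (Q? x) (λ ¬q → ¬∃ (x , px , ¬q))) (λ P⊆Q (x , px , ¬q) → ¬q (P⊆Q px))
                   (¬? (∃ᵛ? (P? ∩? ∁? Q?)))

  module _ {n k : ℕ} where
    infix 4 _∈?_
    _∈?_ : ∀ x (S : Subspace n k) → Dec (x ∈ ⟦ S ⟧)
    x ∈? S = ∃ᵛ? λ cs → x ≟ᵛ combination cs (Subspace.basis S)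

    subspaces-decSetoid : DecSetoid 0ℓ 0ℓ
    subspaces-decSetoid = record
      { isDecEquivalence = record
        { isEquivalence = Setoid.isEquivalence (subspaces n k)
        ; _≟_ = λ S T → ∀ᵛ? (_∈? S) (_∈? T) ×-dec ∀ᵛ? (_∈? T) (_∈? S)
        }
      }

    private
      Independent : Vec (Vector n) k → Set
      Independent vs = ∀ {cs} → combination cs vs ≡ 0ᵛ → cs ≡ 0ᵛ

      spans : List (Vec (Vector n) k) → List (Subspace n k)
      spans []         = []
      spans (vs ∷ vss) with ∀ᵛ? {P = λ cs → combination cs vs ≡ 0ᵛ} (λ cs → combination cs vs ≟ᵛ 0ᵛ) (_≟ᵛ 0ᵛ)
      ... | yes ind = record { basis = vs ; independent = λ cs → ind {cs} } ∷ spans vss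
      ... | no _    = spans vss

      ∈-spans : ∀ (S : Subspace n k) {vss} → Any (Subspace.basis S ≡_) vss → Any (Setoid._≈_ (subspaces n k) S) (spans vss)
      ∈-spans S {vs ∷ vss} i with ∀ᵛ? {P = λ cs → combination cs vs ≡ 0ᵛ} (λ cs → combination cs vs ≟ᵛ 0ᵛ) (_≟ᵛ 0ᵛ) | i
      ... | yes _  | here refl = here ((λ x∈ → x∈) , (λ x∈ → x∈))
      ... | yes _  | there j   = there (∈-spans S j)
      ... | no ¬ind | here refl = ⊥-elim (¬ind (λ {cs} → Subspace.independent S cs))
      ... | no _   | there j   = ∈-spans S j

      bases = vec-finite (vectors n) k

    -- All k-tuples of vectors are tested for independence, and bases with the same span are then
    -- merged.
    all-subspaces : Finite subspaces-decSetoid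
    all-subspaces = record
      { elements = deduplicate (DecSetoid._≟_ subspaces-decSetoid) (spans (Finite.elements bases))
      ; unique   = deduplicate-! subspaces-decSetoid _
      ; complete = λ S → Any.deduplicate⁺ (DecSetoid._≟_ subspaces-decSetoid)
          (λ (y⊆z , z⊆y) (S⊆z , z⊆S) → (λ x∈ → z⊆y (S⊆z x∈)) , (λ x∈ → z⊆S (y⊆z x∈)))
              (∈-spans S (Finite.complete bases (Subspace.basis S)))
      }

  inverse : ∀ {x} → x ≢ 0# → Carrier
  inverse {x} x≢0 = proj₁ (invertible x x≢0)

  inverseʳ : ∀ {x} (x≢0 : x ≢ 0#) → x · inverse x≢0 ≡ 1#
  inverseʳ {x} x≢0 = proj₂ (invertible x x≢0)

  ·-cancelˡ : ∀ {x y z} → x ≢ 0# → x · y ≡ x · z → y ≡ z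
  ·-cancelˡ {x} {y} {z} x≢0 eq = begin
    y              ≡⟨ *-identityˡ y ⟨
    1# · y         ≡⟨ cong (_· y) (inverseʳ x≢0) ⟨
    x · i · y      ≡⟨ solve 3 (λ x i y → x :* i :* y := i :* (x :* y)) refl x i y ⟩
    i · (x · y)    ≡⟨ cong (i ·_) eq ⟩
    i · (x · z)    ≡⟨ solve 3 (λ x i y → x :* i :* y := i :* (x :* y)) refl x i z ⟨
    x · i · z      ≡⟨ cong (_· z) (inverseʳ x≢0) ⟩
    1# · z         ≡⟨ *-identityˡ z ⟩
    z              ∎
    where
    open ≡-Reasoning
    i = inverse x≢0

  ·≡0 : ∀ {x y} → x ≢ 0# → x · y ≡ 0# → y ≡ 0#
  ·≡0 {x} x≢0 eq = ·-cancelˡ x≢0 (trans eq (sym (zeroʳ x)))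

  ·≢0 : ∀ {x y} → x ≢ 0# → y ≢ 0# → x · y ≢ 0#
  ·≢0 x≢0 y≢0 eq = y≢0 (·≡0 x≢0 eq)

  neg≡0 : ∀ {x} → - x ≡ 0# → x ≡ 0#
  neg≡0 {x} eq = trans (solve 1 (λ x → x := :- (:- x)) refl x) (trans (cong -_ eq) (solve 0 (:- :0 := :0) refl))

  -≡0 : ∀ {x y} → x - y ≡ 0# → x ≡ y
  -≡0 {x} {y} eq = trans (solve 2 (λ x y → x := (x :- y) :+ y) refl x y) (trans (cong (_⊕ y) eq) (+-identityˡ y))

  ≡⇒-≡0 : ∀ {x y} → x ≡ y → x - y ≡ 0#
  ≡⇒-≡0 {x} refl = -‿inverseʳ x

  ext : ∀ {n} {x y : Vector n} → (∀ i → lookup x i ≡ lookup y i) → x ≡ y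
  ext {x = x} {y} eq = trans (sym (Vec.tabulate∘lookup x)) (trans (Vec.tabulate-cong eq) (Vec.tabulate∘lookup y))

  -- Vector expressions: an identity between them is checked entrywise.
  infixl 6 _⊞_
  infixr 7 _⊡_
  data VectorExpr (n : ℕ) : Set where
    ⌜_⌝ : Vector n → VectorExpr n
    𝟎   : VectorExpr n
    _⊞_ : VectorExpr n → VectorExpr n → VectorExpr n
    _⊡_ : Carrier → VectorExpr n → VectorExpr n

  eval : ∀ {n} → VectorExpr n → Vector n
  eval ⌜ x ⌝   = x
  eval 𝟎       = 0ᵛ
  eval (e ⊞ f) = eval e +ᵛ eval f
  eval (c ⊡ e) = c ·ᵛ eval e

  entry : ∀ {n} → VectorExpr n → Fin n → Carrier
  entry ⌜ x ⌝   i = lookup x i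
  entry 𝟎       i = 0#
  entry (e ⊞ f) i = entry e i ⊕ entry f i
  entry (c ⊡ e) i = c · entry e i

  lookup-eval : ∀ {n} (e : VectorExpr n) i → lookup (eval e) i ≡ entry e i
  lookup-eval ⌜ x ⌝   i = refl
  lookup-eval 𝟎       i = Vec.lookup-replicate i 0#
  lookup-eval (e ⊞ f) i = trans (Vec.lookup-zipWith _⊕_ i (eval e) (eval f)) (cong₂ _⊕_ (lookup-eval e i) (lookup-eval f i))
  lookup-eval (c ⊡ e) i = trans (Vec.lookup-map i (c ·_) (eval e)) (cong (c ·_) (lookup-eval e i))

  entrywise : ∀ {n} (e f : VectorExpr n) → (∀ i → entry e i ≡ entry f i) → eval e ≡ eval f
  entrywise e f eq = ext λ i → trans (lookup-eval e i) (trans (eq i) (sym (lookup-eval f i)))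

  module _ {n : ℕ} where
    lc : Carrier → Carrier → Vector n → Vector n → Vector n
    lc a b x y = a ·ᵛ x +ᵛ b ·ᵛ y

    +ᵛ-comm : ∀ (x y : Vector n) → x +ᵛ y ≡ y +ᵛ x
    +ᵛ-comm x y = entrywise (⌜ x ⌝ ⊞ ⌜ y ⌝) (⌜ y ⌝ ⊞ ⌜ x ⌝) λ i → +-comm _ _

    +ᵛ-identityʳ : ∀ (x : Vector n) → x +ᵛ 0ᵛ ≡ x
    +ᵛ-identityʳ x = entrywise (⌜ x ⌝ ⊞ 𝟎) ⌜ x ⌝ λ i → +-identityʳ _

    ·ᵛ-identity : ∀ (x : Vector n) → 1# ·ᵛ x ≡ x
    ·ᵛ-identity x = entrywise (1# ⊡ ⌜ x ⌝) ⌜ x ⌝ λ i → *-identityˡ _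

    ·ᵛ-assoc : ∀ a b (x : Vector n) → a ·ᵛ b ·ᵛ x ≡ (a · b) ·ᵛ x
    ·ᵛ-assoc a b x = entrywise (a ⊡ b ⊡ ⌜ x ⌝) ((a · b) ⊡ ⌜ x ⌝) λ i → sym (*-assoc _ _ _)

    0·ᵛ : ∀ (x : Vector n) → 0# ·ᵛ x ≡ 0ᵛ
    0·ᵛ x = entrywise (0# ⊡ ⌜ x ⌝) 𝟎 λ i → zeroˡ _

    ·ᵛ0 : ∀ a → a ·ᵛ 0ᵛ {n} ≡ 0ᵛ
    ·ᵛ0 a = entrywise (a ⊡ 𝟎) 𝟎 λ i → zeroʳ _

    ·ᵛ-cancelˡ : ∀ {a} {x y : Vector n} → a ≢ 0# → a ·ᵛ x ≡ a ·ᵛ y → x ≡ y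
    ·ᵛ-cancelˡ {a} {x} {y} a≢0 eq = ext λ i → ·-cancelˡ a≢0
      (trans (sym (lookup-eval (a ⊡ ⌜ x ⌝) i)) (trans (cong (λ z → lookup z i) eq) (lookup-eval (a ⊡ ⌜ y ⌝) i)))

    ·ᵛ≡0 : ∀ {a} {x : Vector n} → a ≢ 0# → a ·ᵛ x ≡ 0ᵛ → x ≡ 0ᵛ
    ·ᵛ≡0 {a} a≢0 eq = ·ᵛ-cancelˡ a≢0 (trans eq (sym (·ᵛ0 a)))

    ·ᵛ≡0⇒scalar≡0 : ∀ {a} {x : Vector n} → x ≢ 0ᵛ → a ·ᵛ x ≡ 0ᵛ → a ≡ 0#
    ·ᵛ≡0⇒scalar≡0 {a} x≢0 eq with a ≟ 0#
    ... | yes a≡0 = a≡0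
    ... | no a≢0  = contradiction (·ᵛ≡0 a≢0 eq) x≢0

    +·-cancel : ∀ t (x y : Vector n) → (y +ᵛ t ·ᵛ x) +ᵛ (- t) ·ᵛ x ≡ y
    +·-cancel t x y = entrywise ((⌜ y ⌝ ⊞ t ⊡ ⌜ x ⌝) ⊞ (- t) ⊡ ⌜ x ⌝) ⌜ y ⌝
      λ i → solve 3 (λ t x y → (y :+ t :* x) :+ :- t :* x := y) refl t (lookup x i) (lookup y i)

    lc-lc : ∀ a b c d e f (x y : Vector n) → lc a b (lc c d x y) (lc e f x y) ≡ lc (a · c ⊕ b · e) (a · d ⊕ b · f) x y
    lc-lc a b c d e f x y = entrywise
      (a ⊡ (c ⊡ ⌜ x ⌝ ⊞ d ⊡ ⌜ y ⌝) ⊞ b ⊡ (e ⊡ ⌜ x ⌝ ⊞ f ⊡ ⌜ y ⌝)) ((a · c ⊕ b · e) ⊡ ⌜ x ⌝ ⊞ (a · d ⊕ b · f) ⊡ ⌜ y ⌝)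
      λ i → solve 8 (λ a b c d e f x y → a :* (c :* x :+ d :* y) :+ b :* (e :* x :+ f :* y) :=
          (a :* c :+ b :* e) :* x :+ (a :* d :+ b :* f) :* y)
              refl a b c d e f (lookup x i) (lookup y i)

    ·-lc : ∀ c a b (x y : Vector n) → c ·ᵛ lc a b x y ≡ lc (c · a) (c · b) x y
    ·-lc c a b x y = entrywise (c ⊡ (a ⊡ ⌜ x ⌝ ⊞ b ⊡ ⌜ y ⌝)) ((c · a) ⊡ ⌜ x ⌝ ⊞ (c · b) ⊡ ⌜ y ⌝)
      λ i → solve 5 (λ c a b x y → c :* (a :* x :+ b :* y) := (c :* a) :* x :+ (c :* b) :* y) refl c a b (lookup x i)
          (lookup y i)

    lc-10 : ∀ (x y : Vector n) → lc 1# 0# x y ≡ x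
    lc-10 x y = entrywise (1# ⊡ ⌜ x ⌝ ⊞ 0# ⊡ ⌜ y ⌝) ⌜ x ⌝ λ i → solve 2 (λ x y → :1 :* x :+ :0 :* y := x) refl
        (lookup x i) (lookup y i)

    lc-01 : ∀ (x y : Vector n) → lc 0# 1# x y ≡ y
    lc-01 x y = entrywise (0# ⊡ ⌜ x ⌝ ⊞ 1# ⊡ ⌜ y ⌝) ⌜ y ⌝ λ i → solve 2 (λ x y → :0 :* x :+ :1 :* y := y) refl
        (lookup x i) (lookup y i)

    lc-00 : ∀ (x y : Vector n) → lc 0# 0# x y ≡ 0ᵛ
    lc-00 x y = entrywise (0# ⊡ ⌜ x ⌝ ⊞ 0# ⊡ ⌜ y ⌝) 𝟎 λ i → solve 2 (λ x y → :0 :* x :+ :0 :* y := :0) refl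
        (lookup x i) (lookup y i)

    count : {P : Pred (Vector n) 0ℓ} → Decidable P → ℕ
    count = vectors.count

    private
      space = vectors.elements {n}

    translate : ∀ a (f : Vector n → ℕ) → ∑[ x ∈ space ] f (x +ᵛ a) ≡ ∑ space f
    translate a f = ∑-reindex (vectors n) (vectors n) (_+ᵛ a) (_+ᵛ (- 1#) ·ᵛ a)
      (λ {x} → λ { refl → sym (cancel x) }) (λ {x} {y} → λ { refl → cancel′ y }) f (λ { refl → refl })
      where
      cancel : ∀ x → (x +ᵛ a) +ᵛ (- 1#) ·ᵛ a ≡ x
      cancel x = entrywise ((⌜ x ⌝ ⊞ ⌜ a ⌝) ⊞ (- 1#) ⊡ ⌜ a ⌝) ⌜ x ⌝ λ i → solve 2
          (λ x a → (x :+ a) :+ :- :1 :* a := x) refl (lookup x i) (lookup a i)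
      cancel′ : ∀ x → (x +ᵛ (- 1#) ·ᵛ a) +ᵛ a ≡ x
      cancel′ x = entrywise ((⌜ x ⌝ ⊞ (- 1#) ⊡ ⌜ a ⌝) ⊞ ⌜ a ⌝) ⌜ x ⌝ λ i → solve 2
          (λ x a → (x :+ :- :1 :* a) :+ a := x) refl (lookup x i) (lookup a i)

    -- Pairs of a vector y in U and a scalar t with y + t x in A are counted twice. A given y has
    -- exactly one t; for a given t, translation by t x permutes U and leaves the vectors of U ∩ A
    -- to be counted.
    slice : {U A : Pred (Vector n) 0ℓ} (U? : Decidable U) (A? : Decidable A) (x : Vector n) →
      (∀ t {y} → U y → U (y +ᵛ t ·ᵛ x)) →
      (∀ {y} → U y → ∃ λ t → A (y +ᵛ t ·ᵛ x) × (∀ {s} → A (y +ᵛ s ·ᵛ x) → s ≡ t)) →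
      q * count (U? ∩? A?) ≡ count U?
    slice {U} {A} U? A? x shift one = sym (begin
      count U?
        ≡⟨ ∑-cong space (λ y → sym (trans (⟨⟩*-cong (U? y) (λ Uy → hits Uy)) (ℕ.*-identityʳ _))) ⟩
      ∑[ y ∈ space ] (⟨ U? y ⟩ * ∑[ t ∈ scalars.elements ] ⟨ A? (y +ᵛ t ·ᵛ x) ⟩)
        ≡⟨ ∑-cong space (λ y → sym (∑-*ˡ scalars.elements ⟨ U? y ⟩ _)) ⟩
      ∑[ y ∈ space ] ∑[ t ∈ scalars.elements ] (⟨ U? y ⟩ * ⟨ A? (y +ᵛ t ·ᵛ x) ⟩)
        ≡⟨ ∑-swap space scalars.elements _ ⟩
      ∑[ t ∈ scalars.elements ] ∑[ y ∈ space ] (⟨ U? y ⟩ * ⟨ A? (y +ᵛ t ·ᵛ x) ⟩)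
        ≡⟨ ∑-cong scalars.elements (λ t → trans (∑-cong space (shifted t)) (translate (t ·ᵛ x) (λ y → ⟨ (U? ∩? A?) y ⟩))) ⟩
      ∑[ t ∈ scalars.elements ] count (U? ∩? A?)
        ≡⟨ trans (∑-const scalars.elements _) (cong (_* count (U? ∩? A?)) length-scalars) ⟩
      q * count (U? ∩? A?) ∎)
      where
      open ≡-Reasoning
      hits : ∀ {y} → U y → ∑[ t ∈ scalars.elements ] ⟨ A? (y +ᵛ t ·ᵛ x) ⟩ ≡ 1
      hits {y} Uy = let t , At , unq = one Uy in scalars.count-unique (λ t → A? (y +ᵛ t ·ᵛ x)) resp≡ At unq
      shifted : ∀ t y → ⟨ U? y ⟩ * ⟨ A? (y +ᵛ t ·ᵛ x) ⟩ ≡ ⟨ (U? ∩? A?) (y +ᵛ t ·ᵛ x) ⟩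
      shifted t y = trans (cong (_* ⟨ A? (y +ᵛ t ·ᵛ x) ⟩)
        (⟨⟩-cong (U? y) (U? (y +ᵛ t ·ᵛ x)) (shift t) (λ Uy′ → subst U (+·-cancel t x y) (shift (- t) Uy′))))
        (sym (⟨⟩-× (U? (y +ᵛ t ·ᵛ x)) (A? (y +ᵛ t ·ᵛ x))))

-- Counting zeros of linear and quadratic forms

module FieldCounting {q} (F : FiniteField q) where
  open FieldTheory F

  2≤order : 2 ≤ q
  2≤order = subst (2 ≤_) (trans (∑-const scalars.elements 1) (trans (ℕ.*-identityʳ _) length-scalars))
    (distinct⇒2≤count scalars {P = λ _ → ⊤} (λ _ → yes tt) _ {0#} {1#} tt tt 0≢1)

  instance
    order-nonZero : ℕ.NonZero q
    order-nonZero = ℕ.>-nonZero (ℕ.≤-trans (s≤s z≤n) 2≤order)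

  affine-root : ∀ {α β} → β ≢ 0# → ∃ λ t → α ⊕ t · β ≡ 0# × (∀ {s} → α ⊕ s · β ≡ 0# → s ≡ t)
  affine-root {α} {β} β≢0 = - (α · i) , root , unique
    where
    i = inverse β≢0
    root : α ⊕ - (α · i) · β ≡ 0#
    root = trans (solve 3 (λ α β i → α :+ :- (α :* i) :* β := α :- α :* (β :* i)) refl α β i)
                 (trans (cong (λ z → α - α · z) (inverseʳ β≢0)) (solve 1 (λ α → α :- α :* :1 := :0) refl α))
    unique : ∀ {s} → α ⊕ s · β ≡ 0# → s ≡ - (α · i)
    unique {s} eq = ·-cancelˡ β≢0 (trans (solve 3 (λ α β s → β :* s := (α :+ s :* β) :- α) refl α β s)
      (trans (cong (_- α) eq) (trans (solve 1 (λ α → :0 :- α := :- (α :* :1)) refl α)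
        (trans (cong (λ z → - (α · z)) (sym (inverseʳ β≢0))) (solve 3
            (λ α β i → :- (α :* (β :* i)) := β :* :- (α :* i)) refl α β i)))))

  square-roots : ∀ {s t} → s · s ≡ t · t → s ≡ t ⊎ s ≡ - t
  square-roots {s} {t} eq with s - t ≟ 0#
  ... | yes s-t≡0 = inj₁ (-≡0 s-t≡0)
  ... | no s-t≢0  = inj₂ (-≡0 (trans (solve 2 (λ s t → s :- :- t := s :+ t) refl s t)
          (·≡0 s-t≢0 (trans (solve 2 (λ s t → (s :- t) :* (s :+ t) := s :* s :- t :* t) refl s t) (≡⇒-≡0 eq)))))

  -- The images of s ↦ a s² and t ↦ - (b t² + c) cannot be disjoint: every fibre
  -- has at most two elements, and one of them only one.
  diagonal-root : ∀ {a b} → a ≢ 0# → b ≢ 0# → ∀ c → ∃₂ λ s t → a · s · s ⊕ b · t · t ⊕ c ≡ 0#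
  diagonal-root {a} {b} a≢0 b≢0 c with scalars.∃? (λ s → scalars.∃? (λ t → (a · s · s ⊕ b · t · t ⊕ c) ≟ 0#) resp≡) resp≡
  ... | yes root = root
  ... | no ¬root = contradiction bound (ℕ.<⇒≱ (ℕ.≤-reflexive (ℕ.+-comm 1 _)))
    where
    f g : Carrier → Carrier
    f s = a · s · s
    g t = - (b · t · t ⊕ c)
    disjoint : ∀ s t → f s ≢ g t
    disjoint s t eq = ¬root (s , t , trans (cong (λ z → z ⊕ b · t · t ⊕ c) eq)
      (solve 2 (λ x c → :- (x :+ c) :+ x :+ c := :0) refl (b · t · t) c))
    fibre : (Carrier → Carrier) → Carrier → ℕ
    fibre h v = scalars.count (λ s → h s ≟ v)
    fibre≤2 : ∀ h → (∀ {s t} → h s ≡ h t → s ≡ t ⊎ s ≡ - t) → ∀ v → fibre h v ≤ 2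
    fibre≤2 h even v with scalars.∃? (λ s → h s ≟ v) resp≡
    ... | no ¬∃ = ℕ.≤-trans (ℕ.≤-reflexive (trans (∑-cong scalars.elements (λ s → ⟨⟩-no (h s ≟ v) (λ e → ¬∃ (s , e))))
        (∑-zero scalars.elements))) z≤n
    ... | yes (t , refl) = begin
      fibre h (h t)                                              ≤⟨ ∑-mono scalars.elements pointwise ⟩
      ∑[ s ∈ scalars.elements ] (⟨ s ≟ t ⟩ + ⟨ s ≟ - t ⟩)        ≡⟨ ∑-+ scalars.elements _ _ ⟩
      scalars.count (_≟ t) + scalars.count (_≟ - t)  ≡⟨ cong₂ _+_ (scalars.count-≈ t) (scalars.count-≈ (- t)) ⟩
      2                                                          ∎
      where
      open ℕ.≤-Reasoning
      pointwise : ∀ s → ⟨ h s ≟ h t ⟩ ≤ ⟨ s ≟ t ⟩ + ⟨ s ≟ - t ⟩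
      pointwise s with h s ≟ h t
      ... | no _  = z≤n
      ... | yes e with even e
      ...   | inj₁ p = ℕ.≤-trans (ℕ.≤-reflexive (sym (⟨⟩-yes (s ≟ t) p))) (ℕ.m≤m+n _ _)
      ...   | inj₂ p = ℕ.≤-trans (ℕ.≤-reflexive (sym (⟨⟩-yes (s ≟ - t) p))) (ℕ.m≤n+m _ _)
    f-even : ∀ {s t} → f s ≡ f t → s ≡ t ⊎ s ≡ - t
    f-even {s} {t} eq = square-roots (·-cancelˡ a≢0 (trans (sym (*-assoc a s s)) (trans eq (*-assoc a t t))))
    g-even : ∀ {s t} → g s ≡ g t → s ≡ t ⊎ s ≡ - t
    g-even {s} {t} eq = square-roots (·-cancelˡ b≢0 (trans (back s) (trans (cong (λ z → - z - c) eq) (sym (back t)))))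
      where
      back : ∀ s → b · (s · s) ≡ - g s - c
      back s = solve 3 (λ b s c → b :* (s :* s) := :- (:- (b :* s :* s :+ c)) :- c) refl b s c
    empty : ∀ h v → (∀ s → h s ≢ v) → fibre h v ≡ 0
    empty h v ne = trans (∑-cong scalars.elements (λ s → ⟨⟩-no (h s ≟ v) (ne s))) (∑-zero scalars.elements)
    f0 : f 0# ≡ 0#
    f0 = zeroʳ _
    fibre-f-0 : fibre f 0# ≡ 1
    fibre-f-0 = scalars.count-unique (λ s → f s ≟ 0#) resp≡ f0 λ {s} e → root s e
      where
      root : ∀ s → f s ≡ 0# → s ≡ 0#
      root s e with f-even {s} {0#} (trans e (sym f0))
      ... | inj₁ p = p
      ... | inj₂ p = trans p (solve 0 (:- :0 := :0) refl)
    -- At v = 0 the fibre of f is only the point 0, and disjointness empties the fibre of g. The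
    -- indicator spends this slack, so that summation over v gives the impossible 2q + 1 ≤ 2q.
    pointwise : ∀ v → fibre f v + fibre g v + ⟨ v ≟ 0# ⟩ ≤ 2
    pointwise v with v ≟ 0#
    ... | yes refl = ℕ.≤-reflexive (cong₂ (λ i j → i + j + 1) fibre-f-0
        (empty g 0# (λ t e → disjoint 0# t (trans f0 (sym e)))))
    ... | no _ with scalars.∃? (λ s → f s ≟ v) resp≡
    ...   | yes (s , refl) = ℕ.≤-trans (ℕ.≤-reflexive (trans (ℕ.+-identityʳ _)
        (trans (cong (fibre f v ℕ.+_) (empty g v (λ t e → disjoint s t (sym e)))) (ℕ.+-identityʳ _)))) (fibre≤2 f f-even v)
    ...   | no ¬∃ = ℕ.≤-trans (ℕ.≤-reflexive (trans (ℕ.+-identityʳ _)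
        (cong (ℕ._+ fibre g v) (empty f v (λ s e → ¬∃ (s , e)))))) (fibre≤2 g g-even v)
    total : ∀ h → ∑ scalars.elements (fibre h) ≡ q
    total h = trans (∑-swap scalars.elements scalars.elements _)
      (trans (∑-cong scalars.elements (λ s → trans (∑-cong scalars.elements
          (λ v → ⟨⟩-cong (h s ≟ v) (v ≟ h s) sym sym)) (scalars.count-≈ (h s))))
        (trans (∑-const scalars.elements 1) (trans (ℕ.*-identityʳ _) length-scalars)))
    bound : q + q + 1 ≤ q + q
    bound = begin
      q + q + 1
        ≡⟨ cong₂ _+_ (cong₂ _+_ (total f) (total g)) (scalars.count-≈ 0#) ⟨
      ∑ scalars.elements (fibre f) + ∑ scalars.elements (fibre g) + scalars.count (_≟ 0#)
        ≡⟨ cong (_+ scalars.count (_≟ 0#)) (∑-+ scalars.elements (fibre f) (fibre g)) ⟨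
      ∑[ v ∈ scalars.elements ] (fibre f v + fibre g v) + scalars.count (_≟ 0#)
        ≡⟨ ∑-+ scalars.elements _ _ ⟨
      ∑[ v ∈ scalars.elements ] (fibre f v + fibre g v + ⟨ v ≟ 0# ⟩)
        ≤⟨ ∑-mono scalars.elements pointwise ⟩
      ∑[ v ∈ scalars.elements ] 2
        ≡⟨ trans (∑-const scalars.elements 2) (cong (_* 2) length-scalars) ⟩
      q * 2
        ≡⟨ trans (ℕ.*-comm q 2) (cong (q +_) (ℕ.+-identityʳ q)) ⟩
      q + q ∎
      where open ℕ.≤-Reasoning

  -- The subspaces needed are intersections of kernels without a chosen basis; their number of
  -- vectors stands in for the dimension.
  record IsSubspace {n} (U : Pred (Vector n) 0ℓ) : Set where
    field
      0∈       : U 0ᵛ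
      +-closed : ∀ {x y} → U x → U y → U (x +ᵛ y)
      ·-closed : ∀ a {x} → U x → U (a ·ᵛ x)

    lc-closed : ∀ a b {x y} → U x → U y → U (lc a b x y)
    lc-closed a b Ux Uy = +-closed (·-closed a Ux) (·-closed b Uy)

  IsLinear : ∀ {n} → (Vector n → Carrier) → Set
  IsLinear φ = ∀ x a y → φ (x +ᵛ a ·ᵛ y) ≡ φ x ⊕ a · φ y

  kernel : ∀ {n} → (Vector n → Carrier) → Pred (Vector n) 0ℓ
  kernel φ x = φ x ≡ 0#

  kernel? : ∀ {n} (φ : Vector n → Carrier) → Decidable (kernel φ)
  kernel? φ x = φ x ≟ 0#

  -- Along every coset of the span of `x` the form φ is affine in the multiple of `x`, with slope
  -- `φ x` ≠ 0, and so vanishes exactly once.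
  count-kernel : ∀ {n} {U : Pred (Vector n) 0ℓ} (U? : Decidable U) → IsSubspace U → ∀ {φ} → IsLinear φ →
    ∀ {x} → U x → φ x ≢ 0# → q * count (U? ∩? kernel? φ) ≡ count U?
  count-kernel U? sub {φ} lin {x} Ux φx≢0 = slice U? (kernel? φ) x
    (λ t Uy → +-closed Uy (·-closed t Ux))
    (λ {y} Uy → let t , e , unq = affine-root φx≢0 in t , trans (lin y t x) e , (λ {s} e′ → unq (trans (sym (lin y s x)) e′)))
    where open IsSubspace sub

  module QuadraticCounting {n} (Q : QuadraticForm n) (2≢0 : 1# ⊕ 1# ≢ 0#) where
    open QuadraticForm Q public renaming (polar to b)

    b-sym : ∀ x y → b x y ≡ b y x
    b-sym x y = trans (cong (λ z → form z - form x - form y) (+ᵛ-comm x y))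
      (solve 3 (λ s x y → s :- x :- y := s :- y :- x) refl (form (y +ᵛ x)) (form x) (form y))

    form-+ : ∀ x y → form (x +ᵛ y) ≡ form x ⊕ form y ⊕ b x y
    form-+ x y = solve 3 (λ s x y → s := x :+ y :+ (s :- x :- y)) refl (form (x +ᵛ y)) (form x) (form y)

    b-linearˡ : ∀ z → IsLinear (λ x → b x z)
    b-linearˡ z x a y = trans (polar-+ˡ x (a ·ᵛ y) z) (cong (b x z ⊕_) (polar-·ˡ a y z))

    b-linearʳ : ∀ z → IsLinear (b z)
    b-linearʳ z x a y = trans (b-sym z _) (trans (b-linearˡ z x a y) (cong₂ (λ c d → c ⊕ a · d) (b-sym x z) (b-sym y z)))

    b-lcˡ : ∀ α β x y z → b (lc α β x y) z ≡ α · b x z ⊕ β · b y z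
    b-lcˡ α β x y z = trans (b-linearˡ z (α ·ᵛ x) β y) (cong (_⊕ β · b y z) (polar-·ˡ α x z))

    b-lcʳ : ∀ α β x y z → b z (lc α β x y) ≡ α · b z x ⊕ β · b z y
    b-lcʳ α β x y z = trans (b-sym z _) (trans (b-lcˡ α β x y z) (cong₂ (λ c d → α · c ⊕ β · d) (b-sym x z) (b-sym y z)))

    b-0ˡ : ∀ z → b 0ᵛ z ≡ 0#
    b-0ˡ z = trans (cong (λ x → b x z) (sym (0·ᵛ 0ᵛ))) (trans (polar-·ˡ 0# 0ᵛ z) (zeroˡ _))

    b-diagonal : ∀ x → b x x ≡ (1# ⊕ 1#) · form x
    b-diagonal x = trans (cong (λ z → form z - form x - form x) (entrywise (⌜ x ⌝ ⊞ ⌜ x ⌝) ((1# ⊕ 1#) ⊡ ⌜ x ⌝)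
        λ i → solve 1 (λ x → x :+ x := (:1 :+ :1) :* x) refl (lookup x i)))
      (trans (cong (λ z → z - form x - form x) (form-· (1# ⊕ 1#) x))
        (solve 1 (λ f → (:1 :+ :1) :* (:1 :+ :1) :* f :- f :- f := (:1 :+ :1) :* f) refl (form x)))

    Singular : Pred (Vector n) 0ℓ
    Singular x = form x ≡ 0#

    singular? : Decidable Singular
    singular? x = form x ≟ 0#

    singular⇒b≡0 : ∀ {x} → Singular x → b x x ≡ 0#
    singular⇒b≡0 {x} s = trans (b-diagonal x) (trans (cong ((1# ⊕ 1#) ·_) s) (zeroʳ _))

    b≡0⇒singular : ∀ {x} → b x x ≡ 0# → Singular x
    b≡0⇒singular {x} e = ·≡0 2≢0 (trans (sym (b-diagonal x)) e)

    singular-· : ∀ {x} → Singular x → ∀ c → Singular (c ·ᵛ x)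
    singular-· {x} s c = trans (form-· c x) (trans (cong ((c · c) ·_) s) (zeroʳ _))

    totally-singular⇒b≡0 : ∀ {U} → IsSubspace U → U ⊆ Singular → ∀ {x y} → U x → U y → b x y ≡ 0#
    totally-singular⇒b≡0 sub sing {x} {y} Ux Uy = trans (cong₂ (λ s t → s - form x - t)
        (sing (IsSubspace.+-closed sub Ux Uy)) (sing Uy))
      (trans (cong (λ s → 0# - s - 0#) (sing Ux)) (solve 0 (:0 :- :0 :- :0 := :0) refl))

    form-shift : ∀ y t x → form (y +ᵛ t ·ᵛ x) ≡ form y ⊕ t · t · form x ⊕ t · b y x
    form-shift y t x = trans (form-+ y (t ·ᵛ x)) (cong₂ (λ c d → form y ⊕ c ⊕ d) (form-· t x)
      (trans (b-sym y _) (trans (polar-·ˡ t x y) (cong (t ·_) (b-sym x y)))))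

    infix 8 _⊥ _⊥?
    _⊥ : Vector n → Pred (Vector n) 0ℓ
    x ⊥ = kernel (λ y → b y x)

    _⊥? : ∀ x → Decidable (x ⊥)
    x ⊥? = kernel? (λ y → b y x)

    full : IsSubspace {n} (λ _ → ⊤)
    full = record { 0∈ = tt ; +-closed = λ _ _ → tt ; ·-closed = λ _ _ → tt }

    full? : Decidable {A = Vector n} (λ _ → ⊤)
    full? _ = yes tt

    ∩⊥-subspace : ∀ {U} → IsSubspace U → ∀ x → IsSubspace (U ∩ x ⊥)
    ∩⊥-subspace sub x = record
      { 0∈       = 0∈ , b-0ˡ x
      ; +-closed = λ { {y} {z} (Uy , y⊥) (Uz , z⊥) → +-closed Uy Uz , trans (polar-+ˡ y z x)
          (trans (cong₂ _⊕_ y⊥ z⊥) (+-identityˡ 0#)) }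
      ; ·-closed = λ { a {y} (Uy , y⊥) → ·-closed a Uy , trans (polar-·ˡ a y x) (trans (cong (a ·_) y⊥) (zeroʳ a)) }
      }
      where open IsSubspace sub

    NondegenerateOn : Pred (Vector n) 0ℓ → Set
    NondegenerateOn U = ∀ {x} → U x → (∀ {y} → U y → b x y ≡ 0#) → x ≡ 0ᵛ

    nonorthogonal : ∀ {U} (U? : Decidable U) → NondegenerateOn U → ∀ {x} → U x → x ≢ 0ᵛ → ∃ λ y → U y × b y x ≢ 0#
    nonorthogonal U? nondeg {x} Ux x≢0 with ∃ᵛ? (U? ∩? ∁? (x ⊥?))
    ... | yes witness = witness
    ... | no ¬∃ = contradiction (nondeg Ux λ {y} Uy → trans (b-sym x y)
        (decidable-stable (b y x ≟ 0#) λ ne → ¬∃ (y , Uy , ne))) x≢0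

    gram : Vector n → Vector n → Carrier
    gram u v = b u u · b v v - b u v · b u v

    -- A nonzero Gram determinant lets the plane spanned by u and v split off. A vector of the
    -- complement that is orthogonal to the complement is then orthogonal to all of U.
    ∩⊥⊥-nondegenerate : ∀ {U} → IsSubspace U → NondegenerateOn U → ∀ {u v} → U u → U v → gram u v ≢ 0# →
        NondegenerateOn ((U ∩ u ⊥) ∩ v ⊥)
    ∩⊥⊥-nondegenerate {U} sub nondeg {u} {v} Uu Uv g≢0 {x} ((Ux , x⊥u) , x⊥v) x⊥ = nondeg Ux λ {z} Uz →
      -- By Cramer's rule z′ is the projection of z onto the complement of the plane, multiplied by
      -- `gram u v` to clear denominators. As x is orthogonal to u and v, its product with z′ is
      -- `gram u v` times `b x z`.
      let α = - (b z u · b v v - b z v · b u v)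
          β = - (b z v · b u u - b z u · b u v)
          z′ = gram u v ·ᵛ z +ᵛ lc α β u v
          expand : ∀ y → b z′ y ≡ gram u v · b z y ⊕ (α · b u y ⊕ β · b v y)
          expand y = trans (polar-+ˡ _ _ y) (cong₂ _⊕_ (polar-·ˡ _ z y) (b-lcˡ α β u v y))
          z′⊥u : b z′ u ≡ 0#
          z′⊥u = trans (expand u) (trans (cong (λ w → gram u v · b z u ⊕ (α · b u u ⊕ β · w)) (b-sym v u))
            (solve 5 (λ uu vv uv zu zv → (uu :* vv :- uv :* uv) :* zu :+
                (:- (zu :* vv :- zv :* uv) :* uu :+ :- (zv :* uu :- zu :* uv) :* uv) := :0)
              refl (b u u) (b v v) (b u v) (b z u) (b z v)))
          z′⊥v : b z′ v ≡ 0#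
          z′⊥v = trans (expand v)
            (solve 5 (λ uu vv uv zu zv → (uu :* vv :- uv :* uv) :* zv :+
                (:- (zu :* vv :- zv :* uv) :* uv :+ :- (zv :* uu :- zu :* uv) :* vv) := :0)
              refl (b u u) (b v v) (b u v) (b z u) (b z v))
          Uz′ = +-closed (·-closed (gram u v) Uz) (lc-closed α β Uu Uv)
      in ·≡0 g≢0 (begin
        gram u v · b x z  ≡⟨ solve 3 (λ g α β → g := g :+ (α :* :0 :+ β :* :0)) refl (gram u v · b x z) α β ⟩
        gram u v · b x z ⊕ (α · 0# ⊕ β · 0#)  ≡⟨ cong₂ (λ c d → gram u v · b x z ⊕ (α · c ⊕ β · d))
            (trans (b-sym u x) x⊥u) (trans (b-sym v x) x⊥v) ⟨
        gram u v · b x z ⊕ (α · b u x ⊕ β · b v x)  ≡⟨ cong (λ w → gram u v · w ⊕ (α · b u x ⊕ β · b v x)) (b-sym x z) ⟩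
        gram u v · b z x ⊕ (α · b u x ⊕ β · b v x)                        ≡⟨ expand x ⟨
        b z′ x                                                            ≡⟨ b-sym z′ x ⟩
        b x z′                                                            ≡⟨ x⊥ ((Uz′ , z′⊥u) , z′⊥v) ⟩
        0#                                                                ∎)
      where
      open IsSubspace sub
      open ≡-Reasoning

    -- As many singular vectors as a nondegenerate form has in odd dimension.
    Balanced : ∀ {U : Pred (Vector n) 0ℓ} → Decidable U → Set
    Balanced U? = q * count (U? ∩? singular?) ≡ count U?

    module _ {U : Pred (Vector n) 0ℓ} (U? : Decidable U) (sub : IsSubspace U) {x : Vector n} (Ux : U x) where
      open IsSubspace sub

      count-∩⊥ : ∀ {w} → b x w ≢ 0# → q * count (U? ∩? w ⊥?) ≡ count U?
      count-∩⊥ {w} = count-kernel U? sub (b-linearˡ w) Ux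

      module _ (s : Singular x) where
        private
          shift⊥ : ∀ t y → b (y +ᵛ t ·ᵛ x) x ≡ b y x
          shift⊥ t y = trans (b-linearˡ x y t x) (trans (cong (λ c → b y x ⊕ t · c) (singular⇒b≡0 s))
              (trans (cong (b y x ⊕_) (zeroʳ t)) (+-identityʳ _)))

          shift-form : ∀ y t → form (y +ᵛ t ·ᵛ x) ≡ form y ⊕ t · b y x
          shift-form y t = trans (form-shift y t x) (trans (cong (λ c → form y ⊕ t · t · c ⊕ t · b y x) s)
              (cong (_⊕ t · b y x) (trans (cong (form y ⊕_) (zeroʳ _)) (+-identityʳ _))))

          off : q * count ((U? ∩? ∁? (x ⊥?)) ∩? singular?) ≡ count (U? ∩? ∁? (x ⊥?))
          off = slice (U? ∩? ∁? (x ⊥?)) singular? x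
            (λ t {y} (Uy , y⊥̸) → +-closed Uy (·-closed t Ux) , λ e → y⊥̸ (trans (sym (shift⊥ t y)) e))
            (λ {y} (Uy , y⊥̸) → let t , e , unq = affine-root y⊥̸ in t , trans (shift-form y t) e , (λ {r} e′ → unq (trans (sym (shift-form y r)) e′)))

          on off′ : ℕ
          on   = count ((U? ∩? x ⊥?) ∩? singular?)
          off′ = count ((U? ∩? ∁? (x ⊥?)) ∩? singular?)

          split : count (U? ∩? singular?) ≡ on + off′
          split = trans (count-split (vectors n) (U? ∩? singular?) (x ⊥?))
            (cong₂ _+_ (count-cong (vectors n) ((U? ∩? singular?) ∩? x ⊥?) ((U? ∩? x ⊥?) ∩? singular?) swap swap)
                       (count-cong (vectors n) ((U? ∩? singular?) ∩? ∁? (x ⊥?)) ((U? ∩? ∁? (x ⊥?)) ∩? singular?) swap swap))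
            where
            swap : {A B C : Set} → (A × B) × C → (A × C) × B
            swap ((a , b) , c) = (a , c) , b

          split-q : q * count (U? ∩? singular?) ≡ q * on + count (U? ∩? ∁? (x ⊥?))
          split-q = trans (cong (q *_) split) (trans (ℕ.*-distribˡ-+ q on off′) (cong (λ k → q * on + k) off))

        -- Off x^⊥ exactly one vector in q is singular, whatever U is: along y + t x the form is
        -- affine in t with slope b(y, x). Balance of U and balance of U ∩ x^⊥ are therefore
        -- equivalent.
        balanced⇒balanced-∩⊥ : Balanced U? → Balanced (U? ∩? x ⊥?)
        balanced⇒balanced-∩⊥ bal = ℕ.+-cancelʳ-≡ (count (U? ∩? ∁? (x ⊥?))) _ _
          (trans (sym split-q) (trans bal (count-split (vectors n) U? (x ⊥?))))

        balanced-∩⊥⇒balanced : Balanced (U? ∩? x ⊥?) → Balanced U?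
        balanced-∩⊥⇒balanced bal = trans split-q (trans (cong (_+ count (U? ∩? ∁? (x ⊥?))) bal)
            (sym (count-split (vectors n) U? (x ⊥?))))

        -- Inside x^⊥ a translation by a multiple of x does not change the form, and each orbit
        -- meets y^⊥ once. Passing from x^⊥ ∩ y^⊥ to x^⊥ multiplies the number of all vectors and
        -- that of singular vectors by the same q.
        balanced-∩⊥⊥⇒balanced-∩⊥ : ∀ {y} → b x y ≢ 0# → Balanced ((U? ∩? x ⊥?) ∩? y ⊥?) → Balanced (U? ∩? x ⊥?)
        balanced-∩⊥⊥⇒balanced-∩⊥ {y} xy≢0 bal = trans (cong (q *_) (sym singulars)) (trans (cong (q *_) bal) sizes)
          where
          x∈ = Ux , singular⇒b≡0 s
          sizes : q * count ((U? ∩? x ⊥?) ∩? y ⊥?) ≡ count (U? ∩? x ⊥?)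
          sizes = count-kernel (U? ∩? x ⊥?) (∩⊥-subspace sub x) (b-linearˡ y) x∈ xy≢0
          singulars : q * count (((U? ∩? x ⊥?) ∩? y ⊥?) ∩? singular?) ≡ count ((U? ∩? x ⊥?) ∩? singular?)
          singulars = trans (cong (q *_) (count-cong (vectors n) (((U? ∩? x ⊥?) ∩? y ⊥?) ∩? singular?)
              (((U? ∩? x ⊥?) ∩? singular?) ∩? y ⊥?)
                                             (λ ((a , c) , d) → (a , d) , c) (λ ((a , d) , c) → (a , c) , d)))
            (slice ((U? ∩? x ⊥?) ∩? singular?) (y ⊥?) x
              (λ t {z} ((Uz , z⊥x) , sz) → (+-closed Uz (·-closed t Ux) , trans (shift⊥ t z) z⊥x)
                 , trans (shift-form z t) (trans (cong₂ (λ c d → c ⊕ t · d) sz z⊥x) (trans (+-identityˡ _) (zeroʳ t))))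
              (λ {z} _ → let t , e , unq = affine-root xy≢0 in t , trans (b-linearˡ y z t x) e , (λ {r} e′ → unq (trans (sym (b-linearˡ y z r x)) e′))))

    private
      2≤q* : ∀ w → 1 ≤ w → 2 ≤ q * w
      2≤q* w 1≤w = ℕ.*-mono-≤ 2≤order 1≤w

      cancel-q : ∀ {m k} → q * m ≡ q * k → m ≡ k
      cancel-q {m} {k} = ℕ.*-cancelˡ-≡ m k q

    module _ {U : Pred (Vector n) 0ℓ} (U? : Decidable U) (sub : IsSubspace U) where
      open IsSubspace sub

      -- The size q³ w with w ≥ 1 stands for dimension at least 3. Unless a singular vector turns up
      -- earlier, successive orthogonal complements provide three mutually orthogonal nonsingular
      -- vectors.
      isotropic : ∀ w → 1 ≤ w → count U? ≡ q * (q * (q * w)) → ∃ λ x → U x × x ≢ 0ᵛ × Singular x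
      isotropic w 1≤w size =
        let x , Ux , x≢0 = 2≤count⇒≉ (vectors n) U? (subst (2 ≤_) (sym size) (2≤q* _ (1≤q* (1≤q* 1≤w)))) 0ᵛ
        in first Ux x≢0 (singular? x)
        where
        1≤q* : ∀ {w} → 1 ≤ w → 1 ≤ q * w
        1≤q* 1≤w = ℕ.≤-trans (s≤s z≤n) (2≤q* _ 1≤w)
        size′ : ∀ {x} → U x → ¬ Singular x → count (U? ∩? x ⊥?) ≡ q * (q * w)
        size′ Ux nx = cancel-q (trans (count-∩⊥ U? sub Ux (λ e → nx (b≡0⇒singular e))) size)
        size″ : ∀ {x y} → U y → b y x ≡ 0# → ¬ Singular y → count (U? ∩? x ⊥?) ≡ q * (q * w) → count
            ((U? ∩? x ⊥?) ∩? y ⊥?) ≡ q * w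
        size″ {x} Uy yx ny size′ = cancel-q (trans (count-∩⊥ (U? ∩? x ⊥?) (∩⊥-subspace sub x) (Uy , yx)
            (λ e → ny (b≡0⇒singular e))) size′)
        third : ∀ {x y z} → U x → U y → U z → z ≢ 0ᵛ → b y x ≡ 0# → b z x ≡ 0# → b z y ≡ 0# →
                ¬ Singular x → ¬ Singular y → Dec (Singular z) → ∃ λ x → U x × x ≢ 0ᵛ × Singular x
        third Ux Uy Uz z≢0 yx zx zy nx ny (yes sz) = _ , Uz , z≢0 , sz
        -- The form on s x + t y + z is diagonal in s and t with constant term `form z`, so
        -- `diagonal-root` makes it vanish. The combination is nonzero because its product with z is
        -- b(z, z) ≠ 0.
        third {x} {y} {z} Ux Uy Uz z≢0 yx zx zy nx ny (no nz) with s , t , eq ← diagonal-root nx ny (form z) =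
          v , +-closed (lc-closed s t Ux Uy) Uz , nonzero , singular
          where
          v = lc s t x y +ᵛ z
          vz : b v z ≡ b z z
          vz = trans (polar-+ˡ _ z z) (trans (cong (_⊕ b z z) (trans (b-lcˡ s t x y z)
            (cong₂ (λ c d → s · c ⊕ t · d) (trans (b-sym x z) zx) (trans (b-sym y z) zy))))
            (solve 3 (λ s t c → s :* :0 :+ t :* :0 :+ c := c) refl s t (b z z)))
          nonzero : v ≢ 0ᵛ
          nonzero v≡0 = nz (b≡0⇒singular (trans (sym vz) (trans (cong (λ w → b w z) v≡0) (b-0ˡ z))))
          zv : b z (lc s t x y) ≡ 0#
          zv = trans (b-lcʳ s t x y z) (trans (cong₂ (λ c d → s · c ⊕ t · d) zx zy)
              (solve 2 (λ s t → s :* :0 :+ t :* :0 := :0) refl s t))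
          singular : Singular v
          singular = begin
            form v                                                        ≡⟨ form-+ _ z ⟩
            form (lc s t x y) ⊕ form z ⊕ b (lc s t x y) z  ≡⟨ cong₂ (λ c d → c ⊕ form z ⊕ d) (form-shift (s ·ᵛ x) t y)
                (trans (b-sym _ z) zv) ⟩
            form (s ·ᵛ x) ⊕ t · t · form y ⊕ t · b (s ·ᵛ x) y ⊕ form z ⊕ 0#
              ≡⟨ cong₂ (λ c d → c ⊕ t · t · form y ⊕ t · d ⊕ form z ⊕ 0#) (form-· s x)
                  (trans (polar-·ˡ s x y) (trans (cong (s ·_) (trans (b-sym x y) yx)) (zeroʳ s))) ⟩
            s · s · form x ⊕ t · t · form y ⊕ t · 0# ⊕ form z ⊕ 0#
              ≡⟨ solve 5 (λ s t x y z → s :* s :* x :+ t :* t :* y :+ t :* :0 :+ z :+ :0 := x :* s :* s :+ y :* t :* t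
                  :+ z) refl s t (form x) (form y) (form z) ⟩
            form x · s · s ⊕ form y · t · t ⊕ form z                      ≡⟨ eq ⟩
            0#                                                            ∎
            where open ≡-Reasoning
        second : ∀ {x y} → U x → U y → y ≢ 0ᵛ → b y x ≡ 0# → ¬ Singular x → count (U? ∩? x ⊥?) ≡ q * (q * w) → Dec
            (Singular y) → ∃ λ x → U x × x ≢ 0ᵛ × Singular x
        second Ux Uy y≢0 yx nx size′ (yes sy) = _ , Uy , y≢0 , sy
        second {x} {y} Ux Uy y≢0 yx nx size′ (no ny) =
          let z , ((Uz , zx) , zy) , z≢0 = 2≤count⇒≉ (vectors n) ((U? ∩? x ⊥?) ∩? y ⊥?) (subst (2 ≤_) (sym (size″ Uy yx ny size′)) (2≤q* _ 1≤w)) 0ᵛ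
          in third Ux Uy Uz z≢0 yx zx zy nx ny (singular? z)
        first : ∀ {x} → U x → x ≢ 0ᵛ → Dec (Singular x) → ∃ λ x → U x × x ≢ 0ᵛ × Singular x
        first Ux x≢0 (yes sx) = _ , Ux , x≢0 , sx
        first {x} Ux x≢0 (no nx) =
          let y , (Uy , yx) , y≢0 = 2≤count⇒≉ (vectors n) (U? ∩? x ⊥?) (subst (2 ≤_) (sym (size′ Ux nx)) (2≤q* _ (1≤q* 1≤w))) 0ᵛ
          in second Ux Uy y≢0 yx nx (size′ Ux nx) (singular? y)

    -- The size q (q²)^k encodes dimension 2k + 1. For k > 0 a singular x and a y not orthogonal to
    -- it have Gram determinant equal to minus the square of b(x, y), so x^⊥ ∩ y^⊥ is nondegenerate
    -- of dimension 2k - 1 in U. Balance rises from there to U ∩ x^⊥ and then to U.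
    nondegenerate⇒balanced : ∀ k {U} (U? : Decidable U) → IsSubspace U → NondegenerateOn U → count U? ≡ q *
        (q * q) ℕ.^ k → Balanced U?
    nondegenerate⇒balanced zero {U} U? sub nondeg size = trans (cong (q *_) one) (sym size)
      where
      open IsSubspace sub
      -- In dimension 1 the hyperplane x^⊥ has a single vector, whereas a nonzero singular x would
      -- put both 0 and x into it.
      only-zero : ∀ {x} → (U ∩ Singular) x → x ≡ 0ᵛ
      only-zero {x} (Ux , sx) = decidable-stable (x ≟ᵛ 0ᵛ) λ x≢0 →
        let y , Uy , yx = nonorthogonal U? nondeg Ux x≢0
            x⊥-trivial = cancel-q (trans (count-∩⊥ U? sub Uy yx) size)
        in ℕ.<⇒≱ (distinct⇒2≤count (vectors n) (U? ∩? x ⊥?) resp≡ (Ux , singular⇒b≡0 sx) (0∈ , b-0ˡ x) x≢0)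
            (ℕ.≤-reflexive x⊥-trivial)
      one : count (U? ∩? singular?) ≡ 1
      one = vectors.count-unique (U? ∩? singular?) resp≡ (0∈ , b≡0⇒singular (b-0ˡ 0ᵛ)) only-zero
    nondegenerate⇒balanced (suc k) {U} U? sub nondeg size
      with x , Ux , x≢0 , sx ← isotropic U? sub ((q * q) ℕ.^ k) (ℕ.m^n>0 (q * q) {{ℕ.m*n≢0 q q}} k)
          (trans size (cong (q *_) (ℕ.*-assoc q q _)))
      with y , Uy , yx ← nonorthogonal U? nondeg Ux x≢0 =
        balanced-∩⊥⇒balanced U? sub Ux sx (balanced-∩⊥⊥⇒balanced-∩⊥ U? sub Ux sx xy≢0
          (nondegenerate⇒balanced k ((U? ∩? x ⊥?) ∩? y ⊥?) (∩⊥-subspace (∩⊥-subspace sub x) y)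
             (∩⊥⊥-nondegenerate sub nondeg Ux Uy gram≢0) size′))
      where
      xy≢0 : b x y ≢ 0#
      xy≢0 e = yx (trans (b-sym y x) e)
      gram≢0 : gram x y ≢ 0#
      gram≢0 e = ·≢0 xy≢0 xy≢0 (trans (solve 2 (λ d xy → xy :* xy := d :- (:0 :* d :- xy :* xy) :- d) refl (b y y) (b x y))
        (trans (cong (λ c → b y y - c - b y y) (trans (cong (λ c → c · b y y - b x y · b x y) (sym (singular⇒b≡0 sx))) e))
          (solve 1 (λ d → d :- :0 :- d := :0) refl (b y y))))
      size′ : count ((U? ∩? x ⊥?) ∩? y ⊥?) ≡ q * (q * q) ℕ.^ k
      size′ = cancel-q (trans (count-∩⊥ (U? ∩? x ⊥?) (∩⊥-subspace sub x) (Ux , singular⇒b≡0 sx) xy≢0)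
        (cancel-q (trans (count-∩⊥ U? sub Uy yx) (trans size (cong (q *_) (ℕ.*-assoc q q _))))))

-- Characteristic, Frobenius map, Fermat's theorem and roots of polynomials

prime∤! : ∀ {p} → Prime p → ∀ {k} → k < p → ¬ (p ∣ k !)
prime∤! {p} pp {zero}  k<p p∣ = ℕ.<⇒≱ (ℕ.nonTrivial⇒n>1 p {{prime⇒nonTrivial pp}}) (∣⇒≤ p∣)
prime∤! {p} pp {suc k} k<p p∣ with euclidsLemma (suc k) (k !) pp p∣
... | inj₁ p∣k  = ℕ.<⇒≱ k<p (∣⇒≤ p∣k)
... | inj₂ p∣k! = prime∤! pp (ℕ.<-trans (ℕ.n<1+n k) k<p) p∣k!

-- The prime divides p! = (p C k) k! (p - k)!, but neither of the two smaller factorials.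
prime∣C : ∀ {p} → Prime p → ∀ {k} → 0 < k → k < p → p ∣ p C k
prime∣C {suc p} pp {k} 0<k k<p with euclidsLemma (suc p C k) (k ! * (suc p ∸ k) !) pp
    (subst (suc p ∣_) (sym factorial) (m∣m*n (p !)))
  where
  instance _ = ℕ._!*_!≢0 k (suc p ∸ k)
  factorial : (suc p C k) * (k ! * (suc p ∸ k) !) ≡ suc p !
  factorial = trans (cong (_* (k ! * (suc p ∸ k) !)) (nCk≡n!/k![n-k]! (ℕ.<⇒≤ k<p))) (m/n*n≡m (k![n∸k]!∣n! (ℕ.<⇒≤ k<p)))
... | inj₁ p∣C = p∣C
... | inj₂ p∣! with euclidsLemma (k !) ((suc p ∸ k) !) pp p∣!
...   | inj₁ p∣k! = ⊥-elim (prime∤! pp k<p p∣k!)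
...   | inj₂ p∣[p-k]! = ⊥-elim (prime∤! pp (ℕ.∸-monoʳ-< {suc p} {k} {0} 0<k (ℕ.<⇒≤ k<p)) p∣[p-k]!)

odd⇒2k+1 : ∀ {q} → ¬ (2 ∣ q) → ∃ λ k → q ≡ 1 + k * 2
odd⇒2k+1 {q} odd with q % 2 in eq | m%n<n q 2
... | 0 | _ = ⊥-elim (odd (m%n≡0⇒n∣m q 2 eq))
... | 1 | _ = q / 2 , trans (m≡m%n+[m/n]*n q 2) (cong (_+ (q / 2) * 2) eq)
... | suc (suc _) | s≤s (s≤s ())

module _ (M : CommutativeMonoid 0ℓ 0ℓ) where
  open CommutativeMonoid M
  open MonoidSum M

  -- Entries of a monoid cannot be cancelled, so each sum receives the exceptional entry of the
  -- other. It serves to exempt the element 0 in a product over the whole field.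
  sum-replace : ∀ {n} (i : Fin n) (f g : Fin n → Carrier) → (∀ j → j ≢ i → f j ≈ g j) → f i ∙ sum g ≈ g i ∙ sum f
  sum-replace {suc n} i f g eq = begin
    f i ∙ sum g                          ≈⟨ ∙-congˡ (sum-remove g) ⟩
    f i ∙ (g i ∙ sum (removeAt g i))     ≈⟨ ∙-congˡ (∙-congˡ (sum-cong-≋ λ j → eq (punchIn i j) (Fin.punchInᵢ≢i i j))) ⟨
    f i ∙ (g i ∙ sum (removeAt f i))     ≈⟨ assoc _ _ _ ⟨
    (f i ∙ g i) ∙ sum (removeAt f i)     ≈⟨ ∙-congʳ (comm _ _) ⟩
    (g i ∙ f i) ∙ sum (removeAt f i)     ≈⟨ assoc _ _ _ ⟩
    g i ∙ (f i ∙ sum (removeAt f i))     ≈⟨ ∙-congˡ (sum-remove f) ⟨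
    g i ∙ sum f                          ∎
    where open import Relation.Binary.Reasoning.Setoid setoid

module FieldArithmetic {q} (F : FiniteField q) where
  open FieldTheory F
  open FieldCounting F using (2≤order; order-nonZero)
  open CommutativeRing commutativeRing public using (+-commutativeMonoid; *-commutativeMonoid; commutativeSemiring)
  open Exp semiring public using (_^_; ^-assocʳ)
  open CommutativeExp commutativeSemiring public using (^-distrib-*)
  open Mult semiring public using (×1-homo-*) renaming (_×_ to _×ₙ_)
  private
    module order = Bijection order
    module Add = MonoidSum +-commutativeMonoid
    module Mul = MonoidSum *-commutativeMonoid

    to : Carrier → Fin q
    to = order.to

    from : Fin q → Carrier
    from i = proj₁ (order.surjective i)

    to-from : ∀ i → to (from i) ≡ i
    to-from i = proj₂ (order.surjective i) refl

    from-to : ∀ x → from (to x) ≡ x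
    from-to x = order.injective (to-from (to x))

    relabel : (f g : Carrier → Carrier) → (∀ x → f (g x) ≡ x) → (∀ x → g (f x) ≡ x) → Permutation q q
    relabel f g fg gf = permutation (λ i → to (f (from i))) (λ i → to (g (from i))) (inverts f g fg) (inverts g f gf)
      where
      inverts : ∀ (f g : Carrier → Carrier) → (∀ x → f (g x) ≡ x) → ∀ i → to (f (from (to (g (from i))))) ≡ i
      inverts f g fg i = trans (cong (to ∘ f) (from-to (g (from i)))) (trans (cong to (fg (from i))) (to-from i))

  -- The sum of all elements is unchanged by the permutation x ↦ x + 1, which adds 1 to each of its
  -- q terms.
  order×1≡0 : q ×ₙ 1# ≡ 0#
  order×1≡0 = begin
    q ×ₙ 1#  ≡⟨ solve 2 (λ s k → k := s :+ k :- s) refl (Add.sum from) (q ×ₙ 1#) ⟩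
    Add.sum from ⊕ q ×ₙ 1# - Add.sum from       ≡⟨ cong (_- Add.sum from) shifted ⟨
    Add.sum from - Add.sum from                 ≡⟨ -‿inverseʳ _ ⟩
    0#                                          ∎
    where
    open ≡-Reasoning
    π = relabel (_⊕ 1#) (_- 1#) (λ x → solve 1 (λ x → x :- :1 :+ :1 := x) refl x)
        (λ x → solve 1 (λ x → x :+ :1 :- :1 := x) refl x)
    shifted : Add.sum from ≡ Add.sum from ⊕ q ×ₙ 1#
    shifted = begin
      Add.sum from                              ≡⟨ Add.sum-permute from π ⟩
      Add.sum (λ i → from (to (from i ⊕ 1#)))   ≡⟨ Add.sum-cong-≗ (λ i → from-to (from i ⊕ 1#)) ⟩
      Add.sum (λ i → from i ⊕ 1#)               ≡⟨ Add.∑-distrib-+ from (const 1#) ⟩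
      Add.sum from ⊕ Add.sum {q} (const 1#)     ≡⟨ cong (Add.sum from ⊕_) (Add.sum-replicate q) ⟩
      Add.sum from ⊕ q ×ₙ 1#                    ∎

  ^≢0 : ∀ {x} n → x ≢ 0# → x ^ n ≢ 0#
  ^≢0 zero    x≢0 eq = 0≢1 (sym eq)
  ^≢0 (suc n) x≢0 eq = ·≢0 x≢0 (^≢0 n x≢0) eq

  0^ : ∀ n → 0 < n → 0# ^ n ≡ 0#
  0^ (suc n) _ = zeroˡ _

  -- Multiplication by a permutes the nonzero elements, whose product cancels.
  fermat : ∀ a → a ^ q ≡ a
  fermat a with a ≟ 0#
  ... | yes refl = 0^ q (ℕ.≤-trans (s≤s z≤n) 2≤order)
  ... | no a≢0 = begin
    a ^ q                          ≡⟨ Mul.sum-replicate q ⟨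
    Mul.sum {q} (const a)          ≡⟨ *-identityˡ _ ⟨
    1# · Mul.sum {q} (const a)     ≡⟨ cong (_· Mul.sum {q} (const a)) (g-0 (from-to 0#)) ⟨
    g (from i₀) · Mul.sum {q} (const a)   ≡⟨ sum-replace *-commutativeMonoid i₀ (const a) (g ∘ from)
        (λ j j≢i₀ → sym (g-≢0 λ e → j≢i₀ (trans (sym (to-from j)) (cong to e)))) ⟨
    a · Mul.sum (g ∘ from)         ≡⟨ cong (a ·_) ∏g≡1 ⟩
    a · 1#                         ≡⟨ *-identityʳ a ⟩
    a                              ∎
    where
    open ≡-Reasoning
    i₀ = to 0#
    pick : {P : Set} → Dec P → Carrier → Carrier → Carrier
    pick (yes _) x y = x
    pick (no _)  x y = y
    -- Products run over all q elements, so `nz` puts 1 in place of the factor 0; `g` is the factor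
    -- by which multiplication by a then changes `nz x`.
    nz g : Carrier → Carrier
    nz x = pick (x ≟ 0#) 1# x
    g x = pick (x ≟ 0#) 1# a
    g-0 : ∀ {x} → x ≡ 0# → g x ≡ 1#
    g-0 {x} e with x ≟ 0#
    ... | yes _ = refl
    ... | no n  = contradiction e n
    g-≢0 : ∀ {x} → x ≢ 0# → g x ≡ a
    g-≢0 {x} n with x ≟ 0#
    ... | yes e = contradiction e n
    ... | no _  = refl
    nz≢0 : ∀ x → nz x ≢ 0#
    nz≢0 x with x ≟ 0#
    ... | yes _ = λ e → 0≢1 (sym e)
    ... | no n  = n
    nz-· : ∀ x → nz (a · x) ≡ g x · nz x
    nz-· x with x ≟ 0# | (a · x) ≟ 0#
    ... | yes _    | yes _ = sym (*-identityˡ 1#)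
    ... | yes refl | no n  = contradiction (zeroʳ a) n
    ... | no n     | yes e = contradiction (·≡0 a≢0 e) n
    ... | no _     | no _  = refl
    product≢0 : ∀ {n} (f : Fin n → Carrier) → (∀ i → f i ≢ 0#) → Mul.sum f ≢ 0#
    product≢0 {zero}  f n e = 0≢1 (sym e)
    product≢0 {suc _} f n e = ·≢0 (n zero) (product≢0 (f ∘ suc) (n ∘ suc)) e
    i = inverse a≢0
    π = relabel (a ·_) (i ·_)
      (λ x → trans (sym (*-assoc a i x)) (trans (cong (_· x) (inverseʳ a≢0)) (*-identityˡ x)))
      (λ x → trans (sym (*-assoc i a x)) (trans (cong (_· x) (trans (*-comm i a) (inverseʳ a≢0))) (*-identityˡ x)))
    ∏g≡1 : Mul.sum (g ∘ from) ≡ 1#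
    ∏g≡1 = ·-cancelˡ (product≢0 (nz ∘ from) (nz≢0 ∘ from)) (begin
      Mul.sum (nz ∘ from) · Mul.sum (g ∘ from)    ≡⟨ *-comm _ _ ⟩
      Mul.sum (g ∘ from) · Mul.sum (nz ∘ from)    ≡⟨ Mul.∑-distrib-+ (g ∘ from) (nz ∘ from) ⟨
      Mul.sum (λ i → g (from i) · nz (from i))    ≡⟨ Mul.sum-cong-≗ (λ i → nz-· (from i)) ⟨
      Mul.sum (λ i → nz (a · from i))             ≡⟨ Mul.sum-cong-≗ (λ i → cong nz (from-to (a · from i))) ⟨
      Mul.sum (λ i → nz (from (to (a · from i)))) ≡⟨ Mul.sum-permute (nz ∘ from) π ⟨
      Mul.sum (nz ∘ from)                         ≡⟨ *-identityʳ _ ⟨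
      Mul.sum (nz ∘ from) · 1#                    ∎)

  -- With q = 1 + 2k, the equation 2 = 0 would turn q · 1 = 0 into 1 = 0.
  odd⇒2≢0 : ¬ (2 ∣ q) → 1# ⊕ 1# ≢ 0#
  odd⇒2≢0 odd 2≡0 with k , q≡ ← odd⇒2k+1 odd = 0≢1 (begin
    0#                       ≡⟨ order×1≡0 ⟨
    q ×ₙ 1#                  ≡⟨ cong (_×ₙ 1#) q≡ ⟩
    1# ⊕ (k * 2) ×ₙ 1#       ≡⟨ cong (1# ⊕_) (×1-homo-* k 2) ⟩
    1# ⊕ k ×ₙ 1# · (2 ×ₙ 1#) ≡⟨ cong (λ c → 1# ⊕ k ×ₙ 1# · c) (trans (cong (1# ⊕_) (+-identityʳ 1#)) 2≡0) ⟩
    1# ⊕ k ×ₙ 1# · 0#        ≡⟨ solve 1 (λ k → :1 :+ k :* :0 := :1) refl (k ×ₙ 1#) ⟩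
    1#                       ∎)
    where open ≡-Reasoning

  module Characteristic {p} (pp : Prime p) (char : p ×ₙ 1# ≡ 0#) where
    multiple×≡0 : ∀ {n} → p ∣ n → ∀ x → n ×ₙ x ≡ 0#
    multiple×≡0 (divides k refl) x = begin
      (k * p) ×ₙ x              ≡⟨ cong ((k * p) ×ₙ_) (*-identityˡ x) ⟨
      (k * p) ×ₙ (1# · x)       ≡⟨ Mult.×-assoc-* semiring (k * p) 1# x ⟨
      (k * p) ×ₙ 1# · x         ≡⟨ cong (_· x) (×1-homo-* k p) ⟩
      k ×ₙ 1# · (p ×ₙ 1#) · x   ≡⟨ cong (λ c → k ×ₙ 1# · c · x) char ⟩
      k ×ₙ 1# · 0# · x          ≡⟨ solve 2 (λ k x → k :* :0 :* x := :0) refl (k ×ₙ 1#) x ⟩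
      0#                        ∎
      where open ≡-Reasoning

    frobenius : ∀ x y → (x ⊕ y) ^ p ≡ x ^ p ⊕ y ^ p
    frobenius x y = ends p (ℕ.<-trans (s≤s z≤n) (ℕ.nonTrivial⇒n>1 p {{prime⇒nonTrivial pp}})) (prime∣C pp)
      where
      open ≡-Reasoning
      -- The exponent n is separated from the prime: it has to become a successor for the two outer
      -- binomial terms to split off, while divisibility keeps referring to `p`.
      ends : ∀ n → 0 < n → (∀ {k} → 0 < k → k < n → p ∣ n C k) → (x ⊕ y) ^ n ≡ x ^ n ⊕ y ^ n
      ends (suc n) _ p∣C = begin
        (x ⊕ y) ^ suc n  ≡⟨ Binomial.theorem commutativeSemiring (suc n) x y ⟩
        term zero ⊕ Add.sum (term ∘ suc)  ≡⟨ cong (term zero ⊕_) (Add.sum-init-last (term ∘ suc)) ⟩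
        term zero ⊕ (Add.sum middle ⊕ term (Fin.fromℕ (suc n)))  ≡⟨ cong₂ _⊕_ first
            (cong₂ _⊕_ (trans (Add.sum-cong-≗ vanish) (trans (Add.sum-replicate-zero n) refl)) last) ⟩
        y ^ suc n ⊕ (0# ⊕ x ^ suc n)  ≡⟨ solve 2 (λ x y → y :+ (:0 :+ x) := x :+ y) refl (x ^ suc n) (y ^ suc n) ⟩
        x ^ suc n ⊕ y ^ suc n                                    ∎
        where
        term = Binomial.binomialTerm commutativeSemiring x y (suc n)
        middle : Fin n → Carrier
        middle i = term (suc (Fin.inject₁ i))
        vanish : ∀ i → middle i ≡ 0#
        vanish i = multiple×≡0 (p∣C (s≤s z≤n) (s≤s (subst (_< n) (sym (Fin.toℕ-inject₁ i)) (Fin.toℕ<n i)))) _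
        first : term zero ≡ y ^ suc n
        first = trans (+-identityʳ _) (*-identityˡ _)
        last : term (Fin.fromℕ (suc n)) ≡ x ^ suc n
        last = trans (cong (λ k → (suc n C k) ×ₙ (x ^ k · y ^ (suc n ∸ k))) (Fin.toℕ-fromℕ (suc n)))
          (trans (cong₂ (λ k e → k ×ₙ (x ^ suc n · y ^ e)) (nCn≡1 (suc n)) (ℕ.n∸n≡0 (suc n)))
              (trans (+-identityʳ _) (*-identityʳ _)))

    frobenius^ : ∀ k x y → (x ⊕ y) ^ (p ℕ.^ k) ≡ x ^ (p ℕ.^ k) ⊕ y ^ (p ℕ.^ k)
    frobenius^ zero    x y = solve 2 (λ x y → (x :+ y) :* :1 := x :* :1 :+ y :* :1) refl x y
    frobenius^ (suc k) x y = begin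
      (x ⊕ y) ^ (p * p ℕ.^ k)                       ≡⟨ ^-assocʳ (x ⊕ y) p (p ℕ.^ k) ⟨
      ((x ⊕ y) ^ p) ^ (p ℕ.^ k)                     ≡⟨ cong (_^ (p ℕ.^ k)) (frobenius x y) ⟩
      (x ^ p ⊕ y ^ p) ^ (p ℕ.^ k)                   ≡⟨ frobenius^ k (x ^ p) (y ^ p) ⟩
      (x ^ p) ^ (p ℕ.^ k) ⊕ (y ^ p) ^ (p ℕ.^ k)  ≡⟨ cong₂ _⊕_ (^-assocʳ x p (p ℕ.^ k)) (^-assocʳ y p (p ℕ.^ k)) ⟩
      x ^ (p * p ℕ.^ k) ⊕ y ^ (p * p ℕ.^ k)         ∎
      where open ≡-Reasoning

  -- As q = p^k, the k-th power of p · 1 is q · 1 = 0, and a field has no nonzero nilpotent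
  -- elements.
  prime-characteristic : ∀ {p} k → q ≡ p ℕ.^ k → p ×ₙ 1# ≡ 0#
  prime-characteristic {p} k q≡ with (p ×ₙ 1#) ≟ 0#
  ... | yes e = e
  ... | no n  = contradiction (trans (sym (homo k)) (trans (cong (_×ₙ 1#) (sym q≡)) order×1≡0)) (^≢0 k n)
    where
    homo : ∀ k → (p ℕ.^ k) ×ₙ 1# ≡ (p ×ₙ 1#) ^ k
    homo zero    = +-identityʳ 1#
    homo (suc k) = trans (×1-homo-* p (p ℕ.^ k)) (cong (p ×ₙ 1# ·_) (homo k))

  -- Monic polynomials, by their coefficients below the leading one, in
  -- increasing order of degree.
  monic : ∀ {n} → Vec Carrier n → Carrier → Carrier
  monic []       x = 1#
  monic (c ∷ cs) x = c ⊕ x · monic cs x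

  -- Synthetic division by x - a: the coefficients of the quotient are the Horner values at a of the
  -- tails of the polynomial.
  quotient : ∀ {n} → Vec Carrier (suc n) → Carrier → Vec Carrier n
  quotient (c ∷ [])     a = []
  quotient (c ∷ d ∷ cs) a = monic (d ∷ cs) a ∷ quotient (d ∷ cs) a

  quotient-correct : ∀ {n} (cs : Vec Carrier (suc n)) a x → monic cs x - monic cs a ≡ (x - a) · monic (quotient cs a) x
  quotient-correct (c ∷ [])     a x = solve 3 (λ c a x → c :+ x :* :1 :- (c :+ a :* :1) := (x :- a) :* :1) refl c a x
  quotient-correct (c ∷ d ∷ cs) a x = begin
    c ⊕ x · fx - (c ⊕ a · fa)  ≡⟨ solve 5 (λ c x fx a fa → c :+ x :* fx :- (c :+ a :* fa) := (x :- a) :* fa :+ x :*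
        (fx :- fa)) refl c x fx a fa ⟩
    (x - a) · fa ⊕ x · (fx - fa)  ≡⟨ cong (λ e → (x - a) · fa ⊕ x · e) (quotient-correct (d ∷ cs) a x) ⟩
    (x - a) · fa ⊕ x · ((x - a) · gx)  ≡⟨ solve 4 (λ x a fa gx → (x :- a) :* fa :+ x :* ((x :- a) :* gx) :=
        (x :- a) :* (fa :+ x :* gx)) refl x a fa gx ⟩
    (x - a) · (fa ⊕ x · gx)               ∎
    where
    open ≡-Reasoning
    fx = monic (d ∷ cs) x
    fa = monic (d ∷ cs) a
    gx = monic (quotient (d ∷ cs) a) x

  roots≤degree : ∀ {n} (cs : Vec Carrier n) {xs} → AllPairs _≢_ xs → All (λ x → monic cs x ≡ 0#) xs → length xs ≤ n
  roots≤degree cs       []         []         = z≤n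
  roots≤degree []       (_ ∷ _)    (e ∷ _)    = contradiction (sym e) 0≢1
  roots≤degree (c ∷ cs) {a ∷ xs} (a≢ ∷ distinct) (root ∷ roots) =
    s≤s (roots≤degree (quotient (c ∷ cs) a) distinct (All.zipWith (λ (a≢x , fx) → other a≢x fx) (a≢ , roots)))
    where
    other : ∀ {x} → a ≢ x → monic (c ∷ cs) x ≡ 0# → monic (quotient (c ∷ cs) a) x ≡ 0#
    other {x} a≢x fx = ·≡0 (λ e → a≢x (sym (-≡0 e))) (trans (sym (quotient-correct (c ∷ cs) a x))
      (trans (cong₂ _-_ fx root) (-‿inverseʳ 0#)))

  fixed≤ : ∀ {n xs} → 2 ≤ n → AllPairs _≢_ xs → All (λ x → x ^ n ≡ x) xs → length xs ≤ n
  -- These are the coefficients of x^(n+2) - x. Degree at least 2 keeps the coefficient -1 of x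
  -- apart from the leading one.
  fixed≤ {suc (suc n)} (s≤s (s≤s _)) distinct fixed = roots≤degree (0# ∷ (- 1#) ∷ Vec.replicate n 0#) distinct
      (All.map root fixed)
    where
    power : ∀ n x → monic (Vec.replicate n 0#) x ≡ x ^ n
    power zero    x = refl
    power (suc n) x = trans (+-identityˡ _) (cong (x ·_) (power n x))
    root : ∀ {x} → x ^ suc (suc n) ≡ x → 0# ⊕ x · (- 1# ⊕ x · monic (Vec.replicate n 0#) x) ≡ 0#
    root {x} e = trans (cong (λ c → 0# ⊕ x · (- 1# ⊕ x · c)) (power n x))
      (trans (solve 2 (λ x c → :0 :+ x :* (:- :1 :+ x :* c) := x :* (x :* c) :- x) refl x (x ^ n)) (≡⇒-≡0 e))

-- The quadratic extension and its basis 1, ω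

module QuadraticExtension {q} (pp : IsOddPrimePower q) (F : FiniteField q) (K : FiniteField (q ℕ.^ 2)) (emb : FieldEmbedding F K) where
  private
    module 𝔽 where
      open FieldTheory F public
      open FieldCounting F public
      open FieldArithmetic F public
  open FieldTheory K
  open FieldCounting K
  open FieldArithmetic K
  open FieldEmbedding emb public using (ι)
  open IsRingHomomorphism (FieldEmbedding.isHomomorphism emb) public
    using () renaming (+-homo to ι-+; *-homo to ι-·; -‿homo to ι-neg; 0#-homo to ι-0; 1#-homo to ι-1)
  open 𝔽 using (order-nonZero)

  ι≢0 : ∀ {a} → a ≢ 𝔽.0# → ι a ≢ 0#
  ι≢0 {a} a≢0 e = 0≢1 (begin
    0#                              ≡⟨ zeroˡ _ ⟨
    0# · ι (𝔽.inverse a≢0)          ≡⟨ cong (_· ι (𝔽.inverse a≢0)) e ⟨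
    ι a · ι (𝔽.inverse a≢0)         ≡⟨ ι-· a _ ⟨
    ι (a 𝔽.· 𝔽.inverse a≢0)         ≡⟨ cong ι (𝔽.inverseʳ a≢0) ⟩
    ι 𝔽.1#                          ≡⟨ ι-1 ⟩
    1#                              ∎)
    where open ≡-Reasoning

  ι≡0 : ∀ {a} → ι a ≡ 0# → a ≡ 𝔽.0#
  ι≡0 {a} e = decidable-stable (a 𝔽.≟ 𝔽.0#) λ a≢0 → ι≢0 a≢0 e

  ι-injective : ∀ {a b} → ι a ≡ ι b → a ≡ b
  ι-injective {a} {b} e = 𝔽.-≡0 (ι≡0 (trans (ι-+ a (𝔽.- b)) (trans (cong (ι a ⊕_) (ι-neg b)) (≡⇒-≡0 e))))

  2≢0ᶠ : 𝔽.1# 𝔽.⊕ 𝔽.1# ≢ 𝔽.0#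
  2≢0ᶠ = 𝔽.odd⇒2≢0 (proj₂ pp)

  2≢0 : 1# ⊕ 1# ≢ 0#
  2≢0 e = ι≢0 2≢0ᶠ (trans (ι-+ 𝔽.1# 𝔽.1#) (trans (cong₂ _⊕_ ι-1 ι-1) e))

  conj : Carrier → Carrier
  conj x = x ^ q

  -- Conjugation is an iterated Frobenius map: q is a power of p, and the order q² of the extension
  -- being one too, its characteristic is the same p.
  conj-+ : ∀ x y → conj (x ⊕ y) ≡ conj x ⊕ conj y
  conj-+ x y = let p , h , p-prime , q≡ = proj₁ pp in
    subst (λ k → (x ⊕ y) ^ k ≡ x ^ k ⊕ y ^ k) (sym q≡)
      (Characteristic.frobenius^ p-prime (prime-characteristic {p} (suc h * 2)
          (trans (cong (ℕ._^ 2) q≡) (ℕ.^-*-assoc p (suc h) 2))) (suc h) x y)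

  conj-· : ∀ x y → conj (x · y) ≡ conj x · conj y
  conj-· x y = ^-distrib-* x y q

  conj-ι : ∀ a → conj (ι a) ≡ ι a
  conj-ι a = trans (homo q) (cong ι (𝔽.fermat a))
    where
    homo : ∀ n → ι a ^ n ≡ ι (a 𝔽.^ n)
    homo zero    = sym ι-1
    homo (suc n) = trans (cong (ι a ·_) (homo n)) (sym (ι-· a _))

  conj-conj : ∀ x → conj (conj x) ≡ x
  conj-conj x = trans (^-assocʳ x q q) (trans (cong (x ^_) (cong (q *_) (sym (ℕ.*-identityʳ q)))) (fermat x))

  conj-neg : ∀ x → conj (- x) ≡ - conj x
  conj-neg x = trans (cong conj (solve 1 (λ x → :- x := :- :1 :* x) refl x)) (trans (conj-· (- 1#) x)
    (trans (cong (_· conj x) (trans (cong conj (sym ι-neg-1)) (trans (conj-ι _) ι-neg-1)))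
        (solve 1 (λ x → :- :1 :* x := :- x) refl (conj x))))
    where
    ι-neg-1 : ι (𝔽.- 𝔽.1#) ≡ - 1#
    ι-neg-1 = trans (ι-neg 𝔽.1#) (cong -_ ι-1)

  conj-0 : conj 0# ≡ 0#
  conj-0 = trans (cong conj (sym ι-0)) (trans (conj-ι 𝔽.0#) ι-0)

  -- The q elements of the subfield are already roots of x^q - x; a further fixed element would be a
  -- root too many.
  fixed⇒ι : ∀ {x} → conj x ≡ x → ∃ λ a → x ≡ ι a
  fixed⇒ι {x} fixed with 𝔽.scalars.∃? (λ a → x ≟ ι a) 𝔽.resp≡
  ... | yes p = p
  ... | no ¬∃ = contradiction (subst (λ n → suc n ≤ q) (trans (List.length-map ι 𝔽.scalars.elements) 𝔽.length-scalars)
      (fixed≤ 𝔽.2≤order distinct (fixed ∷ All.map⁺ (All.universal conj-ι 𝔽.scalars.elements)))) ℕ.1+n≰n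
    where
    distinct : AllPairs _≢_ (x ∷ List.map ι 𝔽.scalars.elements)
    distinct = All.map⁺ (All.universal (λ a e → ¬∃ (a , e)) 𝔽.scalars.elements)
      ∷ AllPairs.map⁺ (AllPairs.map (λ ne e → ne (ι-injective e)) 𝔽.scalars.unique)

  ∃-not-fixed : ∃ λ e → conj e ≢ e
  ∃-not-fixed with scalars.∃? (λ e → ¬? (conj e ≟ e)) resp≡
  ... | yes p = p
  ... | no ¬∃ = contradiction (subst (_≤ q) length-scalars (fixed≤ 𝔽.2≤order scalars.unique
        (All.universal (λ x → decidable-stable (conj x ≟ x) λ ne → ¬∃ (x , ne)) scalars.elements)))
      (ℕ.<⇒≱ (subst (q <_) (cong (q *_) (sym (ℕ.*-identityʳ q))) (ℕ.m<m*n q q 𝔽.2≤order)))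

  private abstract
    -- For e not fixed by conjugation, e minus its conjugate is nonzero and changes sign under
    -- conjugation.
    generator : ∃ λ w → w ≢ 0# × conj w ≡ - w
    generator = let e , e≢ = ∃-not-fixed in e - conj e
      , (λ z → e≢ (sym (-≡0 z)))
      , trans (conj-+ e (- conj e)) (trans (cong (conj e ⊕_) (trans (conj-neg (conj e)) (cong -_ (conj-conj e))))
          (solve 2 (λ e c → c :- e := :- (e :- c)) refl e (conj e)))

  ω : Carrier
  ω = proj₁ generator

  ω≢0 : ω ≢ 0#
  ω≢0 = proj₁ (proj₂ generator)

  conj-ω : conj ω ≡ - ω
  conj-ω = proj₂ (proj₂ generator)

  conj-ω· : ∀ x → conj (ω · x) ≡ - ω · conj x
  conj-ω· x = trans (conj-· ω x) (cong (_· conj x) conj-ω)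

  private abstract
    square : ∃ λ d → ω · ω ≡ ι d
    square = fixed⇒ι (trans (conj-ω· ω) (trans (cong (- ω ·_) conj-ω) (solve 1 (λ w → :- w :* :- w := w :* w) refl ω)))

  δ : 𝔽.Carrier
  δ = proj₁ square

  ω² : ω · ω ≡ ι δ
  ω² = proj₂ square

  double≡0 : ∀ {x} → x ⊕ x ≡ 0# → x ≡ 0#
  double≡0 {x} e = ·≡0 2≢0 (trans (solve 1 (λ x → (:1 :+ :1) :* x := x :+ x) refl x) e)

  -- Adding the conjugate relation a - ωb = 0 gives 2a = 0, and 2 is invertible.
  ω-independent : ∀ {a b} → ι a ⊕ ω · ι b ≡ 0# → a ≡ 𝔽.0# × b ≡ 𝔽.0#
  ω-independent {a} {b} e = ι≡0 ιa≡0 , ι≡0 (·≡0 ω≢0 (trans (sym (+-identityˡ _)) (trans (cong (_⊕ ω · ι b) (sym ιa≡0)) e)))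
    where
    conjugate : ι a ⊕ - ω · ι b ≡ 0#
    conjugate = trans (sym (trans (conj-+ _ _) (cong₂ _⊕_ (conj-ι a)
        (trans (conj-ω· (ι b)) (cong (- ω ·_) (conj-ι b)))))) (trans (cong conj e) conj-0)
    ιa≡0 : ι a ≡ 0#
    ιa≡0 = double≡0 (trans (solve 3 (λ a w b → a :+ a := (a :+ w :* b) :+ (a :+ :- w :* b)) refl (ι a) ω (ι b))
        (trans (cong₂ _⊕_ e conjugate) (+-identityˡ 0#)))

  ω-injective : ∀ {a b c d} → ι a ⊕ ω · ι b ≡ ι c ⊕ ω · ι d → a ≡ c × b ≡ d
  ω-injective {a} {b} {c} {d} e = 𝔽.-≡0 (proj₁ parts) , 𝔽.-≡0 (proj₂ parts)
    where
    ι-minus : ∀ a b → ι (a 𝔽.- b) ≡ ι a - ι b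
    ι-minus a b = trans (ι-+ a (𝔽.- b)) (cong (ι a ⊕_) (ι-neg b))
    parts : a 𝔽.- c ≡ 𝔽.0# × b 𝔽.- d ≡ 𝔽.0#
    parts = ω-independent (trans (cong₂ (λ x y → x ⊕ ω · y) (ι-minus a c) (ι-minus b d))
      (trans (solve 5 (λ a b c d w → (a :- c) :+ w :* (b :- d) := (a :+ w :* b) :- (c :+ w :* d)) refl (ι a) (ι b)
          (ι c) (ι d) ω) (≡⇒-≡0 e)))

  -- A square root of δ in the subfield would be ω or -ω. Then ω would be fixed by conjugation as
  -- well as negated by it, so 2ω = 0.
  δ-nonsquare : ∀ s → s 𝔽.· s ≢ δ
  δ-nonsquare s e = [ plus , minus ]′ (square-roots (trans ω² (trans (cong ι (sym e)) (ι-· s s))))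
    where
    plus : ω ≢ ι s
    plus p = ω≢0 (double≡0 (trans (cong (_⊕ ω) (trans p (trans (sym (conj-ι s)) (trans (cong conj (sym p)) conj-ω))))
        (-‿inverseˡ ω)))
    minus : ω ≢ - ι s
    minus p = plus (trans (solve 1 (λ x → x := :- (:- x)) refl ω) (trans (cong -_ (trans (sym conj-ω) (trans (cong conj p)
      (trans (conj-neg _) (cong -_ (conj-ι s)))))) (solve 1 (λ x → :- (:- x) := x) refl (ι s))))

  δ≢0 : δ ≢ 𝔽.0#
  δ≢0 e = δ-nonsquare 𝔽.0# (trans (𝔽.zeroˡ _) (sym e))

  private abstract
    half : ∃ λ k → conj k ≡ k × k ⊕ k ≡ 1#
    half = ι h , conj-ι h , trans (sym (ι-+ h h)) (trans (cong ι
        (trans (𝔽.solve 1 (λ h → h 𝔽.:+ h 𝔽.:= (𝔽.:1 𝔽.:+ 𝔽.:1) 𝔽.:* h) refl h) (𝔽.inverseʳ 2≢0ᶠ))) ι-1)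
      where
      h : 𝔽.Carrier
      h = 𝔽.inverse 2≢0ᶠ

    real-part : ∀ x → ∃ λ a → (x ⊕ conj x) · proj₁ half ≡ ι a
    real-part x = fixed⇒ι (trans (conj-· _ _) (cong₂ _·_ (trans (conj-+ x (conj x))
        (trans (cong (conj x ⊕_) (conj-conj x)) (+-comm _ _))) (proj₁ (proj₂ half))))

    ω⁻¹ : Carrier
    ω⁻¹ = inverse ω≢0

    ω·ω⁻¹ : ω · ω⁻¹ ≡ 1#
    ω·ω⁻¹ = inverseʳ ω≢0

    conj-ω⁻¹ : conj ω⁻¹ ≡ - ω⁻¹
    conj-ω⁻¹ = ·-cancelˡ ω≢0 (begin
      ω · conj ω⁻¹          ≡⟨ solve 2 (λ w c → w :* c := :- (:- w :* c)) refl ω (conj ω⁻¹) ⟩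
      - (- ω · conj ω⁻¹)    ≡⟨ cong -_ (conj-ω· ω⁻¹) ⟨
      - conj (ω · ω⁻¹)      ≡⟨ cong (λ c → - conj c) (trans (ω·ω⁻¹) (sym ι-1)) ⟩
      - conj (ι 𝔽.1#)       ≡⟨ cong -_ (trans (conj-ι 𝔽.1#) ι-1) ⟩
      - 1#                  ≡⟨ cong -_ (ω·ω⁻¹) ⟨
      - (ω · ω⁻¹)           ≡⟨ solve 2 (λ w c → :- (w :* c) := w :* :- c) refl ω ω⁻¹ ⟩
      ω · - ω⁻¹             ∎)
      where open ≡-Reasoning

    imaginary-part : ∀ x → ∃ λ a → (x - conj x) · proj₁ half · ω⁻¹ ≡ ι a
    imaginary-part x = fixed⇒ι (begin
      conj ((x - conj x) · k · ω⁻¹)                  ≡⟨ trans (conj-· _ _) (cong₂ _·_ (conj-· _ _) conj-ω⁻¹) ⟩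
      conj (x - conj x) · conj k · - ω⁻¹  ≡⟨ cong₂ (λ c e → c · e · - ω⁻¹)
          (trans (conj-+ x _) (cong (conj x ⊕_) (trans (conj-neg _) (cong -_ (conj-conj x))))) (proj₁ (proj₂ half)) ⟩
      (conj x - x) · k · - ω⁻¹  ≡⟨ solve 4 (λ x c k i → (c :- x) :* k :* :- i := (x :- c) :* k :* i) refl x (conj x) k ω⁻¹ ⟩
      (x - conj x) · k · ω⁻¹                         ∎)
      where
      open ≡-Reasoning
      k : Carrier
      k = proj₁ half

  -- These are (x + x^q)/2 and (x - x^q)/(2ω). Both are fixed by conjugation, hence images of
  -- elements of the subfield.
  re im : Carrier → 𝔽.Carrier
  re x = proj₁ (real-part x)
  im x = proj₁ (imaginary-part x)

  re-im : ∀ x → x ≡ ι (re x) ⊕ ω · ι (im x)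
  re-im x = sym (begin
    ι (re x) ⊕ ω · ι (im x)  ≡⟨ cong₂ (λ a c → a ⊕ ω · c) (proj₂ (real-part x)) (proj₂ (imaginary-part x)) ⟨
    (x ⊕ conj x) · k ⊕ ω · ((x - conj x) · k · ω⁻¹)  ≡⟨ solve 5 (λ x c k w i → (x :+ c) :* k :+ w :*
        ((x :- c) :* k :* i) := (x :+ c) :* k :+ (w :* i) :* ((x :- c) :* k)) refl x (conj x) k ω ω⁻¹ ⟩
    (x ⊕ conj x) · k ⊕ (ω · ω⁻¹) · ((x - conj x) · k)  ≡⟨ cong (λ c → (x ⊕ conj x) · k ⊕ c · ((x - conj x) · k)) (ω·ω⁻¹) ⟩
    (x ⊕ conj x) · k ⊕ 1# · ((x - conj x) · k)  ≡⟨ solve 3 (λ x c k → (x :+ c) :* k :+ :1 :* ((x :- c) :* k) := x :*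
        (k :+ k)) refl x (conj x) k ⟩
    x · (k ⊕ k)                                              ≡⟨ cong (x ·_) (proj₂ (proj₂ half)) ⟩
    x · 1#                                                   ≡⟨ *-identityʳ x ⟩
    x                                                        ∎)
    where
    open ≡-Reasoning
    k = proj₁ half

-- Points and lines through their generators

module Spans {q} (F : FiniteField q) where
  open FieldTheory F
  open FieldCounting F

  module _ {n : ℕ} where

    private
      combination₁ : ∀ c (p : Vector n) → combination (c ∷ []) (p ∷ []) ≡ c ·ᵛ p
      combination₁ c p = +ᵛ-identityʳ (c ·ᵛ p)

      combination₂ : ∀ a b (u v : Vector n) → combination (a ∷ b ∷ []) (u ∷ v ∷ []) ≡ lc a b u v
      combination₂ a b u v = cong (a ·ᵛ u +ᵛ_) (+ᵛ-identityʳ (b ·ᵛ v))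

    gen : Subspace n 1 → Vector n
    gen P = Vec.head (Subspace.basis P)

    ∈-point⁻ : ∀ P {x} → x ∈ ⟦ P ⟧ → ∃ λ c → x ≡ c ·ᵛ gen P
    ∈-point⁻ record { basis = p ∷ [] } (c ∷ [] , e) = c , trans e (combination₁ c p)

    ∈-point⁺ : ∀ P c → c ·ᵛ gen P ∈ ⟦ P ⟧
    ∈-point⁺ record { basis = p ∷ [] } c = c ∷ [] , sym (combination₁ c p)

    gen≢0 : ∀ P → gen P ≢ 0ᵛ
    gen≢0 record { basis = p ∷ [] ; independent = ind } e = 0≢1 (sym (Vec.∷-injectiveˡ (ind (1# ∷ [])
      (trans (combination₁ 1# p) (trans (·ᵛ-identity p) e)))))

    gen∈ : ∀ P → gen P ∈ ⟦ P ⟧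
    gen∈ P = subst (_∈ ⟦ P ⟧) (·ᵛ-identity (gen P)) (∈-point⁺ P 1#)

    ·ᵛ-gen-injective : ∀ P {c d} → c ·ᵛ gen P ≡ d ·ᵛ gen P → c ≡ d
    ·ᵛ-gen-injective P {c} {d} e = -≡0 (·ᵛ≡0⇒scalar≡0 (gen≢0 P) (trans
      (entrywise ((c - d) ⊡ ⌜ gen P ⌝) (c ⊡ ⌜ gen P ⌝ ⊞ (- 1#) ⊡ d ⊡ ⌜ gen P ⌝)
        λ i → solve 3 (λ c d x → (c :- d) :* x := c :* x :+ :- :1 :* (d :* x)) refl c d (lookup (gen P) i))
      (trans (cong (_+ᵛ (- 1#) ·ᵛ d ·ᵛ gen P) e)
        (entrywise (d ⊡ ⌜ gen P ⌝ ⊞ (- 1#) ⊡ d ⊡ ⌜ gen P ⌝) 𝟎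
          λ i → solve 2 (λ d x → d :* x :+ :- :1 :* (d :* x) := :0) refl d (lookup (gen P) i)))))

    mkPoint : ∀ p → p ≢ 0ᵛ → Subspace n 1
    mkPoint p p≢0 = record
      { basis       = p ∷ []
      ; independent = λ { (c ∷ []) e → cong (_∷ []) (·ᵛ≡0⇒scalar≡0 p≢0 (trans (sym (combination₁ c p)) e)) }
      }

    proportional : ∀ P {x y} → x ∈ ⟦ P ⟧ → x ≢ 0ᵛ → y ∈ ⟦ P ⟧ → ∃ λ c → y ≡ c ·ᵛ x
    proportional P {x} {y} x∈ x≢0 y∈ with ∈-point⁻ P x∈ | ∈-point⁻ P y∈
    ... | a , refl | b , refl = b · inverse a≢0 , sym (begin
      (b · inverse a≢0) ·ᵛ a ·ᵛ gen P   ≡⟨ ·ᵛ-assoc (b · inverse a≢0) a (gen P) ⟩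
      (b · inverse a≢0 · a) ·ᵛ gen P  ≡⟨ cong (_·ᵛ gen P) (solve 3 (λ b i a → b :* i :* a := b :* (a :* i)) refl b
          (inverse a≢0) a) ⟩
      (b · (a · inverse a≢0)) ·ᵛ gen P  ≡⟨ cong (_·ᵛ gen P) (trans (cong (b ·_) (inverseʳ a≢0)) (*-identityʳ b)) ⟩
      b ·ᵛ gen P                        ∎)
      where
      open ≡-Reasoning
      a≢0 : a ≢ 0#
      a≢0 refl = x≢0 (0·ᵛ (gen P))

    point-⊆ : ∀ P Q {x} → x ∈ ⟦ P ⟧ → x ≢ 0ᵛ → x ∈ ⟦ Q ⟧ → ⟦ P ⟧ ⊆ ⟦ Q ⟧
    point-⊆ P Q x∈P x≢0 x∈Q y∈P with proportional P x∈P x≢0 y∈P | ∈-point⁻ Q x∈Q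
    ... | c , refl | a , refl = subst (_∈ ⟦ Q ⟧) (sym (·ᵛ-assoc c a (gen Q))) (∈-point⁺ Q (c · a))

    Independent : Vector n → Vector n → Set
    Independent u v = ∀ {a b} → lc a b u v ≡ 0ᵛ → a ≡ 0# × b ≡ 0#

    gen₁ gen₂ : Subspace n 2 → Vector n
    gen₁ ℓ = Vec.head (Subspace.basis ℓ)
    gen₂ ℓ = Vec.head (Vec.tail (Subspace.basis ℓ))

    gens-independent : ∀ ℓ → Independent (gen₁ ℓ) (gen₂ ℓ)
    gens-independent record { basis = u ∷ v ∷ [] ; independent = ind } {a} {b} e =
      let eq = ind (a ∷ b ∷ []) (trans (combination₂ a b u v) e)
      in Vec.∷-injectiveˡ eq , Vec.∷-injectiveˡ (Vec.∷-injectiveʳ eq)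

    ∈-line⁻ : ∀ ℓ {x} → x ∈ ⟦ ℓ ⟧ → ∃₂ λ a b → x ≡ lc a b (gen₁ ℓ) (gen₂ ℓ)
    ∈-line⁻ record { basis = u ∷ v ∷ [] } (a ∷ b ∷ [] , e) = a , b , trans e (combination₂ a b u v)

    ∈-line⁺ : ∀ ℓ a b → lc a b (gen₁ ℓ) (gen₂ ℓ) ∈ ⟦ ℓ ⟧
    ∈-line⁺ record { basis = u ∷ v ∷ [] } a b = a ∷ b ∷ [] , sym (combination₂ a b u v)

    gen₁∈ : ∀ ℓ → gen₁ ℓ ∈ ⟦ ℓ ⟧
    gen₁∈ ℓ = subst (_∈ ⟦ ℓ ⟧) (lc-10 (gen₁ ℓ) (gen₂ ℓ)) (∈-line⁺ ℓ 1# 0#)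

    gen₂∈ : ∀ ℓ → gen₂ ℓ ∈ ⟦ ℓ ⟧
    gen₂∈ ℓ = subst (_∈ ⟦ ℓ ⟧) (lc-01 (gen₁ ℓ) (gen₂ ℓ)) (∈-line⁺ ℓ 0# 1#)

    line-lc : ∀ ℓ a b {x y} → x ∈ ⟦ ℓ ⟧ → y ∈ ⟦ ℓ ⟧ → lc a b x y ∈ ⟦ ℓ ⟧
    line-lc ℓ a b x∈ y∈ with ∈-line⁻ ℓ x∈ | ∈-line⁻ ℓ y∈
    ... | c , d , refl | e , f , refl = subst (_∈ ⟦ ℓ ⟧) (sym (lc-lc a b c d e f (gen₁ ℓ) (gen₂ ℓ))) (∈-line⁺ ℓ _ _)

    line-· : ∀ ℓ a {x} → x ∈ ⟦ ℓ ⟧ → a ·ᵛ x ∈ ⟦ ℓ ⟧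
    line-· ℓ a x∈ with ∈-line⁻ ℓ x∈
    ... | c , d , refl = subst (_∈ ⟦ ℓ ⟧) (sym (·-lc a c d (gen₁ ℓ) (gen₂ ℓ))) (∈-line⁺ ℓ _ _)

    line-+ : ∀ ℓ {x y} → x ∈ ⟦ ℓ ⟧ → y ∈ ⟦ ℓ ⟧ → x +ᵛ y ∈ ⟦ ℓ ⟧
    line-+ ℓ x∈ y∈ = subst₂ (λ x y → x +ᵛ y ∈ ⟦ ℓ ⟧) (·ᵛ-identity _) (·ᵛ-identity _) (line-lc ℓ 1# 1# x∈ y∈)

    point-⊆-line : ∀ P ℓ → gen P ∈ ⟦ ℓ ⟧ → ⟦ P ⟧ ⊆ ⟦ ℓ ⟧
    point-⊆-line P ℓ g∈ x∈ = let c , e = ∈-point⁻ P x∈ in subst (_∈ ⟦ ℓ ⟧) (sym e) (line-· ℓ c g∈)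

    line-subspace : ∀ ℓ → IsSubspace ⟦ ℓ ⟧
    line-subspace ℓ = record
      { 0∈       = subst (_∈ ⟦ ℓ ⟧) (lc-00 (gen₁ ℓ) (gen₂ ℓ)) (∈-line⁺ ℓ 0# 0#)
      ; +-closed = line-+ ℓ
      ; ·-closed = λ a → line-· ℓ a
      }

    mkLine : ∀ u v → Independent u v → Subspace n 2
    mkLine u v ind = record
      { basis       = u ∷ v ∷ []
      ; independent = λ { (a ∷ b ∷ []) e → let p , r = ind (trans (sym (combination₂ a b u v)) e) in cong₂ (λ a b → a ∷ b ∷ []) p r }
      }

    independent⇒≢0ˡ : ∀ {u v} → Independent u v → u ≢ 0ᵛ
    independent⇒≢0ˡ {u} {v} ind e = 0≢1 (sym (proj₁ (ind (trans (lc-10 u v) e))))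

    independent⇒≢0ʳ : ∀ {u v} → Independent u v → v ≢ 0ᵛ
    independent⇒≢0ʳ {u} {v} ind e = 0≢1 (sym (proj₂ (ind (trans (lc-01 u v) e))))

    independent⁺ : ∀ {u v} → u ≢ 0ᵛ → (∀ t → v ≢ t ·ᵛ u) → Independent u v
    independent⁺ {u} {v} u≢0 ¬∥ {a} {b} e with b ≟ 0#
    ... | yes refl = ·ᵛ≡0⇒scalar≡0 u≢0 (trans (entrywise (a ⊡ ⌜ u ⌝) (a ⊡ ⌜ u ⌝ ⊞ 0# ⊡ ⌜ v ⌝)
                       λ i → solve 3 (λ a x y → a :* x := a :* x :+ :0 :* y) refl a (lookup u i) (lookup v i)) e) , refl
    ... | no b≢0 = contradiction (·ᵛ-cancelˡ b≢0 (begin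
      b ·ᵛ v                               ≡⟨ entrywise (b ⊡ ⌜ v ⌝) ((a ⊡ ⌜ u ⌝ ⊞ b ⊡ ⌜ v ⌝) ⊞ (- a) ⊡ ⌜ u ⌝)
                                                (λ i → solve 4 (λ a b x y → b :* y :=
                                                    (a :* x :+ b :* y) :+ :- a :* x) refl a b (lookup u i) (lookup v i)) ⟩
      lc a b u v +ᵛ (- a) ·ᵛ u             ≡⟨ cong (_+ᵛ (- a) ·ᵛ u) e ⟩
      0ᵛ +ᵛ (- a) ·ᵛ u  ≡⟨ entrywise (𝟎 ⊞ (- a) ⊡ ⌜ u ⌝) ((- (1# · a)) ⊡ ⌜ u ⌝)
          (λ i → solve 2 (λ a x → :0 :+ :- a :* x := :- (:1 :* a) :* x) refl a (lookup u i)) ⟩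
      (- (1# · a)) ·ᵛ u                    ≡⟨ cong (λ c → (- (c · a)) ·ᵛ u) (inverseʳ b≢0) ⟨
      (- (b · inverse b≢0 · a)) ·ᵛ u  ≡⟨ entrywise ((- (b · inverse b≢0 · a)) ⊡ ⌜ u ⌝) (b ⊡ (- (inverse b≢0 · a)) ⊡ ⌜ u ⌝)
                                                (λ i → solve 4 (λ b j a x → :- (b :* j :* a) :* x := b :*
                                                    (:- (j :* a) :* x)) refl b (inverse b≢0) a (lookup u i)) ⟩
      b ·ᵛ (- (inverse b≢0 · a)) ·ᵛ u      ∎)) (¬∥ (- (inverse b≢0 · a)))
      where open ≡-Reasoning

    -- Cramer's rule.
    independent⇒spans : ∀ ℓ {u v} → u ∈ ⟦ ℓ ⟧ → v ∈ ⟦ ℓ ⟧ → Independent u v → ∀ {x} → x ∈ ⟦ ℓ ⟧ → ∃₂ λ s t → x ≡ lc s t u v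
    independent⇒spans ℓ {u} {v} u∈ v∈ ind {x} x∈ with ∈-line⁻ ℓ u∈ | ∈-line⁻ ℓ v∈ | ∈-line⁻ ℓ x∈
    ... | a , b , refl | c , d , refl | e , f , refl = i · s , i · t , sym (begin
      lc (i · s) (i · t) u v  ≡⟨ lc-lc (i · s) (i · t) a b c d g₁ g₂ ⟩
      lc (i · s · a ⊕ i · t · c) (i · s · b ⊕ i · t · d) g₁ g₂  ≡⟨ cong₂ (λ m n → lc m n g₁ g₂)
        (solve 7 (λ i a b c d e f → i :* (e :* d :- f :* c) :* a :+ i :* (f :* a :- e :* b) :* c :=
            (a :* d :- b :* c) :* i :* e) refl i a b c d e f)
        (solve 7 (λ i a b c d e f → i :* (e :* d :- f :* c) :* b :+ i :* (f :* a :- e :* b) :* d :=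
            (a :* d :- b :* c) :* i :* f) refl i a b c d e f) ⟩
      lc (det · i · e) (det · i · f) g₁ g₂  ≡⟨ cong (λ k → lc (k · e) (k · f) g₁ g₂) (inverseʳ det≢0) ⟩
      lc (1# · e) (1# · f) g₁ g₂  ≡⟨ cong₂ (λ m n → lc m n g₁ g₂) (*-identityˡ e) (*-identityˡ f) ⟩
      lc e f g₁ g₂                                                               ∎)
      where
      open ≡-Reasoning
      g₁ = gen₁ ℓ
      g₂ = gen₂ ℓ
      det = a · d - b · c
      vanish : ∀ s t → s · a ⊕ t · c ≡ 0# → s · b ⊕ t · d ≡ 0# → s ≡ 0# × t ≡ 0#
      vanish s t p r = ind (trans (lc-lc s t a b c d g₁ g₂) (trans (cong₂ (λ m n → lc m n g₁ g₂) p r) (lc-00 g₁ g₂)))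
      -- If the determinant vanished, the pairs (d, -b) and (-c, a) would be relations between u and
      -- v. Independence then forces a = b = 0, so that u = 0.
      det≢0 : det ≢ 0#
      det≢0 z = 0≢1 (sym (proj₁ (vanish 1# 0# (trans (solve 2 (λ a c → :1 :* a :+ :0 :* c := a) refl a c) a≡0)
                                             (trans (solve 2 (λ b d → :1 :* b :+ :0 :* d := b) refl b d) b≡0))))
        where
        d≡0×-b≡0 = vanish d (- b) (trans (solve 4 (λ a b c d → d :* a :+ :- b :* c := a :* d :- b :* c) refl a b c d) z)
                                 (solve 2 (λ b d → d :* b :+ :- b :* d := :0) refl b d)
        -c≡0×a≡0 = vanish (- c) a (solve 2 (λ a c → :- c :* a :+ a :* c := :0) refl a c)
                                 (trans (solve 4 (λ a b c d → :- c :* b :+ a :* d := a :* d :- b :* c) refl a b c d) z)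
        a≡0 = proj₂ -c≡0×a≡0
        b≡0 = neg≡0 (proj₂ d≡0×-b≡0)
      i = inverse det≢0
      s = e · d - f · c
      t = f · a - e · b

    line-⊆ : ∀ ℓ ℓ′ {u v} → u ∈ ⟦ ℓ ⟧ → v ∈ ⟦ ℓ ⟧ → Independent u v → u ∈ ⟦ ℓ′ ⟧ → v ∈ ⟦ ℓ′ ⟧ → ⟦ ℓ ⟧ ⊆ ⟦ ℓ′ ⟧
    line-⊆ ℓ ℓ′ u∈ v∈ ind u∈′ v∈′ x∈ = let s , t , e = independent⇒spans ℓ u∈ v∈ ind x∈ in subst (_∈ ⟦ ℓ′ ⟧) (sym e) (line-lc ℓ′ s t u∈′ v∈′)

    private
      space = vectors.elements {n}

    count-point : ∀ P → count (_∈? P) ≡ q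
    count-point P = begin
      count (_∈? P)  ≡⟨ ∑-cong space multiples ⟨
      ∑[ x ∈ space ] ∑[ c ∈ scalars.elements ] ⟨ x ≟ᵛ c ·ᵛ gen P ⟩  ≡⟨ ∑-swap space scalars.elements _ ⟩
      ∑[ c ∈ scalars.elements ] ∑[ x ∈ space ] ⟨ x ≟ᵛ c ·ᵛ gen P ⟩  ≡⟨ ∑-cong scalars.elements
          (λ c → vectors.count-≈ (c ·ᵛ gen P)) ⟩
      ∑[ c ∈ scalars.elements ] 1  ≡⟨ trans (∑-const scalars.elements 1) (trans (ℕ.*-identityʳ _) length-scalars) ⟩
      q                                                                             ∎
      where
      open ≡-Reasoning
      multiples′ : ∀ x → Dec (x ∈ ⟦ P ⟧) → ∑[ c ∈ scalars.elements ] ⟨ x ≟ᵛ c ·ᵛ gen P ⟩ ≡ ⟨ x ∈? P ⟩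
      multiples′ x (yes x∈) = let c , e = ∈-point⁻ P x∈ in
        trans (scalars.count-unique (λ c → x ≟ᵛ c ·ᵛ gen P) resp≡ e (λ e′ → ·ᵛ-gen-injective P (trans (sym e′) e)))
            (sym (⟨⟩-yes (x ∈? P) x∈))
      multiples′ x (no x∉) = trans (∑-cong scalars.elements (λ c → ⟨⟩-no (x ≟ᵛ c ·ᵛ gen P) (λ { refl → x∉ (∈-point⁺ P c) })))
        (trans (∑-zero scalars.elements) (sym (⟨⟩-no (x ∈? P) x∉)))
      multiples : ∀ x → ∑[ c ∈ scalars.elements ] ⟨ x ≟ᵛ c ·ᵛ gen P ⟩ ≡ ⟨ x ∈? P ⟩
      multiples x = multiples′ x (x ∈? P)

    count-line : ∀ ℓ → count (_∈? ℓ) ≡ q * q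
    count-line ℓ = begin
      count (_∈? ℓ)  ≡⟨ ∑-cong space (λ x → combinations x (x ∈? ℓ)) ⟨
      ∑[ x ∈ space ] ∑[ a ∈ scalars.elements ] ∑[ b ∈ scalars.elements ] ⟨ x ≟ᵛ lc a b g₁ g₂ ⟩
        ≡⟨ trans (∑-swap space scalars.elements _) (∑-cong scalars.elements (λ a → ∑-swap space scalars.elements _)) ⟩
      ∑[ a ∈ scalars.elements ] ∑[ b ∈ scalars.elements ] ∑[ x ∈ space ] ⟨ x ≟ᵛ lc a b g₁ g₂ ⟩
        ≡⟨ ∑-cong scalars.elements (λ a → ∑-cong scalars.elements (λ b → vectors.count-≈ (lc a b g₁ g₂))) ⟩
      ∑[ a ∈ scalars.elements ] ∑[ b ∈ scalars.elements ] 1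
        ≡⟨ trans (∑-cong scalars.elements (λ _ → trans (∑-const scalars.elements 1)
            (trans (ℕ.*-identityʳ _) length-scalars)))
             (trans (∑-const scalars.elements q) (cong (_* q) length-scalars)) ⟩
      q * q ∎
      where
      open ≡-Reasoning
      g₁ = gen₁ ℓ
      g₂ = gen₂ ℓ
      lc-injective : ∀ {a b c d} → lc a b g₁ g₂ ≡ lc c d g₁ g₂ → a ≡ c × b ≡ d
      lc-injective {a} {b} {c} {d} e = -≡0 (proj₁ parts) , -≡0 (proj₂ parts)
        where
        parts : a - c ≡ 0# × b - d ≡ 0#
        parts = gens-independent ℓ (trans
          (entrywise ((a - c) ⊡ ⌜ g₁ ⌝ ⊞ (b - d) ⊡ ⌜ g₂ ⌝) ((a ⊡ ⌜ g₁ ⌝ ⊞ b ⊡ ⌜ g₂ ⌝) ⊞ (- 1#) ⊡ (c ⊡ ⌜ g₁ ⌝ ⊞ d ⊡ ⌜ g₂ ⌝))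
            λ i → solve 6 (λ a b c d x y → (a :- c) :* x :+ (b :- d) :* y := (a :* x :+ b :* y) :+ :- :1 :*
                (c :* x :+ d :* y)) refl a b c d (lookup g₁ i) (lookup g₂ i))
          (trans (cong (_+ᵛ (- 1#) ·ᵛ lc c d g₁ g₂) e)
            (entrywise (⌜ lc c d g₁ g₂ ⌝ ⊞ (- 1#) ⊡ ⌜ lc c d g₁ g₂ ⌝) 𝟎 λ i → solve 1
                (λ x → x :+ :- :1 :* x := :0) refl (lookup (lc c d g₁ g₂) i))))
      combinations : ∀ x → Dec (x ∈ ⟦ ℓ ⟧) → ∑[ a ∈ scalars.elements ] ∑[ b ∈ scalars.elements ] ⟨ x ≟ᵛ lc a b g₁ g₂ ⟩
          ≡ ⟨ x ∈? ℓ ⟩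
      combinations x (no x∉) = trans (∑-cong scalars.elements (λ a → trans
          (∑-cong scalars.elements (λ b → ⟨⟩-no (x ≟ᵛ lc a b g₁ g₂) (λ { refl → x∉ (∈-line⁺ ℓ a b) })))
          (∑-zero scalars.elements)))
        (trans (∑-zero scalars.elements) (sym (⟨⟩-no (x ∈? ℓ) x∉)))
      combinations x (yes x∈) with ∈-line⁻ ℓ x∈
      ... | c , d , e = trans (∑-cong scalars.elements (λ a → trans (∑-cong scalars.elements (λ b →
              trans (⟨⟩-cong (x ≟ᵛ lc a b g₁ g₂) ((a ≟ c) ×-dec (b ≟ d)) (λ e′ → lc-injective (trans (sym e′) e))
                  (λ { (refl , refl) → e })) (⟨⟩-× (a ≟ c) (b ≟ d))))
              (trans (∑-*ˡ scalars.elements ⟨ a ≟ c ⟩ _) (trans (cong (⟨ a ≟ c ⟩ *_) (scalars.count-≈ d))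
                  (ℕ.*-identityʳ _)))))
          (trans (scalars.count-≈ c) (sym (⟨⟩-yes (x ∈? ℓ) x∈)))

    nonzero? : Decidable {A = Vector n} (_≢ 0ᵛ)
    nonzero? x = ¬? (x ≟ᵛ 0ᵛ)

    -- Stated additively to avoid truncated subtraction; the 1 is the zero vector.
    count-nonzero : {P : Pred (Vector n) 0ℓ} (P? : Decidable P) → P 0ᵛ → count (nonzero? ∩? P?) + 1 ≡ count P?
    count-nonzero {P} P? p0 = sym (trans (count-split (vectors n) P? nonzero?) (cong₂ _+_
      (count-cong (vectors n) (P? ∩? nonzero?) (nonzero? ∩? P?) (λ (a , b) → b , a) (λ (a , b) → b , a))
      (vectors.count-unique (P? ∩? ∁? nonzero?) resp≡ (p0 , λ n → n refl) (λ {x} (_ , ¬n) → decidable-stable (x ≟ᵛ 0ᵛ) ¬n))))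

    points-finite : Finite (subspaces-decSetoid {n} {1})
    points-finite = all-subspaces
    module points = Finite points-finite

    lines-finite : Finite (subspaces-decSetoid {n} {2})
    lines-finite = all-subspaces
    module lines = Finite lines-finite

    one-point : ∀ {x} → x ≢ 0ᵛ → points.count (λ P → x ∈? P) ≡ 1
    one-point {x} x≢0 = points.count-unique (λ P → x ∈? P) (λ (P⊆Q , _) → P⊆Q) {mkPoint x x≢0} (gen∈ (mkPoint x x≢0))
      λ {P} x∈ → point-⊆ P (mkPoint x x≢0) x∈ x≢0 (gen∈ (mkPoint x x≢0)) , point-⊆ (mkPoint x x≢0) P
          (gen∈ (mkPoint x x≢0)) x≢0 x∈

    -- Every nonzero vector lies on one point and every point carries q - 1 nonzero vectors; the
    -- relation V = N (q - 1) is written as V + N = N q.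
    count-points : {Φ : Pred (Subspace n 1) 0ℓ} {φ : Pred (Vector n) 0ℓ} (Φ? : Decidable Φ) (φ? : Decidable φ) →
      (∀ {P x} → x ∈ ⟦ P ⟧ → x ≢ 0ᵛ → Φ P → φ x) → (∀ {P x} → x ∈ ⟦ P ⟧ → x ≢ 0ᵛ → φ x → Φ P) →
      count (nonzero? ∩? φ?) + points.count Φ? ≡ points.count Φ? * q
    count-points Φ? φ? to from = begin
      count (nonzero? ∩? φ?) + points.count Φ?  ≡⟨ cong (_+ points.count Φ?) (∑-cong space spread) ⟩
      ∑[ x ∈ space ] ∑[ P ∈ points.elements ] ⟨ (nonzero? ∩? φ?) x ×-dec x ∈? P ⟩ + points.count Φ?
        ≡⟨ cong (_+ points.count Φ?) (∑-swap space points.elements _) ⟩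
      ∑[ P ∈ points.elements ] ∑[ x ∈ space ] ⟨ (nonzero? ∩? φ?) x ×-dec x ∈? P ⟩ + points.count Φ?
        ≡⟨ ∑-+ points.elements _ _ ⟨
      ∑[ P ∈ points.elements ] (∑[ x ∈ space ] ⟨ (nonzero? ∩? φ?) x ×-dec x ∈? P ⟩ + ⟨ Φ? P ⟩)
        ≡⟨ ∑-cong points.elements (λ P → collect P (Φ? P)) ⟩
      ∑[ P ∈ points.elements ] (⟨ Φ? P ⟩ * q)  ≡⟨ ∑-*ʳ points.elements q _ ⟩
      points.count Φ? * q                                                               ∎
      where
      open ≡-Reasoning
      spread : ∀ x → ⟨ (nonzero? ∩? φ?) x ⟩ ≡ ∑[ P ∈ points.elements ] ⟨ (nonzero? ∩? φ?) x ×-dec x ∈? P ⟩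
      spread x = begin
        ⟨ (nonzero? ∩? φ?) x ⟩                                                          ≡⟨ ℕ.*-identityʳ _ ⟨
        ⟨ (nonzero? ∩? φ?) x ⟩ * 1  ≡⟨ ⟨⟩*-cong ((nonzero? ∩? φ?) x) (λ (x≢0 , _) → sym (one-point x≢0)) ⟩
        ⟨ (nonzero? ∩? φ?) x ⟩ * points.count (λ P → x ∈? P)  ≡⟨ sym (∑-*ˡ points.elements ⟨ (nonzero? ∩? φ?) x ⟩ _) ⟩
        ∑[ P ∈ points.elements ] (⟨ (nonzero? ∩? φ?) x ⟩ * ⟨ x ∈? P ⟩)  ≡⟨ ∑-cong points.elements
            (λ P → ⟨⟩-× ((nonzero? ∩? φ?) x) (x ∈? P)) ⟨
        ∑[ P ∈ points.elements ] ⟨ (nonzero? ∩? φ?) x ×-dec x ∈? P ⟩                    ∎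
      collect : ∀ P (d : Dec _) → ∑[ x ∈ space ] ⟨ (nonzero? ∩? φ?) x ×-dec x ∈? P ⟩ + ⟨ d ⟩ ≡ ⟨ d ⟩ * q
      collect P (yes ΦP) = trans (trans
        (cong (_+ 1) (count-cong (vectors n) ((nonzero? ∩? φ?) ∩? (_∈? P)) (nonzero? ∩? (_∈? P))
            (λ ((a , _) , c) → a , c) (λ (a , c) → (a , to c a ΦP) , c)))
        (trans (count-nonzero (_∈? P) (subst (_∈ ⟦ P ⟧) (0·ᵛ (gen P)) (∈-point⁺ P 0#))) (count-point P)))
            (sym (ℕ.*-identityˡ q))
      collect P (no ¬ΦP) = trans (ℕ.+-identityʳ _) (trans (∑-cong space
          (λ x → ⟨⟩-no ((nonzero? ∩? φ?) x ×-dec x ∈? P) (λ ((x≢0 , φx) , x∈) → ¬ΦP (from x∈ x≢0 φx)))) (∑-zero space))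

-- Linear forms in coordinates

module LinearForms {q} (F : FiniteField q) where
  open FieldTheory F
  open FieldCounting F
  open Sum semiring using (sum; sum-cong-≗; *-distribˡ-sum; ∑-distrib-+) public

  linear-0 : ∀ {n} {φ : Vector n → Carrier} → IsLinear φ → φ 0ᵛ ≡ 0#
  linear-0 {n} {φ} lin = begin
    φ 0ᵛ                             ≡⟨ solve 1 (λ x → x := x :+ :1 :* x :- x) refl (φ 0ᵛ) ⟩
    φ 0ᵛ ⊕ 1# · φ 0ᵛ - φ 0ᵛ          ≡⟨ cong (_- φ 0ᵛ) (lin 0ᵛ 1# 0ᵛ) ⟨
    φ (0ᵛ +ᵛ 1# ·ᵛ 0ᵛ) - φ 0ᵛ  ≡⟨ cong (λ x → φ x - φ 0ᵛ) (trans (cong (0ᵛ +ᵛ_) (·ᵛ0 1#)) (+ᵛ-identityʳ 0ᵛ)) ⟩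
    φ 0ᵛ - φ 0ᵛ                      ≡⟨ -‿inverseʳ _ ⟩
    0#                               ∎
    where open ≡-Reasoning

  linear-· : ∀ {n} {φ : Vector n → Carrier} → IsLinear φ → ∀ a x → φ (a ·ᵛ x) ≡ a · φ x
  linear-· {φ = φ} lin a x = trans (cong φ (trans (sym (+ᵛ-identityʳ _)) (+ᵛ-comm _ 0ᵛ)))
    (trans (lin 0ᵛ a x) (trans (cong (_⊕ a · φ x) (linear-0 lin)) (+-identityˡ _)))

  linear-+ : ∀ {n} {φ : Vector n → Carrier} → IsLinear φ → ∀ x y → φ (x +ᵛ y) ≡ φ x ⊕ φ y
  linear-+ {φ = φ} lin x y = trans (cong (λ z → φ (x +ᵛ z)) (sym (·ᵛ-identity y)))
      (trans (lin x 1# y) (cong (φ x ⊕_) (*-identityˡ _)))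

  linear-expand : ∀ {n} {φ : Vector n → Carrier} → IsLinear φ → ∀ x → φ x ≡ sum (λ i → lookup x i · φ (unit i))
  linear-expand {zero}  lin []       = linear-0 lin
  linear-expand {suc n} {φ} lin (a ∷ x) = begin
    φ (a ∷ x)  ≡⟨ cong φ (cong₂ _∷_ (solve 1 (λ a → a := :0 :+ a :* :1) refl a)
        (sym (trans (cong (x +ᵛ_) (·ᵛ0 a)) (+ᵛ-identityʳ x)))) ⟩
    φ ((0# ∷ x) +ᵛ a ·ᵛ unit zero)                    ≡⟨ lin (0# ∷ x) a (unit zero) ⟩
    φ (0# ∷ x) ⊕ a · φ (unit zero)                    ≡⟨ +-comm _ _ ⟩
    a · φ (unit zero) ⊕ φ (0# ∷ x)  ≡⟨ cong (a · φ (unit zero) ⊕_) (linear-expand tail-linear x) ⟩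
    a · φ (unit zero) ⊕ sum (λ i → lookup x i · φ (unit (suc i))) ∎
    where
    open ≡-Reasoning
    tail-linear : IsLinear (λ y → φ (0# ∷ y))
    tail-linear y b z = trans (cong (λ c → φ (c ∷ (y +ᵛ b ·ᵛ z))) (solve 1 (λ b → :0 := :0 :+ b :* :0) refl b))
        (lin (0# ∷ y) b (0# ∷ z))

  sum-linear : ∀ {n k} (f : Fin k → Vector n → Carrier) → (∀ i → IsLinear (f i)) → IsLinear (λ x → sum (λ i → f i x))
  sum-linear f lin x a y = trans (sum-cong-≗ (λ i → lin i x a y)) (trans (∑-distrib-+ (λ i → f i x) (λ i → a · f i y))
    (cong (sum (λ i → f i x) ⊕_) (sym (*-distribˡ-sum a (λ i → f i y)))))

  lookup-linear : ∀ {n} (i : Fin n) → IsLinear (λ x → lookup x i)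
  lookup-linear i x a y = lookup-eval (⌜ x ⌝ ⊞ a ⊡ ⌜ y ⌝) i

  scaled-linear : ∀ {n} {φ : Vector n → Carrier} → IsLinear φ → ∀ c → IsLinear (λ x → φ x · c)
  scaled-linear {φ = φ} lin c x a y = trans (cong (_· c) (lin x a y))
      (solve 4 (λ x a y c → (x :+ a :* y) :* c := x :* c :+ a :* (y :* c)) refl (φ x) a (φ y) c)

-- The Hermitian form on vectors u + ωv

module HermitianForm {q r} (pp : IsOddPrimePower q) (F : FiniteField q) (K : FiniteField (q ℕ.^ 2)) (emb : FieldEmbedding F K)
                     (Q : Projective.QuadraticForm F (suc r)) where
  open QuadraticExtension pp F K emb public
  module 𝔽 where
    open FieldTheory F public
    open FieldCounting F public
    open Spans F public
    open LinearForms F public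
    open QuadraticCounting Q 2≢0ᶠ public
  open FieldTheory K public
  open FieldCounting K public hiding (module QuadraticCounting)
  open Spans K public
  open LinearForms K public
  open Hermitian F K emb Q public
  open 𝔽 using (b)

  B-linearˡ : ∀ y → IsLinear (λ x → B x y)
  B-linearˡ y = sum-linear (λ i x → sum (λ j → lookup x i · lookup y j · ι (b (𝔽.unit i) (𝔽.unit j))))
    (λ i → sum-linear (λ j x → lookup x i · lookup y j · ι (b (𝔽.unit i) (𝔽.unit j)))
      (λ j → scaled-linear (scaled-linear (lookup-linear i) (lookup y j)) (ι (b (𝔽.unit i) (𝔽.unit j)))))

  B-linearʳ : ∀ x → IsLinear (B x)
  B-linearʳ x = sum-linear (λ i y → sum (λ j → lookup x i · lookup y j · ι (b (𝔽.unit i) (𝔽.unit j))))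
    (λ i → sum-linear (λ j y → lookup x i · lookup y j · ι (b (𝔽.unit i) (𝔽.unit j)))
      (λ j → scaled-linear (λ y a z → trans (cong (lookup x i ·_) (lookup-linear j y a z))
        (solve 4 (λ x y a z → x :* (y :+ a :* z) := x :* y :+ a :* (x :* z)) refl (lookup x i) (lookup y j) a
            (lookup z j))) (ι (b (𝔽.unit i) (𝔽.unit j)))))

  ιᵛ : ∀ {n} → 𝔽.Vector n → Vector n
  ιᵛ = Vec.map ι

  private
    ι-sum : ∀ {n} (f : Fin n → 𝔽.Carrier) → ι (𝔽.sum f) ≡ sum (λ i → ι (f i))
    ι-sum {zero}  f = ι-0
    ι-sum {suc n} f = trans (ι-+ _ _) (cong (ι (f zero) ⊕_) (ι-sum (λ i → f (suc i))))

    ι-sum-· : ∀ {n} (f g : Fin n → 𝔽.Carrier) → ι (𝔽.sum (λ i → f i 𝔽.· g i)) ≡ sum (λ i → ι (f i) · ι (g i))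
    ι-sum-· f g = trans (ι-sum (λ i → f i 𝔽.· g i)) (sum-cong-≗ (λ i → ι-· (f i) (g i)))

  B-ι : ∀ x y → B (ιᵛ x) (ιᵛ y) ≡ ι (b x y)
  B-ι x y = sym (begin
    ι (b x y)
      ≡⟨ cong ι (𝔽.linear-expand (𝔽.b-linearˡ y) x) ⟩
    ι (𝔽.sum (λ i → lookup x i 𝔽.· b (𝔽.unit i) y))
      ≡⟨ ι-sum-· (lookup x) (λ i → b (𝔽.unit i) y) ⟩
    sum (λ i → ι (lookup x i) · ι (b (𝔽.unit i) y))
      ≡⟨ sum-cong-≗ row ⟩
    sum (λ i → sum (λ j → lookup (ιᵛ x) i · lookup (ιᵛ y) j · gram i j)) ∎)
    where
    open ≡-Reasoning
    gram : Fin (suc r) → Fin (suc r) → Carrier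
    gram i j = ι (b (𝔽.unit i) (𝔽.unit j))
    row : ∀ i → ι (lookup x i) · ι (b (𝔽.unit i) y) ≡ sum (λ j → lookup (ιᵛ x) i · lookup (ιᵛ y) j · gram i j)
    row i = begin
      ι (lookup x i) · ι (b (𝔽.unit i) y)
        ≡⟨ cong (λ c → ι (lookup x i) · ι c) (𝔽.linear-expand (𝔽.b-linearʳ (𝔽.unit i)) y) ⟩
      ι (lookup x i) · ι (𝔽.sum (λ j → lookup y j 𝔽.· b (𝔽.unit i) (𝔽.unit j)))
        ≡⟨ cong (ι (lookup x i) ·_) (ι-sum-· (lookup y) (λ j → b (𝔽.unit i) (𝔽.unit j))) ⟩
      ι (lookup x i) · sum (λ j → ι (lookup y j) · gram i j)
        ≡⟨ *-distribˡ-sum (ι (lookup x i)) (λ j → ι (lookup y j) · gram i j) ⟩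
      sum (λ j → ι (lookup x i) · (ι (lookup y j) · gram i j))
        ≡⟨ sum-cong-≗ (λ j → trans (sym (*-assoc (ι (lookup x i)) (ι (lookup y j)) (gram i j)))
             (sym (cong₂ (λ s t → s · t · gram i j) (Vec.lookup-map i ι x) (Vec.lookup-map j ι y)))) ⟩
      sum (λ j → lookup (ιᵛ x) i · lookup (ιᵛ y) j · gram i j) ∎

  module _ {n : ℕ} where
    ιᵛ-+ : ∀ (x y : 𝔽.Vector n) → ιᵛ (x 𝔽.+ᵛ y) ≡ ιᵛ x +ᵛ ιᵛ y
    ιᵛ-+ x y = ext λ i → begin
      lookup (ιᵛ (x 𝔽.+ᵛ y)) i  ≡⟨ trans (Vec.lookup-map i ι (x 𝔽.+ᵛ y)) (cong ι (Vec.lookup-zipWith 𝔽._⊕_ i x y)) ⟩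
      ι (lookup x i 𝔽.⊕ lookup y i)         ≡⟨ ι-+ _ _ ⟩
      ι (lookup x i) ⊕ ι (lookup y i)       ≡⟨ cong₂ _⊕_ (Vec.lookup-map i ι x) (Vec.lookup-map i ι y) ⟨
      lookup (ιᵛ x) i ⊕ lookup (ιᵛ y) i     ≡⟨ Vec.lookup-zipWith _⊕_ i (ιᵛ x) (ιᵛ y) ⟨
      lookup (ιᵛ x +ᵛ ιᵛ y) i               ∎
      where open ≡-Reasoning

    ιᵛ-· : ∀ a (x : 𝔽.Vector n) → ιᵛ (a 𝔽.·ᵛ x) ≡ ι a ·ᵛ ιᵛ x
    ιᵛ-· a x = ext λ i → begin
      lookup (ιᵛ (a 𝔽.·ᵛ x)) i  ≡⟨ trans (Vec.lookup-map i ι (a 𝔽.·ᵛ x)) (cong ι (Vec.lookup-map i (a 𝔽.·_) x)) ⟩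
      ι (a 𝔽.· lookup x i)          ≡⟨ ι-· a _ ⟩
      ι a · ι (lookup x i)          ≡⟨ cong (ι a ·_) (Vec.lookup-map i ι x) ⟨
      ι a · lookup (ιᵛ x) i         ≡⟨ Vec.lookup-map i (ι a ·_) (ιᵛ x) ⟨
      lookup (ι a ·ᵛ ιᵛ x) i        ∎
      where open ≡-Reasoning

    ιᵛ-lc : ∀ a c (x y : 𝔽.Vector n) → ιᵛ (𝔽.lc a c x y) ≡ lc (ι a) (ι c) (ιᵛ x) (ιᵛ y)
    ιᵛ-lc a c x y = trans (ιᵛ-+ _ _) (cong₂ _+ᵛ_ (ιᵛ-· a x) (ιᵛ-· c y))

    ιᵛ-0 : ιᵛ 𝔽.0ᵛ ≡ 0ᵛ {n}
    ιᵛ-0 = trans (Vec.map-replicate ι 𝔽.0# n) (cong (Vec.replicate n) ι-0)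

    complex : 𝔽.Vector n → 𝔽.Vector n → Vector n
    complex u v = ιᵛ u +ᵛ ω ·ᵛ ιᵛ v

    Re Im : Vector n → 𝔽.Vector n
    Re = Vec.map re
    Im = Vec.map im

    lookup-complex : ∀ u v i → lookup (complex u v) i ≡ ι (lookup u i) ⊕ ω · ι (lookup v i)
    lookup-complex u v i = trans (lookup-eval (⌜ ιᵛ u ⌝ ⊞ ω ⊡ ⌜ ιᵛ v ⌝) i)
        (cong₂ (λ s t → s ⊕ ω · t) (Vec.lookup-map i ι u) (Vec.lookup-map i ι v))

    complex-Re-Im : ∀ z → complex (Re z) (Im z) ≡ z
    complex-Re-Im z = ext λ i → trans (lookup-complex (Re z) (Im z) i)
      (trans (cong₂ (λ s t → ι s ⊕ ω · ι t) (Vec.lookup-map i re z) (Vec.lookup-map i im z)) (sym (re-im (lookup z i))))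

    complex-injective : ∀ {u v u′ v′} → complex u v ≡ complex u′ v′ → u ≡ u′ × v ≡ v′
    complex-injective {u} {v} {u′} {v′} e = 𝔽.ext (λ i → proj₁ (entries i)) , 𝔽.ext (λ i → proj₂ (entries i))
      where
      entries : ∀ i → lookup u i ≡ lookup u′ i × lookup v i ≡ lookup v′ i
      entries i = ω-injective (trans (sym (lookup-complex u v i))
          (trans (cong (λ z → lookup z i) e) (lookup-complex u′ v′ i)))

    complex-parts : ∀ {z u v} → z ≡ complex u v → Re z ≡ u × Im z ≡ v
    complex-parts {z} e = complex-injective (trans (complex-Re-Im z) e)

    complex-0 : complex 𝔽.0ᵛ 𝔽.0ᵛ ≡ 0ᵛ
    complex-0 = trans (cong (λ x → x +ᵛ ω ·ᵛ x) ιᵛ-0) (trans (cong (0ᵛ +ᵛ_) (·ᵛ0 ω)) (+ᵛ-identityʳ 0ᵛ))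

    ·-ι-complex : ∀ c (x : 𝔽.Vector n) → c ·ᵛ ιᵛ x ≡ complex (re c 𝔽.·ᵛ x) (im c 𝔽.·ᵛ x)
    ·-ι-complex c x = begin
      c ·ᵛ ιᵛ x                                            ≡⟨ cong (_·ᵛ ιᵛ x) (re-im c) ⟩
      (ι (re c) ⊕ ω · ι (im c)) ·ᵛ ιᵛ x  ≡⟨ entrywise ((ι (re c) ⊕ ω · ι (im c)) ⊡ ⌜ ιᵛ x ⌝)
          (ι (re c) ⊡ ⌜ ιᵛ x ⌝ ⊞ ω ⊡ ι (im c) ⊡ ⌜ ιᵛ x ⌝)
                                                                (λ i → solve 4 (λ a w c x → (a :+ w :* c) :* x := a :*
                                                                    x :+ w :* (c :* x)) refl (ι (re c)) ω (ι (im c))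
                                                                    (lookup (ιᵛ x) i)) ⟩
      ι (re c) ·ᵛ ιᵛ x +ᵛ ω ·ᵛ ι (im c) ·ᵛ ιᵛ x  ≡⟨ cong₂ (λ s t → s +ᵛ ω ·ᵛ t) (ιᵛ-· (re c) x) (ιᵛ-· (im c) x) ⟨
      complex (re c 𝔽.·ᵛ x) (im c 𝔽.·ᵛ x)                  ∎
      where open ≡-Reasoning

    complex-+ : ∀ u v u′ v′ → complex u v +ᵛ complex u′ v′ ≡ complex (u 𝔽.+ᵛ u′) (v 𝔽.+ᵛ v′)
    complex-+ u v u′ v′ = sym (trans (cong₂ (λ s t → s +ᵛ ω ·ᵛ t) (ιᵛ-+ u u′) (ιᵛ-+ v v′))
      (entrywise ((⌜ ιᵛ u ⌝ ⊞ ⌜ ιᵛ u′ ⌝) ⊞ ω ⊡ (⌜ ιᵛ v ⌝ ⊞ ⌜ ιᵛ v′ ⌝))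
          ((⌜ ιᵛ u ⌝ ⊞ ω ⊡ ⌜ ιᵛ v ⌝) ⊞ (⌜ ιᵛ u′ ⌝ ⊞ ω ⊡ ⌜ ιᵛ v′ ⌝))
        λ i → solve 5 (λ a c d e w → (a :+ c) :+ w :* (d :+ e) := (a :+ w :* d) :+ (c :+ w :* e)) refl
            (lookup (ιᵛ u) i) (lookup (ιᵛ u′) i) (lookup (ιᵛ v) i) (lookup (ιᵛ v′) i) ω))

    lc-ι-complex : ∀ a c (x y : 𝔽.Vector n) → lc a c (ιᵛ x) (ιᵛ y) ≡ complex (𝔽.lc (re a) (re c) x y)
        (𝔽.lc (im a) (im c) x y)
    lc-ι-complex a c x y = trans (cong₂ _+ᵛ_ (·-ι-complex a x) (·-ι-complex c y)) (complex-+ _ _ _ _)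

    complex-lc : ∀ a c a′ c′ (x y : 𝔽.Vector n) → complex (𝔽.lc a c x y) (𝔽.lc a′ c′ x y) ≡ lc (ι a ⊕ ω · ι a′)
        (ι c ⊕ ω · ι c′) (ιᵛ x) (ιᵛ y)
    complex-lc a c a′ c′ x y = trans (cong₂ (λ s t → s +ᵛ ω ·ᵛ t) (ιᵛ-lc a c x y) (ιᵛ-lc a′ c′ x y))
      (entrywise ((ι a ⊡ X ⊞ ι c ⊡ Y) ⊞ ω ⊡ (ι a′ ⊡ X ⊞ ι c′ ⊡ Y)) ((ι a ⊕ ω · ι a′) ⊡ X ⊞ (ι c ⊕ ω · ι c′) ⊡ Y)
        λ i → solve 7 (λ a c a′ c′ w x y → (a :* x :+ c :* y) :+ w :* (a′ :* x :+ c′ :* y) := (a :+ w :* a′) :* x :+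
            (c :+ w :* c′) :* y)
                refl (ι a) (ι c) (ι a′) (ι c′) ω (lookup (ιᵛ x) i) (lookup (ιᵛ y) i))
      where
      X = ⌜ ιᵛ x ⌝
      Y = ⌜ ιᵛ y ⌝

    -- The real and imaginary parts of a relation over the extension are two relations over the
    -- subfield.
    ι-independent : ∀ {x y : 𝔽.Vector n} → 𝔽.Independent x y → Independent (ιᵛ x) (ιᵛ y)
    ι-independent {x} {y} ind {a} {c} e = scalar-0 (proj₁ reals) (proj₁ imags) , scalar-0 (proj₂ reals) (proj₂ imags)
      where
      parts = complex-injective (trans (sym (lc-ι-complex a c x y)) (trans e (sym complex-0)))
      reals = ind (proj₁ parts)
      imags = ind (proj₂ parts)
      scalar-0 : ∀ {a} → re a ≡ 𝔽.0# → im a ≡ 𝔽.0# → a ≡ 0#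
      scalar-0 {a} p r = trans (re-im a) (trans (cong₂ (λ s t → ι s ⊕ ω · ι t) p r)
          (trans (cong (λ s → s ⊕ ω · s) ι-0) (solve 1 (λ w → :0 :+ w :* :0 := :0) refl ω)))

    ιᵛ≢0 : ∀ {x : 𝔽.Vector n} → x ≢ 𝔽.0ᵛ → ιᵛ x ≢ 0ᵛ
    ιᵛ≢0 {x} x≢0 e = x≢0 (𝔽.ext λ i → ι-injective (trans (sym (Vec.lookup-map i ι x))
        (trans (cong (λ z → lookup z i) (trans e (sym ιᵛ-0))) (Vec.lookup-map i ι 𝔽.0ᵛ))))

    τ-+ : ∀ (x y : Vector n) → τ (x +ᵛ y) ≡ τ x +ᵛ τ y
    τ-+ x y = ext λ i → begin
      lookup (τ (x +ᵛ y)) i  ≡⟨ trans (Vec.lookup-map i conj (x +ᵛ y)) (cong conj (lookup-eval (⌜ x ⌝ ⊞ ⌜ y ⌝) i)) ⟩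
      conj (lookup x i ⊕ lookup y i)         ≡⟨ conj-+ _ _ ⟩
      conj (lookup x i) ⊕ conj (lookup y i)  ≡⟨ cong₂ _⊕_ (Vec.lookup-map i conj x) (Vec.lookup-map i conj y) ⟨
      lookup (τ x) i ⊕ lookup (τ y) i        ≡⟨ lookup-eval (⌜ τ x ⌝ ⊞ ⌜ τ y ⌝) i ⟨
      lookup (τ x +ᵛ τ y) i                  ∎
      where open ≡-Reasoning

    τ-· : ∀ a (x : Vector n) → τ (a ·ᵛ x) ≡ conj a ·ᵛ τ x
    τ-· a x = ext λ i → begin
      lookup (τ (a ·ᵛ x)) i  ≡⟨ trans (Vec.lookup-map i conj (a ·ᵛ x)) (cong conj (lookup-eval (a ⊡ ⌜ x ⌝) i)) ⟩
      conj (a · lookup x i)                  ≡⟨ conj-· _ _ ⟩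
      conj a · conj (lookup x i)             ≡⟨ cong (conj a ·_) (Vec.lookup-map i conj x) ⟨
      conj a · lookup (τ x) i                ≡⟨ lookup-eval (conj a ⊡ ⌜ τ x ⌝) i ⟨
      lookup (conj a ·ᵛ τ x) i               ∎
      where open ≡-Reasoning

    τ-ι : ∀ (x : 𝔽.Vector n) → τ (ιᵛ x) ≡ ιᵛ x
    τ-ι x = trans (sym (Vec.map-∘ conj ι x)) (Vec.map-cong conj-ι x)

  abstract
    -- The Hermitian form is kept abstract so that later steps use its sesquilinearity and its
    -- values on Σ, and never unfold the double sum `B`.
    h : Vector (suc r) → Vector (suc r) → Carrier
    h x y = B x (τ y)

    h-B : ∀ x y → h x y ≡ B x (τ y)
    h-B x y = refl

    h-linear : ∀ p → IsLinear (λ x → h x p)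
    h-linear p = B-linearˡ (τ p)

    h-·ʳ : ∀ x c p → h x (c ·ᵛ p) ≡ conj c · h x p
    h-·ʳ x c p = trans (cong (B x) (τ-· c p)) (linear-· (B-linearʳ x) (conj c) (τ p))

    h-+ʳ : ∀ x p p′ → h x (p +ᵛ p′) ≡ h x p ⊕ h x p′
    h-+ʳ x p p′ = trans (cong (B x) (τ-+ p p′)) (linear-+ (B-linearʳ x) (τ p) (τ p′))

    h-ι : ∀ x y → h (ιᵛ x) (ιᵛ y) ≡ ι (b x y)
    h-ι x y = trans (cong (B (ιᵛ x)) (τ-ι y)) (B-ι x y)

  h-ι-complex : ∀ x u v → h (ιᵛ x) (complex u v) ≡ ι (b x u) ⊕ - ω · ι (b x v)
  h-ι-complex x u v = trans (h-+ʳ (ιᵛ x) (ιᵛ u) (ω ·ᵛ ιᵛ v)) (cong₂ _⊕_ (h-ι x u)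
      (trans (h-·ʳ (ιᵛ x) ω (ιᵛ v)) (cong₂ _·_ conj-ω (h-ι x v))))

  h-complex : ∀ x y p → h (complex x y) p ≡ h (ιᵛ x) p ⊕ ω · h (ιᵛ y) p
  h-complex x y p = h-linear p (ιᵛ x) ω (ιᵛ y)

  -- For x over the subfield the value is b(x, u) - ω b(x, v), whose two parts vanish separately.
  -- One Hermitian condition thus amounts to two orthogonality conditions in Σ.
  h-ι-complex≡0 : ∀ {x u v} → h (ιᵛ x) (complex u v) ≡ 0# → b x u ≡ 𝔽.0# × b x v ≡ 𝔽.0#
  h-ι-complex≡0 {x} {u} {v} e = proj₁ parts , 𝔽.neg≡0 (proj₂ parts)
    where
    parts : b x u ≡ 𝔽.0# × (𝔽.- b x v) ≡ 𝔽.0#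
    parts = ω-independent (trans (cong (λ s → ι (b x u) ⊕ ω · s) (ι-neg _))
        (trans (solve 3 (λ a w c → a :+ w :* :- c := a :+ :- w :* c) refl (ι (b x u)) ω (ι (b x v)))
      (trans (sym (h-ι-complex x u v)) e)))

  h-ι-complex≡0⁺ : ∀ {x u v} → b x u ≡ 𝔽.0# → b x v ≡ 𝔽.0# → h (ιᵛ x) (complex u v) ≡ 0#
  h-ι-complex≡0⁺ {x} {u} {v} p s = trans (h-ι-complex x u v) (trans (cong₂ (λ c d → ι c ⊕ - ω · ι d) p s)
    (trans (cong (λ c → c ⊕ - ω · c) ι-0) (solve 1 (λ w → :0 :+ :- w :* :0 := :0) refl ω)))

  -- The cross terms are -ω b(u, v) and ω b(v, u), which cancel by symmetry of b; ω² = δ does the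
  -- rest.
  h-self : ∀ u v → h (complex u v) (complex u v) ≡ ι (b u u 𝔽.- δ 𝔽.· b v v)
  h-self u v = begin
    h (complex u v) (complex u v)  ≡⟨ trans (h-complex u v _) (cong₂ (λ s t → s ⊕ ω · t) (h-ι-complex u u v)
        (h-ι-complex v u v)) ⟩
    (ι (b u u) ⊕ - ω · ι (b u v)) ⊕ ω · (ι (b v u) ⊕ - ω · ι (b v v))  ≡⟨ cong
        (λ s → (ι (b u u) ⊕ - ω · ι (b u v)) ⊕ ω · (ι s ⊕ - ω · ι (b v v))) (𝔽.b-sym v u) ⟩
    (ι (b u u) ⊕ - ω · ι (b u v)) ⊕ ω · (ι (b u v) ⊕ - ω · ι (b v v))  ≡⟨ solve 4
        (λ uu w uv vv → (uu :+ :- w :* uv) :+ w :* (uv :+ :- w :* vv) := uu :- w :* w :* vv) refl (ι (b u u)) ω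
        (ι (b u v)) (ι (b v v)) ⟩
    ι (b u u) - ω · ω · ι (b v v)  ≡⟨ cong (λ s → ι (b u u) - s · ι (b v v)) ω² ⟩
    ι (b u u) - ι δ · ι (b v v)  ≡⟨ cong (λ s → ι (b u u) - s) (ι-· δ (b v v)) ⟨
    ι (b u u) - ι (δ 𝔽.· b v v)  ≡⟨ cong (ι (b u u) ⊕_) (ι-neg _) ⟨
    ι (b u u) ⊕ ι (𝔽.- (δ 𝔽.· b v v))                                                ≡⟨ ι-+ _ _ ⟨
    ι (b u u 𝔽.- δ 𝔽.· b v v)                                                        ∎
    where open ≡-Reasoning

-- Incidences between the cover and a Hermitian hyperplane

module CoverCounting {q r} (pp : IsOddPrimePower q) (F : FiniteField q) (K : FiniteField (q ℕ.^ 2)) (emb : FieldEmbedding F K)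
    (Q : Projective.QuadraticForm F (suc r)) (m : ℕ)
    (𝓛 : Pred (Projective.Line F r) 0ℓ) (resp : 𝓛 Respects (Setoid._≈_ (Projective.lines F r)))
        (cover : Parabolic.IsCover F Q m 𝓛) where
  open HermitianForm pp F K emb Q public
  open 𝔽 using (b; form)
  open Parabolic.IsCover cover

  n : ℕ
  n = suc r

  q² : ℕ
  q² = q ℕ.^ 2

  private
    module 𝔽lines = 𝔽.lines {n}
    module 𝔽points = 𝔽.points {n}

  singular-point : ∀ (R : 𝔽.Subspace n 1) → 𝔽.Singular (𝔽.gen R) → 𝔽.⟦ R ⟧ ⊆ 𝔽.Singular
  singular-point R s {x} x∈ = let c , e = 𝔽.∈-point⁻ R x∈ in
    trans (cong form e) (𝔽.singular-· s c)

  cover-b≡0 : ∀ {ℓ} → ℓ ∈ 𝓛 → ∀ {x y} → x ∈ 𝔽.⟦ ℓ ⟧ → y ∈ 𝔽.⟦ ℓ ⟧ → b x y ≡ 𝔽.0#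
  cover-b≡0 {ℓ} ℓ∈ = 𝔽.totally-singular⇒b≡0 (𝔽.line-subspace ℓ) (onQuadric ℓ∈)

  Through : 𝔽.Subspace n 1 → Pred (𝔽.Subspace n 2) 0ℓ
  Through P ℓ = ℓ ∈ 𝓛 × 𝔽.⟦ P ⟧ ⊆ 𝔽.⟦ ℓ ⟧

  through-resp : ∀ P → Through P Respects (Setoid._≈_ (Projective.lines F r))
  through-resp P {ℓ} {ℓ′} e (ℓ∈ , P⊆ℓ) = resp {ℓ} {ℓ′} e ℓ∈ , λ x∈ → proj₁ e (P⊆ℓ x∈)

  -- The m lines of 𝓛 through a singular point are enumerated by the cover.
  abstract
    𝓛? : Decidable 𝓛
    𝓛? ℓ = decide (𝔽.singular? (𝔽.gen₁ ℓ))
      where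
      P : 𝔽.Subspace n 1
      P = 𝔽.mkPoint (𝔽.gen₁ ℓ) (𝔽.independent⇒≢0ˡ (𝔽.gens-independent ℓ))
      through : ℓ ∈ 𝓛 → Through P ℓ
      through ℓ∈ = ℓ∈ , λ x∈ → 𝔽.point-⊆-line P ℓ (𝔽.gen₁∈ ℓ) x∈
      decide : Dec (𝔽.Singular (𝔽.gen₁ ℓ)) → Dec (ℓ ∈ 𝓛)
      decide (no ns) = no λ ℓ∈ → ns (onQuadric ℓ∈ (𝔽.gen₁∈ ℓ))
      decide (yes s) = map′ proj₁ through
        (𝔽lines.HasCard⇒decidable {Through P} (λ {ℓ} {ℓ′} → through-resp P {ℓ} {ℓ′}) (covers P (singular-point P s)) ℓ)

  coverLines : List (𝔽.Subspace n 2)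
  coverLines = filter 𝓛? 𝔽lines.elements

  coverLines-𝓛 : All 𝓛 coverLines
  coverLines-𝓛 = All.all-filter 𝓛? 𝔽lines.elements

  count-through : ∀ {w} → w ≢ 𝔽.0ᵛ → 𝔽.Singular w → ∑[ ℓ ∈ coverLines ] ⟨ w 𝔽.∈? ℓ ⟩ ≡ m
  count-through {w} w≢0 s = begin
    ∑[ ℓ ∈ coverLines ] ⟨ w 𝔽.∈? ℓ ⟩          ≡⟨ count-filter 𝓛? (λ ℓ → w 𝔽.∈? ℓ) 𝔽lines.elements ⟩
    𝔽lines.count (𝓛? ∩? (λ ℓ → w 𝔽.∈? ℓ))      ≡⟨ count-cong 𝔽.lines-finite (𝓛? ∩? (λ ℓ → w 𝔽.∈? ℓ)) through?
                                                   (λ {ℓ} (ℓ∈ , w∈) → ℓ∈ , λ {x} x∈ → 𝔽.point-⊆-line P ℓ w∈ x∈)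
                                                       (λ (ℓ∈ , P⊆ℓ) → ℓ∈ , P⊆ℓ (𝔽.gen∈ P)) ⟩
    𝔽lines.count through?  ≡⟨ 𝔽lines.HasCard⇒count through? (λ {ℓ} {ℓ′} → through-resp P {ℓ} {ℓ′})
        (covers P (singular-point P s)) ⟩
    m                                          ∎
    where
    open ≡-Reasoning
    P : 𝔽.Subspace n 1
    P = 𝔽.mkPoint w w≢0
    through? : Decidable (Through P)
    through? ℓ = 𝓛? ℓ ×-dec 𝔽.∀ᵛ? (𝔽._∈? P) (𝔽._∈? ℓ)

  -- Flags of a vector on a line of the cover are counted from the side of the vector: a nonzero
  -- singular vector lies on m lines of the cover, a nonsingular one on none.
  count-incidences : {ψ : Pred (𝔽.Vector n) 0ℓ} (ψ? : Decidable ψ) →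
    ∑[ ℓ ∈ coverLines ] 𝔽.count (𝔽.nonzero? ∩? ((𝔽._∈? ℓ) ∩? ψ?)) ≡ m * 𝔽.count (𝔽.nonzero? ∩? (𝔽.singular? ∩? ψ?))
  count-incidences {ψ} ψ? = begin
    ∑[ ℓ ∈ coverLines ] 𝔽.count (𝔽.nonzero? ∩? ((𝔽._∈? ℓ) ∩? ψ?))  ≡⟨ ∑-swap coverLines space _ ⟩
    ∑[ x ∈ space ] ∑[ ℓ ∈ coverLines ] ⟨ (𝔽.nonzero? ∩? ((𝔽._∈? ℓ) ∩? ψ?)) x ⟩  ≡⟨ ∑-cong space
        (λ x → pointwise x ((𝔽.nonzero? ∩? (𝔽.singular? ∩? ψ?)) x)) ⟩
    ∑[ x ∈ space ] (m * ⟨ (𝔽.nonzero? ∩? (𝔽.singular? ∩? ψ?)) x ⟩)  ≡⟨ ∑-*ˡ space m _ ⟩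
    m * 𝔽.count (𝔽.nonzero? ∩? (𝔽.singular? ∩? ψ?))                                                      ∎
    where
    open ≡-Reasoning
    space = 𝔽.vectors.elements {n}
    pointwise : ∀ x (d : Dec (x ≢ 𝔽.0ᵛ × 𝔽.Singular x × ψ x)) → ∑[ ℓ ∈ coverLines ] ⟨
        (𝔽.nonzero? ∩? ((𝔽._∈? ℓ) ∩? ψ?)) x ⟩ ≡ m * ⟨ d ⟩
    pointwise x (yes (x≢0 , s , ψx)) = trans (∑-cong coverLines (λ ℓ → ⟨⟩-cong ((𝔽.nonzero? ∩? ((𝔽._∈? ℓ) ∩? ψ?)) x)
        (x 𝔽.∈? ℓ) (λ (_ , x∈ , _) → x∈) (λ x∈ → x≢0 , x∈ , ψx)))
      (trans (count-through x≢0 s) (sym (ℕ.*-identityʳ m)))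
    pointwise x (no ¬p) = trans (trans (∑-cong-All coverLines-𝓛 (λ ℓ ℓ∈ → ⟨⟩-no ((𝔽.nonzero? ∩? ((𝔽._∈? ℓ) ∩? ψ?)) x)
        (λ (x≢0 , x∈ , ψx) → ¬p (x≢0 , onQuadric ℓ∈ x∈ , ψx)))) (∑-zero coverLines))
      (sym (ℕ.*-zeroʳ m))

  -- z lies on the extension of ℓ.
  OnLine : 𝔽.Subspace n 2 → Pred (Vector n) 0ℓ
  OnLine ℓ z = Re z ∈ 𝔽.⟦ ℓ ⟧ × Im z ∈ 𝔽.⟦ ℓ ⟧

  onLine? : ∀ ℓ → Decidable (OnLine ℓ)
  onLine? ℓ z = Re z 𝔽.∈? ℓ ×-dec Im z 𝔽.∈? ℓ

  extension : 𝔽.Subspace n 2 → Subspace n 2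
  extension ℓ = mkLine (ιᵛ (𝔽.gen₁ ℓ)) (ιᵛ (𝔽.gen₂ ℓ)) (ι-independent (𝔽.gens-independent ℓ))

  extension⇒onLine : ∀ ℓ {z : Vector n} → z ∈ ⟦ extension ℓ ⟧ → OnLine ℓ z
  extension⇒onLine ℓ z∈ =
    let a , c , e = ∈-line⁻ (extension ℓ) z∈
        p , r = complex-parts (trans e (lc-ι-complex a c (𝔽.gen₁ ℓ) (𝔽.gen₂ ℓ)))
    in subst (_∈ 𝔽.⟦ ℓ ⟧) (sym p) (𝔽.∈-line⁺ ℓ (re a) (re c)) , subst (_∈ 𝔽.⟦ ℓ ⟧) (sym r) (𝔽.∈-line⁺ ℓ (im a) (im c))

  onLine⇒extension : ∀ ℓ {z : Vector n} → OnLine ℓ z → z ∈ ⟦ extension ℓ ⟧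
  onLine⇒extension ℓ {z} (re∈ , im∈) =
    let a , c , e = 𝔽.∈-line⁻ ℓ re∈
        a′ , c′ , e′ = 𝔽.∈-line⁻ ℓ im∈
    in subst (_∈ ⟦ extension ℓ ⟧) (trans (sym (complex-lc a c a′ c′ (𝔽.gen₁ ℓ) (𝔽.gen₂ ℓ)))
        (trans (sym (cong₂ complex e e′)) (complex-Re-Im z)))
         (∈-line⁺ (extension ℓ) (ι a ⊕ ω · ι a′) (ι c ⊕ ω · ι c′))

  onLine-cong : ∀ {ℓ ℓ′ z} → 𝔽.⟦ ℓ ⟧ ⊆ 𝔽.⟦ ℓ′ ⟧ → OnLine ℓ z → OnLine ℓ′ z
  onLine-cong ℓ⊆ℓ′ (re∈ , im∈) = ℓ⊆ℓ′ re∈ , ℓ⊆ℓ′ im∈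

  ι-onLine : ∀ {ℓ x} → x ∈ 𝔽.⟦ ℓ ⟧ → OnLine ℓ (ιᵛ x)
  ι-onLine {ℓ} {x} x∈ = extension⇒onLine ℓ (let a , c , e = 𝔽.∈-line⁻ ℓ x∈ in
    subst (_∈ ⟦ extension ℓ ⟧) (trans (sym (ιᵛ-lc a c _ _)) (cong ιᵛ (sym e))) (∈-line⁺ (extension ℓ) (ι a) (ι c)))

  module _ {z : Vector n} {c} {w : 𝔽.Vector n} (z≡ : z ≡ c ·ᵛ ιᵛ w) where
    private
      parts : Re z ≡ re c 𝔽.·ᵛ w × Im z ≡ im c 𝔽.·ᵛ w
      parts = complex-parts (trans z≡ (·-ι-complex c w))

    multiple-onLine : ∀ {ℓ} → w ∈ 𝔽.⟦ ℓ ⟧ → OnLine ℓ z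
    multiple-onLine {ℓ} w∈ = subst (_∈ 𝔽.⟦ ℓ ⟧) (sym (proj₁ parts)) (𝔽.line-· ℓ (re c) w∈) , subst (_∈ 𝔽.⟦ ℓ ⟧)
        (sym (proj₂ parts)) (𝔽.line-· ℓ (im c) w∈)

    real-multiple : z ≢ 0ᵛ → ∃ λ a → a ≢ 𝔽.0# × (Re z ≡ a 𝔽.·ᵛ w ⊎ Im z ≡ a 𝔽.·ᵛ w)
    real-multiple z≢0 = by-cases (re c 𝔽.≟ 𝔽.0#) (im c 𝔽.≟ 𝔽.0#)
      where
      by-cases : Dec (re c ≡ 𝔽.0#) → Dec (im c ≡ 𝔽.0#) → ∃ λ a → a ≢ 𝔽.0# × (Re z ≡ a 𝔽.·ᵛ w ⊎ Im z ≡ a 𝔽.·ᵛ w)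
      by-cases (no n) _ = re c , n , inj₁ (proj₁ parts)
      by-cases _ (no n) = im c , n , inj₂ (proj₂ parts)
      by-cases (yes p) (yes s) = contradiction (trans (sym (complex-Re-Im z))
          (trans (cong₂ complex (trans (proj₁ parts) (trans (cong (𝔽._·ᵛ w) p) (𝔽.0·ᵛ w)))
        (trans (proj₂ parts) (trans (cong (𝔽._·ᵛ w) s) (𝔽.0·ᵛ w)))) complex-0)) z≢0

    onLine-multiple : z ≢ 0ᵛ → ∀ {ℓ} → OnLine ℓ z → w ∈ 𝔽.⟦ ℓ ⟧
    onLine-multiple z≢0 {ℓ} (re∈ , im∈) = let a , a≢0 , e = real-multiple z≢0 in
      [ (λ e → divide a≢0 (subst (_∈ 𝔽.⟦ ℓ ⟧) e re∈)) , (λ e → divide a≢0 (subst (_∈ 𝔽.⟦ ℓ ⟧) e im∈)) ]′ e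
      where
      divide : ∀ {a} (a≢0 : a ≢ 𝔽.0#) → a 𝔽.·ᵛ w ∈ 𝔽.⟦ ℓ ⟧ → w ∈ 𝔽.⟦ ℓ ⟧
      divide {a} a≢0 aw∈ = subst (_∈ 𝔽.⟦ ℓ ⟧) (trans (𝔽.·ᵛ-assoc (𝔽.inverse a≢0) a w)
        (trans (cong (𝔽._·ᵛ w) (trans (𝔽.*-comm (𝔽.inverse a≢0) a) (𝔽.inverseʳ a≢0))) (𝔽.·ᵛ-identity w)))
            (𝔽.line-· ℓ (𝔽.inverse a≢0) aw∈)

  -- A point either lies on a unique line of Σ, or is a point of Σ.
  independent-or-real : ∀ {z : Vector n} → z ≢ 0ᵛ → 𝔽.Independent (Re z) (Im z) ⊎ (∃₂ λ c w → w ≢ 𝔽.0ᵛ × z ≡ c ·ᵛ ιᵛ w)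
  independent-or-real {z} z≢0 = by-cases (Re z 𝔽.≟ᵛ 𝔽.0ᵛ) (𝔽.scalars.∃? (λ t → Im z 𝔽.≟ᵛ t 𝔽.·ᵛ Re z) 𝔽.resp≡)
    where
    Goal = 𝔽.Independent (Re z) (Im z) ⊎ (∃₂ λ c w → w ≢ 𝔽.0ᵛ × z ≡ c ·ᵛ ιᵛ w)
    by-cases : Dec (Re z ≡ 𝔽.0ᵛ) → Dec (∃ λ t → Im z ≡ t 𝔽.·ᵛ Re z) → Goal
    by-cases (yes p) _ = inj₂ (ω , Im z , (λ s → z≢0 (trans (sym (complex-Re-Im z)) (trans (cong₂ complex p s) complex-0)))
      , trans (sym (complex-Re-Im z)) (trans (cong (λ u → ιᵛ u +ᵛ ω ·ᵛ ιᵛ (Im z)) p)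
          (trans (cong (_+ᵛ ω ·ᵛ ιᵛ (Im z)) ιᵛ-0) (trans (+ᵛ-comm _ _) (+ᵛ-identityʳ _)))))
    by-cases (no Re≢0) (no ¬∥) = inj₁ (𝔽.independent⁺ Re≢0 (λ t e → ¬∥ (t , e)))
    by-cases (no Re≢0) (yes (t , e)) = inj₂ (1# ⊕ ω · ι t , Re z , Re≢0 , (begin
      z                                           ≡⟨ complex-Re-Im z ⟨
      complex (Re z) (Im z)  ≡⟨ cong (λ v → ιᵛ (Re z) +ᵛ ω ·ᵛ v) (trans (cong ιᵛ e) (ιᵛ-· t (Re z))) ⟩
      ιᵛ (Re z) +ᵛ ω ·ᵛ ι t ·ᵛ ιᵛ (Re z)  ≡⟨ entrywise (⌜ ιᵛ (Re z) ⌝ ⊞ ω ⊡ ι t ⊡ ⌜ ιᵛ (Re z) ⌝)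
          ((1# ⊕ ω · ι t) ⊡ ⌜ ιᵛ (Re z) ⌝)
                                                       (λ i → solve 3 (λ x w t → x :+ w :* (t :* x) :=
                                                           (:1 :+ w :* t) :* x) refl (lookup (ιᵛ (Re z)) i) ω (ι t)) ⟩
      (1# ⊕ ω · ι t) ·ᵛ ιᵛ (Re z)                 ∎))
      where open ≡-Reasoning

  extensionPoint : 𝔽.Subspace n 1 → Subspace n 1
  extensionPoint R = mkPoint (ιᵛ (𝔽.gen R)) (ιᵛ≢0 (𝔽.gen≢0 R))

  RealSingularIn : Vector n → Pred (𝔽.Subspace n 1) 0ℓ
  RealSingularIn z R = 𝔽.Singular (𝔽.gen R) × z ∈ ⟦ extensionPoint R ⟧

  realSingularIn? : ∀ z → Decidable (RealSingularIn z)
  realSingularIn? z R = 𝔽.singular? (𝔽.gen R) ×-dec z ∈? extensionPoint R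

  extensionPoint-unique : ∀ {z : Vector n} → z ≢ 0ᵛ → ∀ R R′ → z ∈ ⟦ extensionPoint R ⟧ → z ∈ ⟦ extensionPoint R′ ⟧ →
      𝔽.⟦ R ⟧ ⊆ 𝔽.⟦ R′ ⟧
  extensionPoint-unique {z} z≢0 R R′ z∈R z∈R′ =
    let a , a≢0 , e = real-multiple (proj₂ (∈-point⁻ (extensionPoint R) z∈R)) z≢0
        c , e′ = ∈-point⁻ (extensionPoint R′) z∈R′
        p , s = complex-parts (trans e′ (·-ι-complex c (𝔽.gen R′)))
        x = a 𝔽.·ᵛ 𝔽.gen R
        x∈R′ = [ (λ e → subst (_∈ 𝔽.⟦ R′ ⟧) (trans (sym p) e) (𝔽.∈-point⁺ R′ (re c))) ,
            (λ e → subst (_∈ 𝔽.⟦ R′ ⟧) (trans (sym s) e) (𝔽.∈-point⁺ R′ (im c))) ]′ e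
    in 𝔽.point-⊆ R R′ (𝔽.∈-point⁺ R a) (λ x≡0 → 𝔽.gen≢0 R (𝔽.·ᵛ≡0 a≢0 x≡0)) x∈R′

  realSingularIn-resp : ∀ z → RealSingularIn z Respects (Setoid._≈_ (Projective.points F r))
  realSingularIn-resp z {R} {R′} (R⊆R′ , R′⊆R) (s , z∈) = singular-point R s (R′⊆R (𝔽.gen∈ R′)) ,
    (let d , e = 𝔽.∈-point⁻ R′ (R⊆R′ (𝔽.gen∈ R))
         c , e′ = ∈-point⁻ (extensionPoint R) z∈
     in subst (_∈ ⟦ extensionPoint R′ ⟧) (trans (sym (·ᵛ-assoc c (ι d) _))
         (trans (cong (c ·ᵛ_) (trans (sym (ιᵛ-· d _)) (cong ιᵛ (sym e)))) (sym e′)))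
         (∈-point⁺ (extensionPoint R′) (c · ι d)))

  -- Vectors on the points of the quadric itself. The witness is a point of Σ and not a vector,
  -- which makes it unique for nonzero z and allows summation over witnesses.
  RealSingular : Pred (Vector n) 0ℓ
  RealSingular z = ∃ (RealSingularIn z)

  abstract
    realSingular? : Decidable RealSingular
    realSingular? z = 𝔽points.∃? (realSingularIn? z) (λ {R} {R′} → realSingularIn-resp z {R} {R′})

  real⇒realSingular : ∀ {z : Vector n} {c} {w : 𝔽.Vector n} → z ≡ c ·ᵛ ιᵛ w → w ≢ 𝔽.0ᵛ → 𝔽.Singular w → RealSingular z
  real⇒realSingular {z} {c} {w} e w≢0 s = 𝔽.mkPoint w w≢0 , s , subst (_∈ ⟦ extensionPoint (𝔽.mkPoint w w≢0) ⟧)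
      (sym e) (∈-point⁺ (extensionPoint (𝔽.mkPoint w w≢0)) c)

  Covered : Pred (Vector n) 0ℓ
  Covered z = ∃ λ ℓ → ℓ ∈ 𝓛 × OnLine ℓ z

  private
    coveredBy-resp : ∀ z → (λ ℓ → ℓ ∈ 𝓛 × OnLine ℓ z) Respects (Setoid._≈_ (Projective.lines F r))
    coveredBy-resp z {ℓ} {ℓ′} e (ℓ∈ , on) = resp {ℓ} {ℓ′} e ℓ∈ , onLine-cong {ℓ} {ℓ′} (proj₁ e) on

    coveredBy? : ∀ z → Decidable (λ ℓ → ℓ ∈ 𝓛 × OnLine ℓ z)
    coveredBy? z = 𝓛? ∩? (λ ℓ → onLine? ℓ z)

  abstract
    covered? : Decidable Covered
    covered? z = 𝔽lines.∃? (coveredBy? z) (λ {ℓ} {ℓ′} → coveredBy-resp z {ℓ} {ℓ′})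

  -- Positivity of m enters here: a singular point of Σ lies on m lines of the cover, hence on at
  -- least one.
  realSingular⇒covered : ∀ {z : Vector n} → RealSingular z → Covered z
  realSingular⇒covered {z} (R , s , z∈) =
    let c , e = ∈-point⁻ (extensionPoint R) z∈
        ℓ , ℓ∈ , w∈ = 𝔽lines.nonzero⇒∃ (𝓛? ∩? (λ ℓ → 𝔽.gen R 𝔽.∈? ℓ))
            (λ count≡0 → ℕ.<⇒≢ positive (sym (trans (sym (count-through (𝔽.gen≢0 R) s))
                          (trans (count-filter 𝓛? (λ ℓ → 𝔽.gen R 𝔽.∈? ℓ) 𝔽lines.elements) count≡0))))
    in ℓ , ℓ∈ , multiple-onLine e {ℓ} w∈

  -- A point of X off Σ lies on one extended line of the cover, a singular point
  -- of Σ on m of them.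
  count-covering : ∀ {z : Vector n} → z ≢ 0ᵛ → ∑[ ℓ ∈ coverLines ] ⟨ onLine? ℓ z ⟩ + ⟨ realSingular? z ⟩
      ≡ ⟨ covered? z ⟩ + m * ⟨ realSingular? z ⟩
  count-covering {z} z≢0 = by-cases (realSingular? z) (covered? z)
    where
    by-cases : (d : Dec (RealSingular z)) (e : Dec (Covered z)) → ∑[ ℓ ∈ coverLines ] ⟨ onLine? ℓ z ⟩ + ⟨ d ⟩
        ≡ ⟨ e ⟩ + m * ⟨ d ⟩
    by-cases (yes rs) (no ¬c) = contradiction (realSingular⇒covered rs) ¬c
    by-cases (yes (R , s , z∈)) (yes _) = trans (cong (_+ 1) (trans
        (∑-cong coverLines (λ ℓ → ⟨⟩-cong (onLine? ℓ z) (𝔽.gen R 𝔽.∈? ℓ)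
        (onLine-multiple e z≢0 {ℓ}) (multiple-onLine e {ℓ}))) (count-through (𝔽.gen≢0 R) s)))
        (trans (ℕ.+-comm m 1) (cong suc (sym (ℕ.*-identityʳ m))))
      where
      e = proj₂ (∈-point⁻ (extensionPoint R) z∈)
    by-cases (no ¬rs) (no ¬c) = cong₂ _+_ (trans (∑-cong-All coverLines-𝓛
        (λ ℓ ℓ∈ → ⟨⟩-no (onLine? ℓ z) (λ on → ¬c (ℓ , ℓ∈ , on)))) (∑-zero coverLines)) (sym (ℕ.*-zeroʳ m))
    by-cases (no ¬rs) (yes (ℓ , ℓ∈ , on)) = cong₂ _+_ (trans (count-filter 𝓛? (λ ℓ → onLine? ℓ z) 𝔽lines.elements)
        (𝔽lines.count-unique (coveredBy? z) (λ {ℓ} {ℓ′} → coveredBy-resp z {ℓ} {ℓ′}) {ℓ} (ℓ∈ , on) λ {ℓ′}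
            (_ , on′) → ⊆ {ℓ′} {ℓ} on′ on , ⊆ {ℓ} {ℓ′} on on′)) (sym (ℕ.*-zeroʳ m))
      where
      -- Were z a multiple of a vector w of Σ, then w would lie on ℓ and be singular, against ¬rs.
      -- So Re z and Im z span ℓ and determine it.
      independent : 𝔽.Independent (Re z) (Im z)
      independent = [ (λ i → i) , (λ (c , w , w≢0 , e) → contradiction
          (real⇒realSingular e w≢0 (onQuadric ℓ∈ (onLine-multiple e z≢0 {ℓ} on))) ¬rs) ]′ (independent-or-real z≢0)
      ⊆ : ∀ {ℓ ℓ′} → OnLine ℓ z → OnLine ℓ′ z → 𝔽.⟦ ℓ ⟧ ⊆ 𝔽.⟦ ℓ′ ⟧
      ⊆ {ℓ} {ℓ′} (re∈ , im∈) (re∈′ , im∈′) x∈ = 𝔽.line-⊆ ℓ ℓ′ re∈ im∈ independent re∈′ im∈′ x∈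

  module _ (p : Vector n) where
    ⊥? : Decidable (kernel (λ z → h z p))
    ⊥? = kernel? (λ z → h z p)

    -- ℓ is contained in p^⊥.
    Inside : Pred (𝔽.Subspace n 2) 0ℓ
    Inside ℓ = h (ιᵛ (𝔽.gen₁ ℓ)) p ≡ 0# × h (ιᵛ (𝔽.gen₂ ℓ)) p ≡ 0#

    inside? : Decidable Inside
    inside? ℓ = h (ιᵛ (𝔽.gen₁ ℓ)) p ≟ 0# ×-dec h (ιᵛ (𝔽.gen₂ ℓ)) p ≟ 0#

    private
      h-lc : ∀ a c x y → h (lc a c x y) p ≡ a · h x p ⊕ c · h y p
      h-lc a c x y = trans (h-linear p (a ·ᵛ x) c y) (cong (_⊕ c · h y p) (linear-· (h-linear p) a x))

    inside⇒⊥ : ∀ ℓ → Inside ℓ → ∀ {z} → OnLine ℓ z → h z p ≡ 0#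
    inside⇒⊥ ℓ (p₁ , p₂) on = let a , c , e = ∈-line⁻ (extension ℓ) (onLine⇒extension ℓ on) in
      trans (cong (λ z → h z p) e) (trans (h-lc a c _ _) (trans (cong₂ (λ s t → a · s ⊕ c · t) p₁ p₂)
          (solve 2 (λ a c → a :* :0 :+ c :* :0 := :0) refl a c)))

    insideLines : ℕ
    insideLines = ∑[ ℓ ∈ coverLines ] ⟨ inside? ℓ ⟩

    -- An extended line has q² · q² vectors. Inside p^⊥ all of them count, otherwise the kernel of a
    -- nonzero linear form on the line, which has q². The added term on the left stands for the
    -- subtraction of q².
    count-onLine-⊥ : ∀ ℓ → count (onLine? ℓ ∩? ⊥?) + q² * ⟨ inside? ℓ ⟩ ≡ q² + q² * q² * ⟨ inside? ℓ ⟩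
    count-onLine-⊥ ℓ = by-cases (inside? ℓ)
      where
      M = extension ℓ
      size : count (onLine? ℓ) ≡ q² * q²
      size = trans (count-cong (vectors n) (onLine? ℓ) (_∈? M) (onLine⇒extension ℓ) (extension⇒onLine ℓ)) (count-line M)
      sub : IsSubspace (OnLine ℓ)
      sub = record
        { 0∈       = extension⇒onLine ℓ (IsSubspace.0∈ (line-subspace M))
        ; +-closed = λ x y → extension⇒onLine ℓ (line-+ M (onLine⇒extension ℓ x) (onLine⇒extension ℓ y))
        ; ·-closed = λ a x → extension⇒onLine ℓ (line-· M a (onLine⇒extension ℓ x))
        }
      outside : ∀ {x} → OnLine ℓ x → h x p ≢ 0# → count (onLine? ℓ ∩? ⊥?) + q² * 0 ≡ q² + q² * q² * 0
      outside {x} on ne = trans (cong₂ _+_ (ℕ.*-cancelˡ-≡ _ _ q²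
          (trans (count-kernel (onLine? ℓ) sub (h-linear p) on ne) size)) (ℕ.*-zeroʳ q²))
        (cong (q² +_) (sym (ℕ.*-zeroʳ (q² * q²))))
      by-cases : (d : Dec (Inside ℓ)) → count (onLine? ℓ ∩? ⊥?) + q² * ⟨ d ⟩ ≡ q² + q² * q² * ⟨ d ⟩
      by-cases (yes i) = trans (cong (_+ q² * 1) (trans (count-cong (vectors n) (onLine? ℓ ∩? ⊥?) (onLine? ℓ) proj₁
          (λ on → on , inside⇒⊥ ℓ i on)) size))
        (trans (ℕ.+-comm (q² * q²) (q² * 1)) (cong₂ _+_ (ℕ.*-identityʳ q²) (sym (ℕ.*-identityʳ (q² * q²)))))
      by-cases (no ¬i) = at-generator (h (ιᵛ (𝔽.gen₁ ℓ)) p ≟ 0#)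
        where
        at-generator : Dec (h (ιᵛ (𝔽.gen₁ ℓ)) p ≡ 0#) → _
        at-generator (no ne) = outside (ι-onLine {ℓ} (𝔽.gen₁∈ ℓ)) ne
        at-generator (yes e) = outside (ι-onLine {ℓ} (𝔽.gen₂∈ ℓ)) (λ e′ → ¬i (e , e′))

    Seen : Pred (𝔽.Vector n) 0ℓ
    Seen w = h (ιᵛ w) p ≡ 0#

    seen? : Decidable Seen
    seen? w = h (ιᵛ w) p ≟ 0#

    realPoints : ℕ
    realPoints = 𝔽points.count (λ R → (𝔽.singular? ∩? seen?) (𝔽.gen R))

    coveredVectors realVectors : ℕ
    coveredVectors = count (nonzero? ∩? (covered? ∩? ⊥?))
    realVectors    = count (nonzero? ∩? (realSingular? ∩? ⊥?))

    private
      space = vectors.elements {n}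

      seen-· : ∀ c {w} → Seen w → h (c ·ᵛ ιᵛ w) p ≡ 0#
      seen-· c {w} s = trans (linear-· (h-linear p) c (ιᵛ w)) (trans (cong (c ·_) s) (zeroʳ c))

      seen-·⁻ : ∀ {c w} → c ≢ 0# → h (c ·ᵛ ιᵛ w) p ≡ 0# → Seen w
      seen-·⁻ {c} {w} c≢0 e = ·≡0 c≢0 (trans (sym (linear-· (h-linear p) c (ιᵛ w))) e)

    -- Each singular point of Σ in p^⊥ carries q² - 1 nonzero vectors over the extension, and a
    -- nonzero vector lies on at most one such point.
    count-realVectors : realVectors + realPoints ≡ realPoints * q²
    count-realVectors = begin
      realVectors + realPoints
        ≡⟨ cong (_+ realPoints) (trans (∑-cong space spread) (∑-swap space 𝔽points.elements _)) ⟩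
      ∑[ R ∈ 𝔽points.elements ] ∑[ z ∈ space ] ⟨ nonzero⊥? z ×-dec realSingularIn? z R ⟩ + realPoints
        ≡⟨ ∑-+ 𝔽points.elements _ _ ⟨
      ∑[ R ∈ 𝔽points.elements ] (∑[ z ∈ space ] ⟨ nonzero⊥? z ×-dec realSingularIn? z R ⟩ + ⟨ (𝔽.singular? ∩? seen?)
          (𝔽.gen R) ⟩)
        ≡⟨ ∑-cong 𝔽points.elements (λ R → collect R ((𝔽.singular? ∩? seen?) (𝔽.gen R))) ⟩
      ∑[ R ∈ 𝔽points.elements ] (⟨ (𝔽.singular? ∩? seen?) (𝔽.gen R) ⟩ * q²)
        ≡⟨ ∑-*ʳ 𝔽points.elements q² _ ⟩
      realPoints * q² ∎
      where
      open ≡-Reasoning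
      nonzero⊥? = nonzero? ∩? ⊥?
      one : ∀ {z} → z ≢ 0ᵛ → (d : Dec (RealSingular z)) → ⟨ d ⟩ ≡ 𝔽points.count (realSingularIn? z)
      one {z} z≢0 (yes (R , s , z∈)) = sym (𝔽points.count-unique (realSingularIn? z)
          (λ {R} {R′} → realSingularIn-resp z {R} {R′}) {R} (s , z∈)
        λ {R′} (_ , z∈′) → extensionPoint-unique z≢0 R′ R z∈′ z∈ , extensionPoint-unique z≢0 R R′ z∈ z∈′)
      one {z} z≢0 (no ¬rs) = sym (trans (∑-cong 𝔽points.elements
          (λ R → ⟨⟩-no (realSingularIn? z R) (λ x → ¬rs (R , x)))) (∑-zero 𝔽points.elements))
      spread : ∀ z → ⟨ (nonzero? ∩? (realSingular? ∩? ⊥?)) z ⟩ ≡ ∑[ R ∈ 𝔽points.elements ] ⟨ nonzero⊥? z ×-dec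
          realSingularIn? z R ⟩
      spread z = begin
        ⟨ (nonzero? ∩? (realSingular? ∩? ⊥?)) z ⟩  ≡⟨ ⟨⟩-cong ((nonzero? ∩? (realSingular? ∩? ⊥?)) z)
            (nonzero⊥? z ×-dec realSingular? z) (λ (a , b , c) → (a , c) , b) (λ ((a , c) , b) → a , b , c) ⟩
        ⟨ nonzero⊥? z ×-dec realSingular? z ⟩                        ≡⟨ ⟨⟩-× (nonzero⊥? z) (realSingular? z) ⟩
        ⟨ nonzero⊥? z ⟩ * ⟨ realSingular? z ⟩  ≡⟨ ⟨⟩*-cong (nonzero⊥? z) (λ (z≢0 , _) → one z≢0 (realSingular? z)) ⟩
        ⟨ nonzero⊥? z ⟩ * 𝔽points.count (realSingularIn? z)  ≡⟨ sym (∑-*ˡ 𝔽points.elements ⟨ nonzero⊥? z ⟩ _) ⟩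
        ∑[ R ∈ 𝔽points.elements ] (⟨ nonzero⊥? z ⟩ * ⟨ realSingularIn? z R ⟩)  ≡⟨ ∑-cong 𝔽points.elements
            (λ R → sym (⟨⟩-× (nonzero⊥? z) (realSingularIn? z R))) ⟩
        ∑[ R ∈ 𝔽points.elements ] ⟨ nonzero⊥? z ×-dec realSingularIn? z R ⟩    ∎
      collect : ∀ R (d : Dec (𝔽.Singular (𝔽.gen R) × Seen (𝔽.gen R))) → ∑[ z ∈ space ] ⟨ nonzero⊥? z ×-dec
          realSingularIn? z R ⟩ + ⟨ d ⟩ ≡ ⟨ d ⟩ * q²
      collect R (yes (s , seen)) = trans (trans (cong (_+ 1) (count-cong (vectors n)
          (λ z → nonzero⊥? z ×-dec realSingularIn? z R) (nonzero? ∩? (_∈? extensionPoint R))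
          (λ ((a , _) , _ , z∈) → a , z∈)
          (λ (a , z∈) → (a , (let c , e = ∈-point⁻ (extensionPoint R) z∈ in trans (cong (λ z → h z p) e) (seen-· c seen))) , s , z∈)))
        (trans (count-nonzero (_∈? extensionPoint R) (subst (_∈ ⟦ extensionPoint R ⟧) (0·ᵛ _)
            (∈-point⁺ (extensionPoint R) 0#))) (count-point (extensionPoint R))))
        (sym (ℕ.*-identityˡ q²))
      collect R (no ¬d) = trans (ℕ.+-identityʳ _) (trans (∑-cong space
          (λ z → ⟨⟩-no (nonzero⊥? z ×-dec realSingularIn? z R) λ ((z≢0 , ⊥z) , s , z∈) →
        let c , e = ∈-point⁻ (extensionPoint R) z∈
        in ¬d (s , seen-·⁻ (λ c≡0 → z≢0 (trans e (trans (cong (_·ᵛ ιᵛ (𝔽.gen R)) c≡0) (0·ᵛ _))))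
            (trans (cong (λ z → h z p) (sym e)) ⊥z)))) (∑-zero space))

    -- The same points as in `count-realVectors`, now with q - 1 nonzero vectors over the subfield
    -- each. Together the two equations relate the vector counts over both fields by the factor q +
    -- 1.
    count-seen : 𝔽.count (𝔽.nonzero? ∩? (𝔽.singular? ∩? seen?)) + realPoints ≡ realPoints * q
    count-seen = 𝔽.count-points (λ R → (𝔽.singular? ∩? seen?) (𝔽.gen R)) (𝔽.singular? ∩? seen?)
      (λ {R} {x} x∈ _ (s , seen) → singular-point R s x∈ , (let c , e = 𝔽.∈-point⁻ R x∈ in
         trans (cong (λ x → h x p) (trans (cong ιᵛ e) (ιᵛ-· c (𝔽.gen R)))) (seen-· (ι c) seen)))
      (λ {R} {x} x∈ x≢0 (s , seen) → let c , e = 𝔽.proportional R x∈ x≢0 (𝔽.gen∈ R) in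
         trans (cong form e) (𝔽.singular-· s c)
         , trans (cong (λ x → h x p) (trans (cong ιᵛ e) (ιᵛ-· c x))) (seen-· (ι c) seen))

    -- The sum of `count-covering` over the nonzero z in p^⊥. The zero vector lies on every extended
    -- line, which accounts for the summand `length coverLines`.
    count-covered : coveredVectors + m * realVectors + length coverLines ≡ ∑[ ℓ ∈ coverLines ] count
        (onLine? ℓ ∩? ⊥?) + realVectors
    count-covered = begin
      coveredVectors + m * realVectors + length coverLines
        ≡⟨ cong₂ _+_ (cong (coveredVectors +_) (∑-*ˡ space m _)) (trans (∑-const coverLines 1) (ℕ.*-identityʳ _)) ⟨
      coveredVectors + ∑[ z ∈ space ] (m * ⟨ (nonzero? ∩? (realSingular? ∩? ⊥?)) z ⟩) + ∑ coverLines (λ _ → 1)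
        ≡⟨ cong (_+ ∑ coverLines (λ _ → 1)) (trans (sym (∑-+ space _ _)) (trans (∑-cong space pointwise) (∑-+ space _ _))) ⟩
      ∑[ z ∈ space ] ∑[ ℓ ∈ coverLines ] ⟨ (nonzero? ∩? (onLine? ℓ ∩? ⊥?)) z ⟩ + realVectors + ∑ coverLines (λ _ → 1)
        ≡⟨ xy∙z≈xz∙y (∑[ z ∈ space ] ∑[ ℓ ∈ coverLines ] ⟨ (nonzero? ∩? (onLine? ℓ ∩? ⊥?)) z ⟩) realVectors
            (∑ coverLines (λ _ → 1)) ⟩
      ∑[ z ∈ space ] ∑[ ℓ ∈ coverLines ] ⟨ (nonzero? ∩? (onLine? ℓ ∩? ⊥?)) z ⟩ + ∑ coverLines (λ _ → 1) + realVectors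
        ≡⟨ cong (_+ realVectors) (trans (cong (_+ ∑ coverLines (λ _ → 1)) (∑-swap space coverLines _))
            (trans (sym (∑-+ coverLines _ _))
             (∑-cong coverLines (λ ℓ → count-nonzero (onLine? ℓ ∩? ⊥?)
                 (extension⇒onLine ℓ (IsSubspace.0∈ (line-subspace (extension ℓ))) , linear-0 (h-linear p)))))) ⟩
      ∑[ ℓ ∈ coverLines ] count (onLine? ℓ ∩? ⊥?) + realVectors ∎
      where
      open ≡-Reasoning
      open CommutativeSemigroup ℕ.+-commutativeSemigroup using (xy∙z≈xz∙y)
      nonzero⊥? = nonzero? ∩? ⊥?
      product : {A : Pred (Vector n) 0ℓ} (A? : Decidable A) → ∀ z → ⟨ (nonzero? ∩? (A? ∩? ⊥?)) z ⟩
          ≡ ⟨ nonzero⊥? z ⟩ * ⟨ A? z ⟩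
      product A? z = trans (⟨⟩-cong ((nonzero? ∩? (A? ∩? ⊥?)) z) (nonzero⊥? z ×-dec A? z)
          (λ (a , b , c) → (a , c) , b) (λ ((a , c) , b) → a , b , c)) (⟨⟩-× (nonzero⊥? z) (A? z))
      pointwise : ∀ z → ⟨ (nonzero? ∩? (covered? ∩? ⊥?)) z ⟩ + m * ⟨ (nonzero? ∩? (realSingular? ∩? ⊥?)) z ⟩
                      ≡ ∑[ ℓ ∈ coverLines ] ⟨ (nonzero? ∩? (onLine? ℓ ∩? ⊥?)) z ⟩ + ⟨ (nonzero? ∩? (realSingular? ∩? ⊥?)) z ⟩
      pointwise z = begin
        ⟨ (nonzero? ∩? (covered? ∩? ⊥?)) z ⟩ + m * ⟨ (nonzero? ∩? (realSingular? ∩? ⊥?)) z ⟩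
          ≡⟨ cong₂ (λ s t → s + m * t) (product covered? z) (product realSingular? z) ⟩
        i * ⟨ covered? z ⟩ + m * (i * ⟨ realSingular? z ⟩)
          ≡⟨ +-*-Solver.solve 4 (λ i c m s → i ⊠ c ⊞′ m ⊠ (i ⊠ s) +-*-Solver.:= i ⊠
              (c ⊞′ m ⊠ s)) refl i ⟨ covered? z ⟩ m ⟨ realSingular? z ⟩ ⟩
        i * (⟨ covered? z ⟩ + m * ⟨ realSingular? z ⟩)
          ≡⟨ ⟨⟩*-cong (nonzero⊥? z) (λ (z≢0 , _) → sym (count-covering z≢0)) ⟩
        i * (∑[ ℓ ∈ coverLines ] ⟨ onLine? ℓ z ⟩ + ⟨ realSingular? z ⟩)
          ≡⟨ ℕ.*-distribˡ-+ i _ _ ⟩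
        i * ∑[ ℓ ∈ coverLines ] ⟨ onLine? ℓ z ⟩ + i * ⟨ realSingular? z ⟩
          ≡⟨ cong₂ _+_ (trans (sym (∑-*ˡ coverLines i _)) (∑-cong coverLines (λ ℓ → sym (product (onLine? ℓ) z))))
              (sym (product realSingular? z)) ⟩
        ∑[ ℓ ∈ coverLines ] ⟨ (nonzero? ∩? (onLine? ℓ ∩? ⊥?)) z ⟩ + ⟨ (nonzero? ∩? (realSingular? ∩? ⊥?)) z ⟩ ∎
        where
        i = ⟨ nonzero⊥? z ⟩
        open +-*-Solver using () renaming (_:*_ to _⊠_; _:+_ to _⊞′_)

    count-onLines : ∑[ ℓ ∈ coverLines ] count (onLine? ℓ ∩? ⊥?) + q² * insideLines
        ≡ q² * length coverLines + q² * q² * insideLines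
    count-onLines = begin
      ∑[ ℓ ∈ coverLines ] count (onLine? ℓ ∩? ⊥?) + q² * insideLines
        ≡⟨ trans (cong (∑[ ℓ ∈ coverLines ] count (onLine? ℓ ∩? ⊥?) +_) (sym (∑-*ˡ coverLines q² _)))
            (sym (∑-+ coverLines _ _)) ⟩
      ∑[ ℓ ∈ coverLines ] (count (onLine? ℓ ∩? ⊥?) + q² * ⟨ inside? ℓ ⟩)
        ≡⟨ ∑-cong coverLines count-onLine-⊥ ⟩
      ∑[ ℓ ∈ coverLines ] (q² + q² * q² * ⟨ inside? ℓ ⟩)
        ≡⟨ trans (∑-+ coverLines _ _) (cong₂ _+_ (trans (∑-const coverLines q²) (ℕ.*-comm (length coverLines) q²))
            (∑-*ˡ coverLines (q² * q²) _)) ⟩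
      q² * length coverLines + q² * q² * insideLines ∎
      where open ≡-Reasoning

-- Lines of Σ and their polar subspaces

module PolarGeometry {q} (F : FiniteField q) {n : ℕ} (Q : Projective.QuadraticForm F n) where
  open FieldTheory F
  open FieldCounting F
  open Spans F

  module _ (2≢0 : 1# ⊕ 1# ≢ 0#) (δ : Carrier) (δ-nonsquare : ∀ s → s · s ≢ δ) where
    open QuadraticCounting Q 2≢0

    -- The condition for ⟨u + ωv⟩ to lie on the Hermitian variety, where ω² = δ.
    Conjugate : Vector n → Vector n → Set
    Conjugate u v = b u u ≡ δ · b v v

    -- Under the condition the Gram determinant is δ c² - e² with c = b(v, v) and e = b(u, v). If it
    -- vanishes with c ≠ 0, then δ is the square of e/c; if c = 0, then e = 0 as well.
    conjugate-dichotomy : ∀ {u v} → Conjugate u v → (b u u ≡ 0# × b u v ≡ 0# × b v v ≡ 0#) ⊎ gram u v ≢ 0#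
    conjugate-dichotomy {u} {v} conj = by-cases (b v v ≟ 0#) (b u v ≟ 0#)
      where
      c = b v v
      e = b u v
      gram≡ : gram u v ≡ δ · c · c - e · e
      gram≡ = cong (λ x → x · c - e · e) conj
      by-cases : Dec (c ≡ 0#) → Dec (e ≡ 0#) → (b u u ≡ 0# × e ≡ 0# × c ≡ 0#) ⊎ gram u v ≢ 0#
      by-cases (yes p) (yes s) = inj₁ (trans conj (trans (cong (δ ·_) p) (zeroʳ δ)) , s , p)
      by-cases (yes p) (no e≢0) = inj₂ λ g → ·≢0 e≢0 e≢0 (neg≡0 (trans
          (trans (solve 2 (λ d e → :- (e :* e) := d :* :0 :* :0 :- e :* e) refl δ e)
        (cong (λ x → δ · x · x - e · e) (sym p))) (trans (sym gram≡) g)))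
      by-cases (no c≢0) _ = inj₂ λ g → δ-nonsquare (e · inverse c≢0) (begin
        e · i · (e · i)  ≡⟨ solve 2 (λ e i → e :* i :* (e :* i) := e :* e :* (i :* i)) refl e i ⟩
        e · e · (i · i)                ≡⟨ cong (_· (i · i)) (sym (-≡0 (trans (sym gram≡) g))) ⟩
        δ · c · c · (i · i)  ≡⟨ solve 3 (λ d c i → d :* c :* c :* (i :* i) := d :* (c :* i) :* (c :* i)) refl δ c i ⟩
        δ · (c · i) · (c · i)          ≡⟨ cong (λ x → δ · x · x) (inverseʳ c≢0) ⟩
        δ · 1# · 1#                    ≡⟨ solve 1 (λ d → d :* :1 :* :1 := d) refl δ ⟩
        δ                              ∎)
        where
        open ≡-Reasoning
        i = inverse c≢0

    module Sizes (nondeg : NondegenerateOn (λ _ → ⊤)) where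

      -- From x₀ not orthogonal to u, the vector w = b(x₀, u) v - b(x₀, v) u is nonzero, so some y
      -- has b(y, w) ≠ 0. Clearing the u-component of y by x₀ gives x with b(x, u) = 0 and b(x, v) =
      -- b(y, w).
      nonorthogonal-pair : ∀ {u v} → Independent u v → ∃ λ x → b x u ≡ 0# × b x v ≢ 0#
      nonorthogonal-pair {u} {v} ind = x , x⊥u , x⊥̸v
        where
        at-u = nonorthogonal full? nondeg tt (independent⇒≢0ˡ ind)
        x₀ = proj₁ at-u
        x₀⊥̸u = proj₂ (proj₂ at-u)
        w = lc (- b x₀ v) (b x₀ u) u v
        at-w = nonorthogonal full? nondeg {w} tt (λ e → x₀⊥̸u (proj₂ (ind e)))
        y = proj₁ at-w
        x = lc (b x₀ u) (- b y u) y x₀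
        x⊥u : b x u ≡ 0#
        x⊥u = trans (b-lcˡ _ _ y x₀ u) (solve 2 (λ s t → s :* t :+ :- t :* s := :0) refl (b x₀ u) (b y u))
        x⊥̸v : b x v ≢ 0#
        x⊥̸v e = proj₂ (proj₂ at-w) (trans (b-lcʳ _ _ u v y) (trans
          (solve 4 (λ s t a c → :- s :* t :+ c :* a := c :* a :+ :- t :* s) refl (b x₀ v) (b y u) (b y v) (b x₀ u))
          (trans (sym (b-lcˡ _ _ y x₀ v)) e)))

      module _ {k} (n≡ : n ≡ suc (2 + k * 2)) where
        private
          N = q ℕ.^ (k * 2)

          cancel : ∀ {x y} → q * x ≡ q * y → x ≡ y
          cancel {x} {y} = ℕ.*-cancelˡ-≡ x y q

          odd-power : ∀ k → q ℕ.^ suc (k * 2) ≡ q * (q * q) ℕ.^ k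
          odd-power k = cong (q *_) (trans (cong (q ℕ.^_) (ℕ.*-comm k 2))
              (trans (sym (ℕ.^-*-assoc q 2 k)) (cong (λ x → (q * x) ℕ.^ k) (ℕ.*-identityʳ q))))

        count-full : count {n} full? ≡ q * (q * (q * N))
        count-full = trans (trans (∑-const (vectors.elements {n}) 1) (ℕ.*-identityʳ _))
            (trans (length-vectors n) (cong (q ℕ.^_) n≡))

        balanced-full : Balanced full?
        balanced-full = nondegenerate⇒balanced (suc k) full? full nondeg (trans count-full (odd-power (suc k)))

        count-singular : count singular? ≡ q * (q * N)
        count-singular = cancel (trans (cong (q *_) (count-cong (vectors n) singular? (full? ∩? singular?)
            (tt ,_) proj₂)) (trans balanced-full count-full))

        count-full⊥ : ∀ {u} → u ≢ 0ᵛ → count (full? ∩? u ⊥?) ≡ q * (q * N)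
        count-full⊥ u≢0 = let x , _ , x⊥̸u = nonorthogonal full? nondeg tt u≢0 in cancel (trans (count-∩⊥ full? full {x} tt x⊥̸u) count-full)

        count-singular⊥ : ∀ {u} → u ≢ 0ᵛ → Singular u → count (singular? ∩? u ⊥?) ≡ q * N
        count-singular⊥ {u} u≢0 s = cancel (trans (cong (q *_) (count-cong (vectors n) (singular? ∩? u ⊥?)
            ((full? ∩? u ⊥?) ∩? singular?) (λ (a , c) → (tt , c) , a) (λ ((_ , c) , a) → a , c)))
          (trans (balanced⇒balanced-∩⊥ full? full tt s balanced-full) (count-full⊥ u≢0)))

        count-full⊥⊥ : ∀ {u v} → Independent u v → count ((full? ∩? u ⊥?) ∩? v ⊥?) ≡ q * N
        count-full⊥⊥ {u} ind = let x , x⊥u , x⊥̸v = nonorthogonal-pair ind in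
          cancel (trans (count-∩⊥ (full? ∩? u ⊥?) (∩⊥-subspace full u) (tt , x⊥u) x⊥̸v) (count-full⊥ (independent⇒≢0ˡ ind)))

        -- If the line is totally singular, balance descends from the whole space to u^⊥ and from
        -- there to v^⊥. Otherwise the polar subspace is nondegenerate of odd dimension 2k + 1.
        -- Either way its singular vectors are one q-th of its vectors.
        count-singular⊥⊥ : ∀ {u v} → Independent u v → Conjugate u v → count (((full? ∩? u ⊥?) ∩? v ⊥?) ∩? singular?) ≡ N
        count-singular⊥⊥ {u} {v} ind conj = cancel (trans (balanced (conjugate-dichotomy conj)) (count-full⊥⊥ ind))
          where
          balanced : (b u u ≡ 0# × b u v ≡ 0# × b v v ≡ 0#) ⊎ gram u v ≢ 0# → Balanced ((full? ∩? u ⊥?) ∩? v ⊥?)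
          balanced (inj₁ (uu , uv , vv)) = balanced⇒balanced-∩⊥ (full? ∩? u ⊥?) (∩⊥-subspace full u)
              (tt , trans (b-sym v u) uv) (b≡0⇒singular vv)
            (balanced⇒balanced-∩⊥ full? full tt (b≡0⇒singular uu) balanced-full)
          balanced (inj₂ g≢0) = nondegenerate⇒balanced k ((full? ∩? u ⊥?) ∩? v ⊥?) (∩⊥-subspace (∩⊥-subspace full u) v)
            (∩⊥⊥-nondegenerate full nondeg tt tt g≢0) (trans (count-full⊥⊥ ind) (odd-power k))

    private
      b-lc-lc : ∀ α β x y → b (lc α β x y) (lc α β x y) ≡ α · α · b x x ⊕ (α · β ⊕ α · β) · b x y ⊕ β · β · b y y
      b-lc-lc α β x y = trans (b-lcˡ α β x y _) (trans (cong₂ (λ s t → α · s ⊕ β · t) (b-lcʳ α β x y x) (b-lcʳ α β x y y))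
        (trans (cong (λ z → α · (α · b x x ⊕ β · b x y) ⊕ β · (α · z ⊕ β · b y y)) (b-sym y x))
          (solve 5 (λ α β xx xy yy → α :* (α :* xx :+ β :* xy) :+ β :* (α :* xy :+ β :* yy) := α :* α :* xx :+
              (α :* β :+ α :* β) :* xy :+ β :* β :* yy)
            refl α β (b x x) (b x y) (b y y))))

      b-lc-orthogonal : ∀ {x y} → b x y ≡ 0# → ∀ α β → b (lc α β x y) (lc α β x y) ≡ α · α · b x x ⊕ β · β · b y y
      b-lc-orthogonal {x} {y} xy α β = trans (b-lc-lc α β x y) (trans
          (cong (λ z → α · α · b x x ⊕ (α · β ⊕ α · β) · z ⊕ β · β · b y y) xy)
        (solve 4 (λ α β xx yy → α :* α :* xx :+ (α :* β :+ α :* β) :* :0 :+ β :* β :* yy := α :* α :* xx :+ β :* β :*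
            yy) refl α β (b x x) (b y y)))

    module OnLine (ℓ : Subspace n 2) where

      -- A basis of ℓ such that u + ωv, with ω² = δ, represents a point of the Hermitian variety on
      -- the extension of ℓ and off Σ.
      ConjugatePair : Set
      ConjugatePair = ∃₂ λ u v → u ∈ ⟦ ℓ ⟧ × v ∈ ⟦ ℓ ⟧ × Independent u v × Conjugate u v

      PointOn : Pred (Subspace n 1) 0ℓ
      PointOn P = ⟦ P ⟧ ⊆ ⟦ ℓ ⟧ × ⟦ P ⟧ ⊆ Singular

      pointOn? : Decidable PointOn
      pointOn? P = ∀ᵛ? (_∈? P) (_∈? ℓ) ×-dec ∀ᵛ? (_∈? P) singular?

      pointOn-resp : PointOn Respects (Setoid._≈_ (subspaces n 1))
      pointOn-resp (_ , Q⊆P) (P⊆ℓ , P⊆S) = (λ x∈ → P⊆ℓ (Q⊆P x∈)) , (λ x∈ → P⊆S (Q⊆P x∈))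

      pointOn⁺ : ∀ P {x} → x ∈ ⟦ P ⟧ → x ≢ 0ᵛ → x ∈ ⟦ ℓ ⟧ → Singular x → PointOn P
      pointOn⁺ P x∈P x≢0 x∈ℓ s =
        (λ y∈ → let c , e = proportional P x∈P x≢0 y∈ in subst (_∈ ⟦ ℓ ⟧) (sym e) (line-· ℓ c x∈ℓ)) ,
        (λ y∈ → let c , e = proportional P x∈P x≢0 y∈ in trans (cong form e) (singular-· s c))

      independent-partner : ∀ {x} → x ≢ 0ᵛ → ∃ λ y → y ∈ ⟦ ℓ ⟧ × Independent x y
      independent-partner {x} x≢0 = by-cases (multiple? (gen₁ ℓ)) (multiple? (gen₂ ℓ))
        where
        Multiple : Pred (Vector n) 0ℓ
        Multiple y = ∃ λ t → y ≡ t ·ᵛ x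
        multiple? : Decidable Multiple
        multiple? y = scalars.∃? (λ t → y ≟ᵛ t ·ᵛ x) resp≡
        by-cases : Dec (Multiple (gen₁ ℓ)) → Dec (Multiple (gen₂ ℓ)) → ∃ λ y → y ∈ ⟦ ℓ ⟧ × Independent x y
        by-cases (no n₁) _ = gen₁ ℓ , gen₁∈ ℓ , independent⁺ x≢0 (λ t e → n₁ (t , e))
        by-cases _ (no n₂) = gen₂ ℓ , gen₂∈ ℓ , independent⁺ x≢0 (λ t e → n₂ (t , e))
        by-cases (yes (s , e₁)) (yes (t , e₂)) = contradiction (trans e₁ (trans (cong (_·ᵛ x) s≡0) (0·ᵛ x)))
            (independent⇒≢0ˡ (gens-independent ℓ))
          where
          s≡0 : s ≡ 0#
          s≡0 = neg≡0 (proj₂ (gens-independent ℓ {t} { - s} (trans (cong₂ (lc t (- s)) e₁ e₂)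
            (entrywise (t ⊡ s ⊡ ⌜ x ⌝ ⊞ (- s) ⊡ t ⊡ ⌜ x ⌝) 𝟎 λ i → solve 3
                (λ s t x → t :* (s :* x) :+ :- s :* (t :* x) := :0) refl s t (lookup x i)))))

      module _ {x y} (x∈ : x ∈ ⟦ ℓ ⟧) (y∈ : y ∈ ⟦ ℓ ⟧) (ind : Independent x y) where

        -- On s x + t y the value of b is s² b(x, x), so only the multiples of y are singular.
        tangent : b x y ≡ 0# → b y y ≡ 0# → b x x ≢ 0# → points.count pointOn? ≡ 1
        tangent xy yy xx≢0 = points.count-unique pointOn? (λ {P} {P′} → pointOn-resp {P} {P′}) {Y}
            (pointOn⁺ Y (gen∈ Y) y≢0 y∈ (b≡0⇒singular yy)) (λ {P} → only {P})
          where
          y≢0 = independent⇒≢0ʳ ind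
          Y = mkPoint y y≢0
          radical : ∀ {z} → z ∈ ⟦ ℓ ⟧ → Singular z → ∃ λ t → z ≡ t ·ᵛ y
          radical {z} z∈ sz = let s , t , e = independent⇒spans ℓ x∈ y∈ ind z∈
                                  s²≡0 : s · s · b x x ≡ 0#
                                  s²≡0 = trans (trans (solve 3 (λ s t xx → s :* s :* xx := s :* s :* xx :+ t :* t :*
                                      :0) refl s t (b x x)) (cong (λ c → s · s · b x x ⊕ t · t · c) (sym yy)))
                                    (trans (sym (b-lc-orthogonal xy s t))
                                        (trans (cong (λ z → b z z) (sym e)) (singular⇒b≡0 sz)))
                                  s≡0 : s ≡ 0#
                                  s≡0 = decidable-stable (s ≟ 0#) λ s≢0 → ·≢0 (·≢0 s≢0 s≢0) xx≢0 s²≡0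
                              in t , trans e (trans (cong (λ s → lc s t x y) s≡0)
                                (entrywise (0# ⊡ ⌜ x ⌝ ⊞ t ⊡ ⌜ y ⌝) (t ⊡ ⌜ y ⌝) λ i → solve 3
                                    (λ t x y → :0 :* x :+ t :* y := t :* y) refl t (lookup x i) (lookup y i)))
          only : ∀ {P} → PointOn P → Setoid._≈_ (subspaces n 1) P Y
          only {P} (P⊆ℓ , P⊆S) = P⊆Y , Y⊆P
            where
            t = proj₁ (radical (P⊆ℓ (gen∈ P)) (P⊆S (gen∈ P)))
            gen∈Y : gen P ∈ ⟦ Y ⟧
            gen∈Y = subst (_∈ ⟦ Y ⟧) (sym (proj₂ (radical (P⊆ℓ (gen∈ P)) (P⊆S (gen∈ P))))) (∈-point⁺ Y t)
            P⊆Y : ⟦ P ⟧ ⊆ ⟦ Y ⟧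
            P⊆Y = point-⊆ P Y (gen∈ P) (gen≢0 P) gen∈Y
            Y⊆P : ⟦ Y ⟧ ⊆ ⟦ P ⟧
            Y⊆P = point-⊆ Y P gen∈Y (gen≢0 P) (gen∈ P)

        lc-independent : ∀ {α β γ κ} → (∀ {s t} → s · α ⊕ t · γ ≡ 0# → s · β ⊕ t · κ ≡ 0# → s ≡ 0# × t
            ≡ 0#) → Independent (lc α β x y) (lc γ κ x y)
        lc-independent {α} {β} {γ} {κ} inj {s} {t} e = let p , r = ind (trans (sym (lc-lc s t α β γ κ x y)) e) in inj p r

        -- Solves b(x,x) + s² b(y,y) = δ t² b(y,y); then u = x + s y and v = t y, or
        -- v = x - s y when t = 0.
        orthogonal⇒conjugate : b x y ≡ 0# → b x x ≢ 0# → b y y ≢ 0# → ConjugatePair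
        orthogonal⇒conjugate xy xx≢0 yy≢0 = by-cases (t ≟ 0#)
          where
          a = b x x
          c = b y y
          δ≢0 : δ ≢ 0#
          δ≢0 e = δ-nonsquare 0# (trans (zeroˡ _) (sym e))
          root = diagonal-root {c} { - (δ · c)} yy≢0 (λ e → ·≢0 δ≢0 yy≢0 (neg≡0 e)) a
          s = proj₁ root
          t = proj₁ (proj₂ root)
          eq : c · s · s ⊕ - (δ · c) · t · t ⊕ a ≡ 0#
          eq = proj₂ (proj₂ root)
          u = lc 1# s x y
          uu : b u u ≡ δ · c · t · t
          uu = trans (b-lc-orthogonal xy 1# s) (trans (solve 5 (λ a c s t d → :1 :* :1 :* a :+ s :* s :* c :=
              (c :* s :* s :+ :- (d :* c) :* t :* t :+ a) :+ d :* c :* t :* t) refl a c s t δ)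
            (trans (cong (_⊕ δ · c · t · t) eq) (+-identityˡ _)))
          by-cases : Dec (t ≡ 0#) → ConjugatePair
          by-cases (no t≢0) = u , lc 0# t x y , line-lc ℓ 1# s x∈ y∈ , line-lc ℓ 0# t x∈ y∈ ,
            lc-independent (λ {α} {β} p r →
              let α≡0 = trans (solve 2 (λ α β → α := α :* :1 :+ β :* :0) refl α β) p
                  βt≡0 : t · β ≡ 0#
                  βt≡0 = trans (solve 3 (λ s β t → t :* β := :0 :* s :+ β :* t) refl s β t)
                      (trans (cong (λ α → α · s ⊕ β · t) (sym α≡0)) r)
              in α≡0 , ·≡0 t≢0 βt≡0) ,
            trans uu (trans (solve 4 (λ a c t d → d :* c :* t :* t := d :*
                (:0 :* :0 :* a :+ t :* t :* c)) refl a c t δ) (cong (δ ·_) (sym (b-lc-orthogonal xy 0# t))))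
          -- Now b(x, x) + s² b(y, y) = 0, so x + s y and x - s y are both singular and the
          -- condition reads 0 = δ · 0. They are independent because s ≠ 0 and 2 ≠ 0.
          by-cases (yes t≡0) = u , v , line-lc ℓ 1# s x∈ y∈ , line-lc ℓ 1#
              (- s) x∈ y∈ , lc-independent inj , trans uu0 (trans (sym (zeroʳ δ)) (cong (δ ·_) (sym vv0)))
            where
            v = lc 1# (- s) x y
            uu0 : b u u ≡ 0#
            uu0 = trans uu (trans (cong (λ t → δ · c · t · t) t≡0) (zeroʳ _))
            vv0 : b v v ≡ 0#
            vv0 = trans (b-lc-orthogonal xy 1# (- s)) (trans (solve 3
                (λ a c s → :1 :* :1 :* a :+ :- s :* :- s :* c := :1 :* :1 :* a :+ s :* s :* c) refl a c s)
              (trans (sym (b-lc-orthogonal xy 1# s)) uu0))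
            s≢0 : s ≢ 0#
            s≢0 s≡0 = xx≢0 (trans (trans (solve 2 (λ a c → a := :1 :* :1 :* a :+ :0 :* :0 :* c) refl a c)
                (cong (λ s → 1# · 1# · a ⊕ s · s · c) (sym s≡0))) (trans (sym (b-lc-orthogonal xy 1# s)) uu0))
            inj : ∀ {α β} → α · 1# ⊕ β · 1# ≡ 0# → α · s ⊕ β · - s ≡ 0# → α ≡ 0# × β ≡ 0#
            inj {α} {β} p r = α≡0 , trans (solve 2 (λ α β → β := (α :* :1 :+ β :* :1) :- α) refl α β)
                (trans (cong₂ _-_ p α≡0) (-‿inverseʳ 0#))
              where
              α≡0 : α ≡ 0#
              α≡0 = ·≡0 2≢0 (·≡0 s≢0 (trans (solve 3 (λ α β s → s :* ((:1 :+ :1) :* α) := s :* (α :* :1 :+ β :* :1) :+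
                  (α :* s :+ β :* :- s)) refl α β s)
                (trans (cong₂ (λ p r → s · p ⊕ r) p r) (trans (+-identityʳ _) (zeroʳ s)))))

      -- A totally singular line satisfies the condition in every basis. Any other line has an
      -- orthogonal basis whose first vector is nonsingular; were the second one singular, the line
      -- would be tangent with exactly one singular point.
      conjugate-pair : points.count pointOn? ≢ 1 → ConjugatePair
      conjugate-pair ≢1 = by-cases (∃ᵛ? ((_∈? ℓ) ∩? ∁? singular?))
        where
        nonsingular : ∀ {x} → x ∈ ⟦ ℓ ⟧ → ¬ Singular x → ConjugatePair
        nonsingular {x} x∈ nx = at-y (b y y ≟ 0#)
          where
          xx≢0 : b x x ≢ 0#
          xx≢0 e = nx (b≡0⇒singular e)
          x≢0 : x ≢ 0ᵛ
          x≢0 e = xx≢0 (trans (cong (λ z → b z x) e) (b-0ˡ x))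
          partner = independent-partner x≢0
          y₀ = proj₁ partner
          -- Gram-Schmidt, multiplied by b(x, x) to avoid a division.
          y = lc (- b x y₀) (b x x) x y₀
          y∈ : y ∈ ⟦ ℓ ⟧
          y∈ = line-lc ℓ _ _ x∈ (proj₁ (proj₂ partner))
          xy : b x y ≡ 0#
          xy = trans (b-lcʳ _ _ x y₀ x) (solve 2 (λ s t → :- s :* t :+ t :* s := :0) refl (b x y₀) (b x x))
          ind : Independent x y
          ind = independent⁺ x≢0 λ t e → xx≢0 (proj₂ (proj₂ (proj₂ partner)
              (trans (entrywise ((- b x y₀ - t) ⊡ ⌜ x ⌝ ⊞ b x x ⊡ ⌜ y₀ ⌝)
              (((- b x y₀) ⊡ ⌜ x ⌝ ⊞ b x x ⊡ ⌜ y₀ ⌝) ⊞ (- 1#) ⊡ t ⊡ ⌜ x ⌝)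
              (λ i → solve 5 (λ s t a x y → (s :- t) :* x :+ a :* y := (s :* x :+ a :* y) :+ :- :1 :* (t :* x)) refl
                  (- b x y₀) t (b x x) (lookup x i) (lookup y₀ i)))
            (trans (cong (_+ᵛ (- 1#) ·ᵛ t ·ᵛ x) e) (entrywise (t ⊡ ⌜ x ⌝ ⊞ (- 1#) ⊡ t ⊡ ⌜ x ⌝) 𝟎 λ i → solve 2
                (λ t x → t :* x :+ :- :1 :* (t :* x) := :0) refl t (lookup x i))))))
          at-y : Dec (b y y ≡ 0#) → ConjugatePair
          at-y (yes yy) = contradiction (tangent x∈ y∈ ind xy yy xx≢0) ≢1
          at-y (no yy≢0) = orthogonal⇒conjugate x∈ y∈ ind xy xx≢0 yy≢0
        by-cases : Dec (∃ λ x → x ∈ ⟦ ℓ ⟧ × ¬ Singular x) → ConjugatePair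
        by-cases (yes (x , x∈ , nx)) = nonsingular x∈ nx
        by-cases (no ¬∃) = gen₁ ℓ , gen₂ ℓ , gen₁∈ ℓ , gen₂∈ ℓ , gens-independent ℓ ,
          trans (b≡0 (gen₁∈ ℓ) (gen₁∈ ℓ)) (trans (sym (zeroʳ δ)) (cong (δ ·_) (sym (b≡0 (gen₂∈ ℓ) (gen₂∈ ℓ)))))
          where
          b≡0 : ∀ {x y} → x ∈ ⟦ ℓ ⟧ → y ∈ ⟦ ℓ ⟧ → b x y ≡ 0#
          b≡0 = totally-singular⇒b≡0 (line-subspace ℓ) λ {x} x∈ → decidable-stable (singular? x) λ nx → ¬∃ (x , x∈ , nx)

      module _ {u v} (u∈ : u ∈ ⟦ ℓ ⟧) (v∈ : v ∈ ⟦ ℓ ⟧) (ind : Independent u v) (conj : Conjugate u v) where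

        private
          degenerate : b u u ≡ 0# → b u v ≡ 0# → b v v ≡ 0# → points.count pointOn? ≡ q + 1
          degenerate uu uv vv = number (ℕ.pred q) (sym (ℕ.suc-pred q)) (points.count pointOn?)
            (trans (cong (_+ points.count pointOn?) (count-cong (vectors n) (nonzero? ∩? (_∈? ℓ))
                (nonzero? ∩? ((_∈? ℓ) ∩? singular?)) (λ (a , x∈) → a , x∈ , singular x∈) (λ (a , x∈ , _) → a , x∈)))
              (count-points pointOn? ((_∈? ℓ) ∩? singular?) (λ x∈ _ (P⊆ℓ , P⊆S) → P⊆ℓ x∈ , P⊆S x∈)
                  (λ {P} x∈ x≢0 (x∈ℓ , s) → pointOn⁺ P x∈ x≢0 x∈ℓ s)))
            (trans (count-nonzero (_∈? ℓ) (IsSubspace.0∈ (line-subspace ℓ))) (count-line ℓ))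
            where
            singular : ∀ {x} → x ∈ ⟦ ℓ ⟧ → Singular x
            singular x∈ = let s , t , e = independent⇒spans ℓ u∈ v∈ ind x∈ in b≡0⇒singular (trans (cong (λ z → b z z) e) (trans (b-lc-orthogonal uv s t)
              (trans (cong₂ (λ c d → s · s · c ⊕ t · t · d) uu vv)
                  (solve 2 (λ s t → s :* s :* :0 :+ t :* t :* :0 := :0) refl s t))))
            -- With k = q - 1 the two equations say k N = V = k (q + 1), and k > 0 since q ≥ 2.
            number : ∀ k → q ≡ suc k → ∀ N {V} → V + N ≡ N * q → V + 1 ≡ q * q → N ≡ q + 1
            number k refl N {V} p r = ℕ.*-cancelˡ-≡ N (suc k + 1) k {{ℕ.>-nonZero (ℕ.≤-pred 2≤order)}}
              (trans (ℕ.+-cancelʳ-≡ N (k * N) V (trans (+-*-Solver.solve 2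
                  (λ k N → k :*ℕ N :+ℕ N :=ℕ N :*ℕ (conℕ 1 :+ℕ k)) refl k N) (sym p)))
                (ℕ.+-cancelʳ-≡ 1 V (k * (suc k + 1)) (trans r (+-*-Solver.solve 1
                    (λ k → (conℕ 1 :+ℕ k) :*ℕ (conℕ 1 :+ℕ k) :=ℕ k :*ℕ (conℕ 1 :+ℕ k :+ℕ conℕ 1) :+ℕ conℕ 1) refl k))))
              where open +-*-Solver using () renaming (_:*_ to _:*ℕ_; _:+_ to _:+ℕ_; _:=_ to _:=ℕ_; con to conℕ)

          module _ (g≢0 : gram u v ≢ 0#) where
            nondegenerate-on-line : NondegenerateOn ⟦ ℓ ⟧
            nondegenerate-on-line {x} x∈ x⊥ =
              let s , t , e = independent⇒spans ℓ u∈ v∈ ind x∈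
                  xu : s · b u u ⊕ t · b u v ≡ 0#
                  xu = trans (cong (λ c → s · b u u ⊕ t · c) (b-sym u v))
                      (trans (sym (b-lcˡ s t u v u)) (trans (cong (λ z → b z u) (sym e)) (x⊥ u∈)))
                  xv : s · b u v ⊕ t · b v v ≡ 0#
                  xv = trans (sym (b-lcˡ s t u v v)) (trans (cong (λ z → b z v) (sym e)) (x⊥ v∈))
                  s≡0 : s ≡ 0#
                  s≡0 = ·≡0 g≢0 (trans (solve 5 (λ s t uu uv vv → (uu :* vv :- uv :* uv) :* s := vv :*
                      (s :* uu :+ t :* uv) :- uv :* (s :* uv :+ t :* vv)) refl s t (b u u) (b u v) (b v v))
                    (trans (cong₂ (λ p r → b v v · p - b u v · r) xu xv)
                        (solve 2 (λ a c → a :* :0 :- c :* :0 := :0) refl (b v v) (b u v))))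
                  t≡0 : t ≡ 0#
                  t≡0 = ·≡0 g≢0 (trans (solve 5 (λ s t uu uv vv → (uu :* vv :- uv :* uv) :* t := uu :*
                      (s :* uv :+ t :* vv) :- uv :* (s :* uu :+ t :* uv)) refl s t (b u u) (b u v) (b v v))
                    (trans (cong₂ (λ p r → b u u · r - b u v · p) xu xv)
                        (solve 2 (λ a c → a :* :0 :- c :* :0 := :0) refl (b u u) (b u v))))
              in trans e (trans (cong₂ (λ s t → lc s t u v) s≡0 t≡0) (lc-00 u v))

            -- A y on ℓ not orthogonal to w can be shifted by a multiple of w to a singular w′. In
            -- the basis w, w′ the value of b on s w + t w′ is 2 s t b(w, w′), which vanishes only
            -- for s = 0 or t = 0.
            secant : ∀ {w} → w ∈ ⟦ ℓ ⟧ → w ≢ 0ᵛ → Singular w → points.count pointOn? ≡ 2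
            secant {w} w∈ w≢0 sw = count-pair points-finite pointOn? (λ {P} {P′} → pointOn-resp {P} {P′}) {W} {W′}
                (pointOn⁺ W (gen∈ W) w≢0 w∈ sw) (pointOn⁺ W′ (gen∈ W′) w′≢0 w′∈ sw′) distinct (λ {P} → only {P})
              where
              partner = nonorthogonal (_∈? ℓ) nondegenerate-on-line w∈ w≢0
              y = proj₁ partner
              yw≢0 = proj₂ (proj₂ partner)
              root = affine-root {form y} {b y w} yw≢0
              t = proj₁ root
              w′ = y +ᵛ t ·ᵛ w
              w′∈ : w′ ∈ ⟦ ℓ ⟧
              w′∈ = line-+ ℓ (proj₁ (proj₂ partner)) (line-· ℓ t w∈)
              sw′ : Singular w′
              sw′ = trans (form-shift y t w) (trans (cong (λ c → form y ⊕ t · t · c ⊕ t · b y w) sw)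
                (trans (solve 3 (λ f t c → f :+ t :* t :* :0 :+ t :* c := f :+ t :* c) refl (form y) t (b y w))
                    (proj₁ (proj₂ root))))
              w′w≢0 : b w′ w ≢ 0#
              w′w≢0 e = yw≢0 (trans (trans (solve 2 (λ c t → c := c :+ t :* :0) refl (b y w) t)
                  (cong (λ c → b y w ⊕ t · c) (sym (singular⇒b≡0 sw)))) (trans (sym (b-linearˡ w y t w)) e))
              w′≢0 : w′ ≢ 0ᵛ
              w′≢0 e = w′w≢0 (trans (cong (λ z → b z w) e) (b-0ˡ w))
              W = mkPoint w w≢0
              W′ = mkPoint w′ w′≢0
              independent : Independent w w′
              independent = independent⁺ w≢0 λ t e → w′w≢0 (trans (cong (λ z → b z w) e)
                  (trans (polar-·ˡ t w w) (trans (cong (t ·_) (singular⇒b≡0 sw)) (zeroʳ t))))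
              distinct : ¬ (Setoid._≈_ (subspaces n 1) W W′)
              distinct (_ , W′⊆W) = let c , e = ∈-point⁻ W (W′⊆W (gen∈ W′)) in
                w′w≢0 (trans (cong (λ z → b z w) e) (trans (polar-·ˡ c w w)
                    (trans (cong (c ·_) (singular⇒b≡0 sw)) (zeroʳ c))))
              isotropic-lines : ∀ {z} → z ∈ ⟦ ℓ ⟧ → Singular z → z ≢ 0ᵛ → z ∈ ⟦ W ⟧ ⊎ z ∈ ⟦ W′ ⟧
              isotropic-lines {z} z∈ sz z≢0 = by-cases (s ≟ 0#)
                where
                spanning = independent⇒spans ℓ w∈ w′∈ independent z∈
                s = proj₁ spanning
                t′ = proj₁ (proj₂ spanning)
                e = proj₂ (proj₂ spanning)
                product : (1# ⊕ 1#) · (s · (t′ · b w′ w)) ≡ 0#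
                product = trans (trans (solve 3 (λ s t c → (:1 :+ :1) :* (s :* (t :* c)) := s :* s :* :0 :+
                    (s :* t :+ s :* t) :* c :+ t :* t :* :0) refl s t′ (b w′ w))
                    (trans (cong (λ c → s · s · 0# ⊕ (s · t′ ⊕ s · t′) · c ⊕ t′ · t′ · 0#) (b-sym w′ w))
                      (cong₂ (λ c d → s · s · c ⊕ (s · t′ ⊕ s · t′) · b w w′ ⊕ t′ · t′ · d) (sym (singular⇒b≡0 sw))
                          (sym (singular⇒b≡0 sw′)))))
                  (trans (sym (b-lc-lc s t′ w w′)) (trans (cong (λ z → b z z) (sym e)) (singular⇒b≡0 sz)))
                by-cases : Dec (s ≡ 0#) → z ∈ ⟦ W ⟧ ⊎ z ∈ ⟦ W′ ⟧
                by-cases (yes s≡0) = inj₂ (subst (_∈ ⟦ W′ ⟧) (sym (trans e (trans (cong (λ s → lc s t′ w w′) s≡0)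
                  (entrywise (0# ⊡ ⌜ w ⌝ ⊞ t′ ⊡ ⌜ w′ ⌝) (t′ ⊡ ⌜ w′ ⌝) λ i → solve 3
                      (λ t x y → :0 :* x :+ t :* y := t :* y) refl t′ (lookup w i) (lookup w′ i))))) (∈-point⁺ W′ t′))
                by-cases (no s≢0) = inj₁ (subst (_∈ ⟦ W ⟧) (sym (trans e (trans (cong (λ t → lc s t w w′) t≡0)
                  (entrywise (s ⊡ ⌜ w ⌝ ⊞ 0# ⊡ ⌜ w′ ⌝) (s ⊡ ⌜ w ⌝) λ i → solve 3
                      (λ s x y → s :* x :+ :0 :* y := s :* x) refl s (lookup w i) (lookup w′ i))))) (∈-point⁺ W s))
                  where
                  t≡0 : t′ ≡ 0#
                  t≡0 = ·≡0 w′w≢0 (trans (*-comm _ _) (·≡0 s≢0 (·≡0 2≢0 product)))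
              only : ∀ {P} → PointOn P → Setoid._≈_ (subspaces n 1) P W ⊎ Setoid._≈_ (subspaces n 1) P W′
              only {P} (P⊆ℓ , P⊆S) = [ (λ z∈ → inj₁ (same W z∈)) , (λ z∈ → inj₂ (same W′ z∈)) ]′
                  (isotropic-lines (P⊆ℓ (gen∈ P)) (P⊆S (gen∈ P)) (gen≢0 P))
                where
                same : ∀ R → gen P ∈ ⟦ R ⟧ → Setoid._≈_ (subspaces n 1) P R
                same R z∈ = (λ {x} → point-⊆ P R (gen∈ P) (gen≢0 P) z∈ {x}) , (λ {x} → point-⊆ R P z∈ (gen≢0 P) (gen∈ P) {x})

        -- The dichotomy leaves a totally singular line or a nondegenerate one; the latter has
        -- exactly two singular points as soon as it has any.
        conjugate-count : points.count pointOn? ≡ 0 ⊎ points.count pointOn? ≡ 2 ⊎ points.count pointOn? ≡ q + 1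
        conjugate-count = [ (λ (uu , uv , vv) → inj₂ (inj₂ (degenerate uu uv vv))) ,
            (λ g≢0 → by-cases g≢0 (∃ᵛ? (nonzero? ∩? ((_∈? ℓ) ∩? singular?)))) ]′ (conjugate-dichotomy conj)
          where
          by-cases : gram u v ≢ 0# → Dec (∃ λ w → w ≢ 0ᵛ × w ∈ ⟦ ℓ ⟧ × Singular w) → points.count pointOn?
              ≡ 0 ⊎ points.count pointOn? ≡ 2 ⊎ points.count pointOn? ≡ q + 1
          by-cases g≢0 (yes (w , w≢0 , w∈ , sw)) = inj₂ (inj₁ (secant g≢0 w∈ w≢0 sw))
          by-cases g≢0 (no ¬∃) = inj₁ (trans (∑-cong points.elements
              (λ P → ⟨⟩-no (pointOn? P) (λ (P⊆ℓ , P⊆S) → ¬∃ (gen P , gen≢0 P , P⊆ℓ (gen∈ P) , P⊆S (gen∈ P)))))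
              (∑-zero (points.elements {n})))

-- Arithmetic of the counts

module Arithmetic where
  open import Data.Integer.Base using (+_; -[1+_])
  open import Data.Nat.Base using (_^_; NonZero)
  open import Data.Nat.Properties
  open +-*-Solver

  -- The geometric series, with κ in the place of the difference between the base and 1.
  θ-geometric : ∀ n κ → κ * θ (+ n) (suc κ) + 1 ≡ suc κ ^ suc n
  θ-geometric zero    κ = solve 1 (λ κ → κ :* con 1 :+ con 1 := (con 1 :+ κ) :* con 1) refl κ
  θ-geometric (suc n) κ = begin
    κ * (Q + θ (+ n) (suc κ)) + 1  ≡⟨ solve 3 (λ κ Q t → κ :* (Q :+ t) :+ con 1 := κ :* Q :+
        (κ :* t :+ con 1)) refl κ Q (θ (+ n) (suc κ)) ⟩
    κ * Q + (κ * θ (+ n) (suc κ) + 1)  ≡⟨ cong (λ x → κ * Q + x) (θ-geometric n κ) ⟩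
    κ * Q + Q                          ≡⟨ +-comm (κ * Q) Q ⟩
    suc κ * Q                          ∎
    where
    open ≡-Reasoning
    Q = suc κ ^ suc n

  ⊖5 : ∀ j → (5 + j) ℤ.⊖ 5 ≡ + j
  ⊖5 j = trans (ℤ.⊖-≥ {5 + j} {5} (m≤m+n 5 j)) refl

  θ⊖5 : ∀ j k → k * θ ((4 + j) ℤ.⊖ 5) (suc k) + 1 ≡ suc k ^ j
  -- The index is -1 here, and the convention θ = 0 agrees with the geometric formula.
  θ⊖5 zero    k = cong (_+ 1) (*-zeroʳ k)
  θ⊖5 (suc j) k = trans (cong (λ i → k * θ i (suc k) + 1) (⊖5 j)) (θ-geometric j k)

  square-suc : ∀ k → suc k * suc k ≡ suc (k * (2 + k))
  square-suc k = solve 1 (λ k → (con 1 :+ k) :* (con 1 :+ k) := con 1 :+ k :* (con 2 :+ k)) refl k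

  -- The quotient is θ_{i-1,q²}: since (q - 1)(q + 1) = q² - 1, both sides multiplied by q - 1 equal
  -- q^(2i) - 1. For i = 0 the quotient is again the θ of index -1.
  θ⊖5-divisible : ∀ i k .{{_ : NonZero k}} → ∃ λ t → θ ((4 + i * 2) ℤ.⊖ 5) (suc k) ≡ t * (2 + k)
  θ⊖5-divisible i k = t i , *-cancelˡ-≡ _ _ k (+-cancelʳ-≡ 1 _ _ (begin
    k * θ ((4 + i * 2) ℤ.⊖ 5) (suc k) + 1   ≡⟨ θ⊖5 (i * 2) k ⟩
    suc k ^ (i * 2)  ≡⟨ trans (cong (suc k ^_) (*-comm i 2)) (sym (^-*-assoc (suc k) 2 i)) ⟩
    (suc k ^ 2) ^ i  ≡⟨ cong (_^ i) (trans (cong (suc k *_) (*-identityʳ (suc k))) (square-suc k)) ⟩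
    suc (k * (2 + k)) ^ i                   ≡⟨ power i ⟨
    k * (2 + k) * t i + 1  ≡⟨ cong (_+ 1) (solve 2 (λ k t → k :* (con 2 :+ k) :* t := k :* (t :* (con 2 :+ k))) refl k
        (t i)) ⟩
    k * (t i * (2 + k)) + 1                 ∎))
    where
    open ≡-Reasoning
    t : ℕ → ℕ
    t zero    = 0
    t (suc i) = θ (+ i) (suc (k * (2 + k)))
    power : ∀ i → k * (2 + k) * t i + 1 ≡ suc (k * (2 + k)) ^ i
    power zero    = cong (_+ 1) (*-zeroʳ (k * (2 + k)))
    power (suc i) = θ-geometric i (k * (2 + k))

  dualNumber-exact : ∀ i k m .{{_ : NonZero k}} → m * θ ((4 + i * 2) ℤ.⊖ 5) (suc k) / (2 + k) * (2 + k) ≡ m * θ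
      ((4 + i * 2) ℤ.⊖ 5) (suc k)
  dualNumber-exact i k m with θ⊖5-divisible i k
  ... | t , e = trans (cong (λ x → m * x / (2 + k) * (2 + k)) e)
      (trans (cong (λ x → x / (2 + k) * (2 + k)) (sym (*-assoc m t (2 + k))))
    (trans (cong (_* (2 + k)) (m*n/n≡m (m * t) (2 + k))) (trans (*-assoc m t (2 + k)) (cong (m *_) (sym e)))))

  -- In the counts below q = 1 + k.  T and D are the numbers of nonzero vectors of
  -- P^⊥ on points of X and on singular points of Σ, N and R the numbers of these
  -- points, s the number of nonzero singular vectors of Σ in P^⊥, and s₀ of all
  -- nonzero singular vectors; L is the size of the cover, and n₂ the number of its
  -- lines in P^⊥.
  module Counts (k m : ℕ) .{{k≢0 : NonZero k}} {T N D R L M n₂ s s₀ : ℕ}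
    (eN  : T + N ≡ N * (suc k * suc k))
    (eA  : T + m * D + L ≡ M + D)
    (eB  : M + suc k * suc k * n₂ ≡ suc k * suc k * L + suc k * suc k * (suc k * suc k) * n₂)
    (eC₁ : D + R ≡ R * (suc k * suc k))
    (eC₂ : s + R ≡ R * suc k)
    (eE  : m * s₀ + L ≡ L * (suc k * suc k)) where

    private
      q κ : ℕ
      q = suc k
      κ = k * (2 + k)

      instance
        κ≢0 : NonZero κ
        κ≢0 = m*n≢0 k (2 + k)

      open ≡-Reasoning

    L≡ : m * s₀ ≡ κ * L
    L≡ = +-cancelʳ-≡ L _ _ (trans eE (solve 2 (λ k L → L :* ((con 1 :+ k) :* (con 1 :+ k)) := k :*
        (con 2 :+ k) :* L :+ L) refl k L))

    -- T, D, M and L are eliminated through T = (q² - 1) N, D = (q + 1) s and (q² - 1) L = m s₀.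
    -- What remains is affine in n₂, with N - q² n₂ fixed by m, q, s and s₀.
    balance : κ * N + m * ((2 + k) * s) ≡ m * s₀ + (2 + k) * s + q * q * (κ * n₂)
    balance = +-cancelʳ-≡ L _ _ (begin
      κ * N + m * ((2 + k) * s) + L  ≡⟨ cong₂ (λ x y → x + m * y + L) (sym T≡) (sym D≡) ⟩
      T + m * D + L                                              ≡⟨ eA ⟩
      M + D                                                      ≡⟨ cong₂ _+_ M≡ D≡ ⟩
      q * q * L + q * q * (κ * n₂) + (2 + k) * s  ≡⟨ solve 4 (λ k L n s → (con 1 :+ k) :*
          (con 1 :+ k) :* L :+ n :+ s := k :* (con 2 :+ k) :* L :+ s :+ n :+ L) refl k L (q * q * (κ * n₂)) ((2 + k) * s) ⟩
      κ * L + (2 + k) * s + q * q * (κ * n₂) + L  ≡⟨ cong (λ x → x + (2 + k) * s + q * q * (κ * n₂) + L) (sym L≡) ⟩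
      m * s₀ + (2 + k) * s + q * q * (κ * n₂) + L                ∎)
      where
      T≡ : T ≡ κ * N
      T≡ = +-cancelʳ-≡ N _ _ (trans eN (solve 2 (λ k N → N :* ((con 1 :+ k) :* (con 1 :+ k)) := k :*
          (con 2 :+ k) :* N :+ N) refl k N))
      s≡ : s ≡ k * R
      s≡ = +-cancelʳ-≡ R _ _ (trans eC₂ (solve 2 (λ k R → R :* (con 1 :+ k) := k :* R :+ R) refl k R))
      D≡ : D ≡ (2 + k) * s
      D≡ = +-cancelʳ-≡ R _ _ (trans eC₁ (trans (solve 2 (λ k R → R :* ((con 1 :+ k) :* (con 1 :+ k)) :=
          (con 2 :+ k) :* (k :* R) :+ R) refl k R) (cong (λ x → (2 + k) * x + R) (sym s≡))))
      M≡ : M ≡ q * q * L + q * q * (κ * n₂)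
      M≡ = +-cancelʳ-≡ (q * q * n₂) _ _ (trans eB (solve 3 (λ k L n →
        let Q = (con 1 :+ k) :* (con 1 :+ k) in Q :* L :+ Q :* Q :* n := Q :* L :+ Q :* (k :* (con 2 :+ k) :* n) :+ Q :* n) refl k L n₂))

    -- To be read with a = q^(r-4) and θ = θ_{(r-4)/2,q²}, so that s₀ + 1 = q^r is the number of all
    -- singular vectors of Σ.
    module _ {θ a : ℕ} (eθ : κ * θ + 1 ≡ q * q * a) (e₀ : s₀ + 1 ≡ q * q * (q * q * a)) where
      private
        i = m * (q * k) + q + 1

        s₀≡ : s₀ ≡ κ * (q * q * θ + 1)
        s₀≡ = +-cancelʳ-≡ 1 _ _ (trans e₀ (trans (cong (q * q *_) (sym eθ)) (solve 2 (λ k t →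
          let κ = k :* (con 2 :+ k) ; Q = (con 1 :+ k) :* (con 1 :+ k) in Q :* (κ :* t :+ con 1) := κ :* (Q :* t :+ con 1) :+ con 1) refl k θ)))

      -- There are q^(r-2) singular vectors in the polar subspace, that is s = (q² - 1) θ, and
      -- `balance` becomes divisible by q² - 1. The dual number d enters through q² d + m = m θ,
      -- which completes the constant term to i θ.
      points-off-Σ : ∀ {ϑ d} → s + 1 ≡ q * q * a → k * ϑ + 1 ≡ a → d * (2 + k) ≡ m * ϑ → N + q * q * d ≡ i * θ + q * q * n₂
      points-off-Σ {ϑ} {d} eS eϑ ed = +-cancelʳ-≡ (m + m * ((2 + k) * θ)) _ _ (begin
        N + q * q * d + (m + m * ((2 + k) * θ))  ≡⟨ solve 4 (λ N d m t → N :+ d :+ (m :+ t) := (N :+ t) :+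
            (d :+ m)) refl N (q * q * d) m (m * ((2 + k) * θ)) ⟩
        (N + m * ((2 + k) * θ)) + (q * q * d + m)  ≡⟨ cong₂ _+_ reduced dual ⟩
        m * (q * q * θ + 1) + (2 + k) * θ + q * q * n₂ + m * θ
          ≡⟨ solve 4 (λ k m t n → let q = con 1 :+ k in
               m :* (q :* q :* t :+ con 1) :+ (con 2 :+ k) :* t :+ n :+ m :* t :=
                   (m :* (q :* k) :+ q :+ con 1) :* t :+ n :+ (m :+ m :* ((con 2 :+ k) :* t))) refl k m θ (q * q * n₂) ⟩
        i * θ + q * q * n₂ + (m + m * ((2 + k) * θ)) ∎)
        where
        s≡ : s ≡ κ * θ
        s≡ = +-cancelʳ-≡ 1 _ _ (trans eS (sym eθ))
        reduced : N + m * ((2 + k) * θ) ≡ m * (q * q * θ + 1) + (2 + k) * θ + q * q * n₂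
        reduced = *-cancelˡ-≡ _ _ κ (begin
          κ * (N + m * ((2 + k) * θ))  ≡⟨ solve 5 (λ κ N m c t → κ :* (N :+ m :* (c :* t)) := κ :* N :+ m :*
              (c :* (κ :* t))) refl κ N m (2 + k) θ ⟩
          κ * N + m * ((2 + k) * (κ * θ))  ≡⟨ cong (λ x → κ * N + m * ((2 + k) * x)) s≡ ⟨
          κ * N + m * ((2 + k) * s)                                               ≡⟨ balance ⟩
          m * s₀ + (2 + k) * s + q * q * (κ * n₂)  ≡⟨ cong₂ (λ x y → m * x + (2 + k) * y + q * q * (κ * n₂)) s₀≡ s≡ ⟩
          m * (κ * (q * q * θ + 1)) + (2 + k) * (κ * θ) + q * q * (κ * n₂)  ≡⟨ solve 7
              (λ κ m Q t x c n → m :* (κ :* x) :+ c :* (κ :* t) :+ Q :* (κ :* n) := κ :* (m :* x :+ c :* t :+ Q :* n))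
                                                                                       refl κ m (q * q) θ (q * q * θ +
                                                                                           1) (2 + k) n₂ ⟩
          κ * (m * (q * q * θ + 1) + (2 + k) * θ + q * q * n₂)                    ∎)
        -- Two expressions for θ_{r-3,q}: its two lowest terms split off from q² θ_{r-5,q}, or its
        -- terms grouped in pairs into (q + 1) θ_{(r-4)/2,q²}.
        ratio : q * q * ϑ + (2 + k) ≡ (2 + k) * θ
        ratio = *-cancelˡ-≡ _ _ k (+-cancelʳ-≡ 1 _ _ (begin
          k * (q * q * ϑ + (2 + k)) + 1  ≡⟨ solve 2 (λ k t → let Q = (con 1 :+ k) :* (con 1 :+ k) in k :* (Q :* t :+ (con 2 :+ k)) :+ con 1 := Q :* (k :* t :+ con 1)) refl k ϑ ⟩
          q * q * (k * ϑ + 1)                ≡⟨ cong (q * q *_) eϑ ⟩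
          q * q * a                          ≡⟨ eθ ⟨
          κ * θ + 1                          ≡⟨ cong (_+ 1) (*-assoc k (2 + k) θ) ⟩
          k * ((2 + k) * θ) + 1              ∎))
        dual : q * q * d + m ≡ m * θ
        dual = *-cancelˡ-≡ _ _ (2 + k) (begin
          (2 + k) * (q * q * d + m)  ≡⟨ solve 4 (λ c Q d m → c :* (Q :* d :+ m) := Q :* (d :* c) :+ m :* c) refl
              (2 + k) (q * q) d m ⟩
          q * q * (d * (2 + k)) + m * (2 + k)  ≡⟨ cong (λ x → q * q * x + m * (2 + k)) ed ⟩
          q * q * (m * ϑ) + m * (2 + k)  ≡⟨ solve 4 (λ Q m t c → Q :* (m :* t) :+ m :* c := m :* (Q :* t :+ c)) refl
              (q * q) m ϑ (2 + k) ⟩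
          m * (q * q * ϑ + (2 + k))          ≡⟨ cong (m *_) ratio ⟩
          m * ((2 + k) * θ)  ≡⟨ solve 3 (λ m c t → m :* (c :* t) := c :* (m :* t)) refl m (2 + k) θ ⟩
          (2 + k) * (m * θ)                  ∎)

      -- The last hypothesis counts flags of a vector of P^⊥ on a line of the cover. It fixes n₂ by
      -- m σ = L + q n₂, after which `balance` leaves no freedom for N.
      points-on-Σ : s + 1 ≡ q * (q * q * a) → m * s + L + q * n₂ ≡ q * L + q * q * n₂ → N ≡ i * θ + q * q * a
      points-on-Σ eS eF = +-cancelʳ-≡ (m * σ + q * L) _ _ (begin
        N + (m * σ + q * L)                      ≡⟨ +-assoc N (m * σ) (q * L) ⟨
        N + m * σ + q * L                        ≡⟨ cong (_+ q * L) reduced ⟩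
        L + σ + q * q * n₂ + q * L  ≡⟨ solve 4 (λ L s q n → L :+ s :+ q :* q :* n :+ q :* L := L :+ s :+ q :*
            (L :+ q :* n)) refl L σ q n₂ ⟩
        L + σ + q * (L + q * n₂)                 ≡⟨ cong (λ x → L + σ + q * x) (sym mσ≡) ⟩
        L + σ + q * (m * σ)                      ≡⟨ cong (λ x → x + σ + q * (m * σ)) L≡′ ⟩
        m * (q * q * θ + 1) + σ + q * (m * σ)
          ≡⟨ solve 3 (λ k m t → let q = con 1 :+ k ; σ = q :* ((con 2 :+ k) :* t) :+ con 1 in
               m :* (q :* q :* t :+ con 1) :+ σ :+ q :* (m :* σ) := (m :* (q :* k) :+ q :+ con 1) :* t :+
                   (k :* (con 2 :+ k) :* t :+ con 1) :+ (m :* σ :+ q :* (m :* (q :* q :* t :+ con 1)))) refl k m θ ⟩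
        i * θ + (κ * θ + 1) + (m * σ + q * (m * (q * q * θ + 1)))  ≡⟨ cong₂ (λ x y → i * θ + x + (m * σ + q * y)) eθ
            (sym L≡′) ⟩
        i * θ + q * q * a + (m * σ + q * L)      ∎)
        where
        -- The number θ_{r-2,q} of singular points of Σ in P^⊥.
        σ = q * ((2 + k) * θ) + 1
        s≡ : s ≡ k * σ
        s≡ = +-cancelʳ-≡ 1 _ _ (trans eS (trans (cong (q *_) (sym eθ)) (solve 2 (λ k t → let q = con 1 :+ k in
          q :* (k :* (con 2 :+ k) :* t :+ con 1) := k :* (q :* ((con 2 :+ k) :* t) :+ con 1) :+ con 1) refl k θ)))
        mσ≡ : m * σ ≡ L + q * n₂
        mσ≡ = *-cancelˡ-≡ _ _ k (+-cancelʳ-≡ (L + q * n₂) _ _ (begin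
          k * (m * σ) + (L + q * n₂)  ≡⟨ solve 4 (λ k m s x → k :* (m :* s) :+ x := m :* (k :* s) :+ x) refl k m σ
              (L + q * n₂) ⟩
          m * (k * σ) + (L + q * n₂)        ≡⟨ cong (λ x → m * x + (L + q * n₂)) s≡ ⟨
          m * s + (L + q * n₂)              ≡⟨ +-assoc (m * s) L (q * n₂) ⟨
          m * s + L + q * n₂                ≡⟨ eF ⟩
          q * L + q * q * n₂  ≡⟨ solve 3 (λ k L n → let q = con 1 :+ k in q :* L :+ q :* q :* n := k :* (L :+ q :* n) :+ (L :+ q :* n)) refl k L n₂ ⟩
          k * (L + q * n₂) + (L + q * n₂)   ∎))
        L≡′ : L ≡ m * (q * q * θ + 1)
        L≡′ = *-cancelˡ-≡ _ _ κ (trans (sym L≡) (trans (cong (m *_) s₀≡)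
            (solve 3 (λ m κ x → m :* (κ :* x) := κ :* (m :* x)) refl m κ (q * q * θ + 1))))
        reduced : N + m * σ ≡ L + σ + q * q * n₂
        reduced = *-cancelˡ-≡ _ _ κ (begin
          κ * (N + m * σ)  ≡⟨ solve 4 (λ k N m s → k :* (con 2 :+ k) :* (N :+ m :* s) := k :*
              (con 2 :+ k) :* N :+ m :* ((con 2 :+ k) :* (k :* s))) refl k N m σ ⟩
          κ * N + m * ((2 + k) * (k * σ))              ≡⟨ cong (λ x → κ * N + m * ((2 + k) * x)) s≡ ⟨
          κ * N + m * ((2 + k) * s)                    ≡⟨ balance ⟩
          m * s₀ + (2 + k) * s + q * q * (κ * n₂)  ≡⟨ cong₂ (λ x y → x + (2 + k) * y + q * q * (κ * n₂)) L≡ s≡ ⟩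
          κ * L + (2 + k) * (k * σ) + q * q * (κ * n₂) ≡⟨ solve 5 (λ k L s Q n → let κ = k :* (con 2 :+ k) in κ :* L :+ (con 2 :+ k) :* (k :* s) :+ Q :* (κ :* n) := κ :* (L :+ s :+ Q :* n)) refl k L σ (q * q) n₂ ⟩
          κ * (L + σ + q * q * n₂)                     ∎)

  module _ {q m i T N D R L M n₂ s s₀ : ℕ} (2≤q : 2 ℕ.≤ q)
    (eN  : T + N ≡ N * q ^ 2)
    (eA  : T + m * D + L ≡ M + D)
    (eB  : M + q ^ 2 * n₂ ≡ q ^ 2 * L + q ^ 2 * q ^ 2 * n₂)
    (eC₁ : D + R ≡ R * q ^ 2)
    (eC₂ : s + R ≡ R * q)
    (eE  : m * s₀ + L ≡ L * (q * q))
    (e₀  : s₀ + 1 ≡ q ^ (4 + i * 2)) where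

    private
      dual tight : ℕ
      dual  = m * θ ((4 + i * 2) ℤ.⊖ 5) q / suc q
      tight = (m * (q ^ 2 ∸ q) + q + 1) * θ (+ (i * 2 / 2)) (q ^ 2)

      -- Writing q as k + 1 turns the truncated difference q² - q into the product (k + 1) k, to
      -- which the polynomial identities apply.
      module Suc {k} .{{_ : NonZero k}} (q≡ : q ≡ suc k) where
        q²≡ : q ^ 2 ≡ suc k * suc k
        q²≡ = trans (cong (_^ 2) q≡) (cong (suc k *_) (*-identityʳ (suc k)))

        module C = Counts k m {T} {N} {D} {R} {L} {M} {n₂} {s} {s₀}
          (subst (λ x → T + N ≡ N * x) q²≡ eN) eA (subst (λ x → M + x * n₂ ≡ x * L + x * x * n₂) q²≡ eB)
          (subst (λ x → D + R ≡ R * x) q²≡ eC₁) (subst (λ x → s + R ≡ R * x) q≡ eC₂)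
              (subst (λ x → m * s₀ + L ≡ L * (x * x)) q≡ eE)

        θ′ a : ℕ
        θ′ = θ (+ i) (suc (k * (2 + k)))
        a  = suc k ^ (i * 2)

        tight≡ : tight ≡ (m * (suc k * k) + suc k + 1) * θ′
        tight≡ = cong₂ _*_ (cong₂ (λ x y → m * x + y + 1) (begin
            q ^ 2 ∸ q                      ≡⟨ cong₂ _∸_ q²≡ q≡ ⟩
            suc k * suc k ∸ suc k  ≡⟨ cong (_∸ suc k) (solve 1 (λ k → (con 1 :+ k) :* (con 1 :+ k) :=
                (con 1 :+ k) :* k :+ (con 1 :+ k)) refl k) ⟩
            suc k * k + suc k ∸ suc k      ≡⟨ m+n∸n≡m (suc k * k) (suc k) ⟩
            suc k * k                      ∎) q≡)
          (cong₂ (λ x y → θ (+ x) y) (m*n/n≡m i 2) (trans q²≡ (square-suc k)))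
          where open ≡-Reasoning

        eθ : k * (2 + k) * θ′ + 1 ≡ suc k * suc k * a
        eθ = begin
          k * (2 + k) * θ′ + 1                  ≡⟨ θ-geometric i (k * (2 + k)) ⟩
          suc (k * (2 + k)) ^ suc i  ≡⟨ cong (_^ suc i) (trans (cong (suc k *_) (*-identityʳ (suc k))) (square-suc k)) ⟨
          (suc k ^ 2) ^ suc i                   ≡⟨ ^-*-assoc (suc k) 2 (suc i) ⟩
          suc k ^ (2 * suc i)                   ≡⟨ cong (suc k ^_) (*-comm 2 (suc i)) ⟩
          suc k * (suc k * a)                   ≡⟨ *-assoc (suc k) (suc k) a ⟨
          suc k * suc k * a                     ∎
          where open ≡-Reasoning

        e₀′ : s₀ + 1 ≡ suc k * suc k * (suc k * suc k * a)
        e₀′ = trans e₀ (trans (cong (_^ (4 + i * 2)) q≡) (solve 2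
            (λ q a → q :* (q :* (q :* (q :* a))) := q :* q :* (q :* q :* a)) refl (suc k) a))

      pred-q : ∃ λ k → NonZero k × q ≡ suc k
      pred-q = go 2≤q
        where
        go : ∀ {q} → 2 ℕ.≤ q → ∃ λ k → NonZero k × q ≡ suc k
        go (ℕ.s≤s (ℕ.s≤s {n = k} _)) = suc k , _ , refl

    tight-off-Σ : s + 1 ≡ q ^ (2 + i * 2) → N + q ^ 2 * dual ≡ tight + q ^ 2 * n₂
    tight-off-Σ eS with pred-q
    ... | k , k≢0 , q≡ = trans (cong₂ (λ x y → N + x * y) q²≡ (cong (λ q → m * θ ((4 + i * 2) ℤ.⊖ 5) q / suc q) q≡))
        (trans (C.points-off-Σ eθ e₀′ (trans eS (trans (cong (_^ (2 + i * 2)) q≡) (sym (*-assoc (suc k) (suc k) a))))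
            (θ⊖5 (i * 2) k) (dualNumber-exact i k m))
          (cong₂ (λ x y → x + y * n₂) (sym tight≡) (sym q²≡)))
      where
      instance _ = k≢0
      open Suc q≡

    tight-on-Σ : s + 1 ≡ q ^ (3 + i * 2) → m * s + L + q * n₂ ≡ q * L + q * q * n₂ → N ≡ tight + q ^ (2 + i * 2)
    tight-on-Σ eS eF with pred-q
    ... | k , k≢0 , q≡ = trans (C.points-on-Σ eθ e₀′
          (trans eS (trans (cong (_^ (3 + i * 2)) q≡) (cong (suc k *_) (sym (*-assoc (suc k) (suc k) a)))))
          (subst (λ q → m * s + L + q * n₂ ≡ q * L + q * q * n₂) q≡ eF))
        (cong₂ _+_ (sym tight≡) (trans (*-assoc (suc k) (suc k) a) (cong (_^ (2 + i * 2)) (sym q≡))))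
      where
      instance _ = k≢0
      open Suc q≡

open Arithmetic

open import Data.Nat.Base using (_^_)

-- Tight sets against dual covers

module TightCover {q} (i : ℕ) (pp : IsOddPrimePower q) (F : FiniteField q) (K : FiniteField (q ^ 2)) (emb : FieldEmbedding F K)
    (Q : Projective.QuadraticForm F (suc (4 + i * 2))) (nondegenerate : Projective.Nondegenerate F Q) (m : ℕ)
    (𝓛 : Pred (Projective.Line F (4 + i * 2)) 0ℓ) (resp : 𝓛 Respects (Setoid._≈_ (Projective.lines F (4 + i * 2))))
        (cover : Parabolic.IsCover F Q m 𝓛) where
  open CoverCounting pp F K emb Q m 𝓛 resp cover
  open 𝔽 using (b; form)
  open Parabolic F Q using (_^⊥; MeetsQuadricIn; dualNumber; IsDualTypeI)
  open Parabolic.IsCover cover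
  open PolarGeometry F Q
  open Sizes 2≢0ᶠ δ δ-nonsquare (λ {x} _ x⊥ → nondegenerate x λ y → x⊥ {y} tt) using
      (count-singular; count-singular⊥; count-singular⊥⊥)

  r : ℕ
  r = 4 + i * 2

  private
    module 𝔽lines = 𝔽.lines {n}
    module 𝔽points = 𝔽.points {n}
    module 𝕂points = points {n}

  X : Pred (Subspace n 1) 0ℓ
  X = extendedPoints 𝓛

  h-multiple : ∀ {x y x′ y′} c d → x ≡ c ·ᵛ x′ → y ≡ d ·ᵛ y′ → h x′ y′ ≡ 0# → h x y ≡ 0#
  h-multiple {x′ = x′} {y′} c d refl refl e = trans (h-·ʳ (c ·ᵛ x′) d y′)
      (trans (cong (conj d ·_) (trans (linear-· (h-linear y′) c x′) (trans (cong (c ·_) e) (zeroʳ c)))) (zeroʳ _))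

  ∈𝓗⁻ : ∀ {P} → P ∈ 𝓗 → h (gen P) (gen P) ≡ 0#
  ∈𝓗⁻ {P} P∈ = trans (h-B _ _) (P∈ (gen∈ P))

  ∈𝓗⁺ : ∀ {P} → h (gen P) (gen P) ≡ 0# → P ∈ 𝓗
  ∈𝓗⁺ {P} e {x} x∈ = let c , x≡ = ∈-point⁻ P x∈ in trans (sym (h-B x x)) (h-multiple c c x≡ x≡ e)

  ∈⊥ₕ⁻ : ∀ {P P′} → ⟦ P′ ⟧ ⊆ P ^⊥ₕ → h (gen P′) (gen P) ≡ 0#
  ∈⊥ₕ⁻ {P} {P′} P′⊆ = trans (h-B _ _) (P′⊆ (gen∈ P′) (gen∈ P))

  ∈⊥ₕ⁺ : ∀ {P P′} → h (gen P′) (gen P) ≡ 0# → ⟦ P′ ⟧ ⊆ P ^⊥ₕ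
  ∈⊥ₕ⁺ {P} {P′} e {y} y∈ {x} x∈ = let c , y≡ = ∈-point⁻ P′ y∈ ; d , x≡ = ∈-point⁻ P x∈ in trans (sym (h-B y x)) (h-multiple c d y≡ x≡ e)

  -- The line M of the witness is only known to contain ℓ. It shares two independent vectors with
  -- `extension ℓ` and so lies in it.
  ∈X⁻ : ∀ {P} → P ∈ X → Covered (gen P)
  ∈X⁻ {P} (_ , ℓ , M , ℓ∈ , M-extends , P⊆M) = ℓ , ℓ∈ , extension⇒onLine ℓ
    (line-⊆ M (extension ℓ) (M-extends (𝔽.gen₁∈ ℓ)) (M-extends (𝔽.gen₂∈ ℓ)) (ι-independent (𝔽.gens-independent ℓ))
        (gen₁∈ (extension ℓ)) (gen₂∈ (extension ℓ)) (P⊆M (gen∈ P)))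

  onLine-isotropic : ∀ {ℓ z} → ℓ ∈ 𝓛 → OnLine ℓ z → h z z ≡ 0#
  onLine-isotropic {ℓ} {z} ℓ∈ (re∈ , im∈) = trans (cong (λ z → h z z) (sym (complex-Re-Im z))) (trans (h-self (Re z) (Im z))
    (trans (cong ι (trans (cong₂ (λ s t → s 𝔽.- δ 𝔽.· t) (cover-b≡0 {ℓ} ℓ∈ re∈ re∈) (cover-b≡0 {ℓ} ℓ∈ im∈ im∈))
      (𝔽.solve 1 (λ d → 𝔽.:0 𝔽.:- d 𝔽.:* 𝔽.:0 𝔽.:= 𝔽.:0) refl δ))) ι-0))

  ∈X⁺ : ∀ {P} → Covered (gen P) → P ∈ X
  ∈X⁺ {P} (ℓ , ℓ∈ , on) = (λ {x} → ∈𝓗⁺ {P} (onLine-isotropic {ℓ} ℓ∈ on) {x}) , ℓ , extension ℓ , ℓ∈ ,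
      (λ x∈ → onLine⇒extension ℓ (ι-onLine {ℓ} x∈)) ,
    λ x∈ → point-⊆-line P (extension ℓ) (onLine⇒extension ℓ on) x∈

  SeenFrom : Subspace n 1 → Pred (Subspace n 1) 0ℓ
  SeenFrom P P′ = P′ ∈ X × ⟦ P′ ⟧ ⊆ P ^⊥ₕ

  seenFrom-resp : ∀ P → SeenFrom P Respects (Setoid._≈_ (Projective.points K r))
  seenFrom-resp P {P′} {P″} (P′⊆ , ⊆P′) ((H , ℓ , M , ℓ∈ , M-extends , P′⊆M) , P′⊥) =
    ((λ x∈ → H (⊆P′ x∈)) , ℓ , M , ℓ∈ , (λ x∈ → M-extends x∈) , (λ x∈ → P′⊆M (⊆P′ x∈))) , (λ x∈ → P′⊥ (⊆P′ x∈))

  seenFrom⁻ : ∀ P {P′} → SeenFrom P P′ → Covered (gen P′) × h (gen P′) (gen P) ≡ 0#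
  seenFrom⁻ P {P′} (P′∈ , P′⊥) = ∈X⁻ {P′} P′∈ , ∈⊥ₕ⁻ {P} {P′} (λ x∈ → P′⊥ x∈)

  seenFrom⁺ : ∀ P {P′} → Covered (gen P′) × h (gen P′) (gen P) ≡ 0# → SeenFrom P P′
  seenFrom⁺ P {P′} (c , e) = ∈X⁺ {P′} c , (λ x∈ → ∈⊥ₕ⁺ {P} {P′} e x∈)

  seenFrom? : ∀ P → Decidable (SeenFrom P)
  seenFrom? P P′ = map′ (seenFrom⁺ P {P′}) (seenFrom⁻ P {P′}) (covered? (gen P′) ×-dec ⊥? (gen P) (gen P′))

  visible : Subspace n 1 → ℕ
  visible P = 𝕂points.count (seenFrom? P)

  HasCard⇒visible : ∀ P {N} → HasCard (Projective.points K r) (SeenFrom P) N → visible P ≡ N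
  HasCard⇒visible P = 𝕂points.HasCard⇒count (seenFrom? P) (λ {P′} {P″} → seenFrom-resp P {P′} {P″})

  visible⇒HasCard : ∀ P {N} → visible P ≡ N → HasCard (Projective.points K r) (SeenFrom P) N
  visible⇒HasCard P = 𝕂points.count⇒HasCard (seenFrom? P) (λ {P′} {P″} → seenFrom-resp P {P′} {P″})

  count-visible : ∀ P → coveredVectors (gen P) + visible P ≡ visible P * q²
  count-visible P = count-points (seenFrom? P) (covered? ∩? ⊥? (gen P))
    (λ {P′} {x} x∈ x≢0 s → let c , e = ∈-point⁻ P′ x∈ ; cov , ⊥g = seenFrom⁻ P {P′} s in covered-multiple {x} {gen P′} c e cov , trans (cong (λ z → h z (gen P)) e) (trans (linear-· (h-linear (gen P)) c (gen P′)) (trans (cong (c ·_) ⊥g) (zeroʳ c))))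
    (λ {P′} {x} x∈ x≢0 (cov , ⊥x) → let c , e = proportional P′ x∈ x≢0 (gen∈ P′) in seenFrom⁺ P {P′} (covered-multiple {gen P′} {x} c e cov , trans (cong (λ z → h z (gen P)) e) (trans (linear-· (h-linear (gen P)) c x) (trans (cong (c ·_) ⊥x) (zeroʳ c)))))
    where
    covered-multiple : ∀ {x y} c → x ≡ c ·ᵛ y → Covered y → Covered x
    covered-multiple c e (ℓ , ℓ∈ , on) = ℓ , ℓ∈ , subst (OnLine ℓ) (sym e)
        (extension⇒onLine ℓ (line-· (extension ℓ) c (onLine⇒extension ℓ on)))

  N₀ : ℕ
  N₀ = 𝔽.count (𝔽.nonzero? ∩? (𝔽.singular? ∩? 𝔽.full?))

  singular-0 : 𝔽.Singular (𝔽.0ᵛ {n})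
  singular-0 = 𝔽.b≡0⇒singular (𝔽.b-0ˡ 𝔽.0ᵛ)

  N₀+1 : N₀ + 1 ≡ q ^ r
  N₀+1 = trans (𝔽.count-nonzero (𝔽.singular? ∩? 𝔽.full?) (singular-0 , tt))
    (trans (count-cong (𝔽.vectors n) (𝔽.singular? ∩? 𝔽.full?) 𝔽.singular? proj₁ (λ s → s , tt))
        (count-singular {suc i} refl))

  L : ℕ
  L = length coverLines

  private
    +-L : (f : 𝔽.Subspace n 2 → ℕ) → ∑ coverLines f + L ≡ ∑[ ℓ ∈ coverLines ] (f ℓ + 1)
    +-L f = trans (cong (∑ coverLines f ℕ.+_) (sym (trans (∑-const coverLines 1) (ℕ.*-identityʳ L))))
        (sym (∑-+ coverLines f (λ _ → 1)))

  -- Flags without any orthogonality condition: each line of the cover has q² - 1 nonzero vectors,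
  -- each nonzero singular vector lies on m lines.
  cover-size : m * N₀ + L ≡ L * (q * q)
  cover-size = trans (cong (_+ L) (sym (count-incidences 𝔽.full?))) (trans (+-L _)
    (trans (∑-cong coverLines (λ ℓ → trans (𝔽.count-nonzero ((𝔽._∈? ℓ) ∩? 𝔽.full?)
        (𝔽.IsSubspace.0∈ (𝔽.line-subspace ℓ) , tt))
        (trans (count-cong (𝔽.vectors n) ((𝔽._∈? ℓ) ∩? 𝔽.full?) (𝔽._∈? ℓ) proj₁ (λ x∈ → x∈ , tt)) (𝔽.count-line ℓ))))
      (∑-const coverLines (q * q))))

  seenVectors : Vector n → ℕ
  seenVectors p = 𝔽.count (𝔽.nonzero? ∩? (𝔽.singular? ∩? seen? p))

  seenVectors+1 : ∀ p → seenVectors p + 1 ≡ 𝔽.count (𝔽.singular? ∩? seen? p)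
  seenVectors+1 p = 𝔽.count-nonzero (𝔽.singular? ∩? seen? p) (singular-0 , trans (cong (λ z → h z p) ιᵛ-0)
      (linear-0 (h-linear p)))

  tight : ℕ
  tight = (m * (q ^ 2 ∸ q) + q + 1) * θ (ℤ.+ (i * 2 / 2)) (q ^ 2)

  -- The vectors of Σ seen from P are those orthogonal to both u and v. Exactly q^(r-2) of them are
  -- singular, whether the line of u and v is totally singular or nondegenerate; this uniformity
  -- makes the constant term independent of P.
  visible-off-Σ : ∀ P {u v} → gen P ≡ complex u v → 𝔽.Independent u v → Conjugate 2≢0ᶠ δ δ-nonsquare u v →
    visible P + q ^ 2 * dualNumber m ≡ tight + q ^ 2 * insideLines (gen P)
  visible-off-Σ P {u} {v} p≡ ind conj = tight-off-Σ {q} {m} {i} 𝔽.2≤order (count-visible P) (count-covered p)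
      (count-onLines p)
      (count-realVectors p) (count-seen p) cover-size N₀+1 (trans (seenVectors+1 p) (trans
        (count-cong (𝔽.vectors n) (𝔽.singular? ∩? seen? p) (((𝔽.full? ∩? (u 𝔽.⊥?)) ∩? (v 𝔽.⊥?)) ∩? 𝔽.singular?)
          (λ {x} (s , e) → let xu , xv = h-ι-complex≡0 (trans (cong (h (ιᵛ x)) (sym p≡)) e) in ((tt , xu) , xv) , s)
          (λ {x} (((_ , xu) , xv) , s) → s , trans (cong (h (ιᵛ x)) p≡) (h-ι-complex≡0⁺ xu xv)))
        (count-singular⊥⊥ {suc i} refl ind conj)))
    where p = gen P

  visible-on-Σ : ∀ P {c w} → gen P ≡ c ·ᵛ ιᵛ w → w ≢ 𝔽.0ᵛ → 𝔽.Singular w → visible P ≡ tight + q ^ (r ∸ 2)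
  visible-on-Σ P {c} {w} p≡ w≢0 s = tight-on-Σ {q} {m} {i} 𝔽.2≤order (count-visible P) (count-covered p) (count-onLines p)
      (count-realVectors p) (count-seen p) cover-size N₀+1 (trans (seenVectors+1 p) (trans
        (count-cong (𝔽.vectors n) (𝔽.singular? ∩? seen? p) (𝔽.singular? ∩? (w 𝔽.⊥?)) (λ (s , e) → s , seen⁻ e)
            (λ (s , e) → s , seen⁺ e))
        (count-singular⊥ {suc i} refl w≢0 s)))
      -- The additional equation available on Σ: here p^⊥ meets Σ in the hyperplane w^⊥, so a line
      -- of the cover has either q² or only q vectors in it. Summing over the lines and comparing
      -- with `count-incidences` determines `insideLines p`.
      (begin
        m * seenVectors p + L + q * insideLines p
          ≡⟨ cong (λ k → k + L + q * insideLines p) (sym (count-incidences (seen? p))) ⟩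
        ∑[ ℓ ∈ coverLines ] 𝔽.count (𝔽.nonzero? ∩? ((𝔽._∈? ℓ) ∩? seen? p)) + L + q * insideLines p
          ≡⟨ cong₂ _+_ (+-L _) (sym (∑-*ˡ coverLines q _)) ⟩
        ∑[ ℓ ∈ coverLines ] (𝔽.count (𝔽.nonzero? ∩? ((𝔽._∈? ℓ) ∩? seen? p)) + 1) + ∑[ ℓ ∈ coverLines ] (q * ⟨ inside? p ℓ ⟩)
          ≡⟨ sym (∑-+ coverLines _ _) ⟩
        ∑[ ℓ ∈ coverLines ] (𝔽.count (𝔽.nonzero? ∩? ((𝔽._∈? ℓ) ∩? seen? p)) + 1 + q * ⟨ inside? p ℓ ⟩)
          ≡⟨ ∑-cong coverLines on-line ⟩
        ∑[ ℓ ∈ coverLines ] (q + q * q * ⟨ inside? p ℓ ⟩)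
          ≡⟨ trans (∑-+ coverLines _ _) (cong₂ _+_ (trans (∑-const coverLines q) (ℕ.*-comm L q))
              (∑-*ˡ coverLines (q * q) _)) ⟩
        q * L + q * q * insideLines p ∎)
    where
    open ≡-Reasoning
    p = gen P
    instance _ = 𝔽.order-nonZero
    conj-c≢0 : conj c ≢ 0#
    conj-c≢0 e = gen≢0 P (trans p≡ (trans (cong (_·ᵛ ιᵛ w) (trans (sym (conj-conj c)) (trans (cong conj e) conj-0)))
        (0·ᵛ _)))
    h≡ : ∀ x → h (ιᵛ x) p ≡ conj c · ι (b x w)
    h≡ x = trans (cong (h (ιᵛ x)) p≡) (trans (h-·ʳ (ιᵛ x) c (ιᵛ w)) (cong (conj c ·_) (h-ι x w)))
    seen⁻ : ∀ {x} → Seen p x → b x w ≡ 𝔽.0#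
    seen⁻ {x} e = ι≡0 (·≡0 conj-c≢0 (trans (sym (h≡ x)) e))
    seen⁺ : ∀ {x} → b x w ≡ 𝔽.0# → Seen p x
    seen⁺ {x} e = trans (h≡ x) (trans (cong (λ y → conj c · ι y) e) (trans (cong (conj c ·_) ι-0) (zeroʳ _)))
    on-line : ∀ ℓ → 𝔽.count (𝔽.nonzero? ∩? ((𝔽._∈? ℓ) ∩? seen? p)) + 1 + q * ⟨ inside? p ℓ ⟩ ≡ q + q * q * ⟨ inside? p ℓ ⟩
    on-line ℓ = trans (cong (_+ q * ⟨ inside? p ℓ ⟩) (trans (𝔽.count-nonzero ((𝔽._∈? ℓ) ∩? seen? p)
        (𝔽.IsSubspace.0∈ (𝔽.line-subspace ℓ) , seen⁺ (𝔽.b-0ˡ w)))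
        (count-cong (𝔽.vectors n) ((𝔽._∈? ℓ) ∩? seen? p) ((𝔽._∈? ℓ) ∩? (w 𝔽.⊥?)) (λ (a , e) → a , seen⁻ e)
            (λ (a , e) → a , seen⁺ e)))) (by-cases (inside? p ℓ))
      where
      outside : ∀ {x} → x ∈ 𝔽.⟦ ℓ ⟧ → ¬ Seen p x → 𝔽.count ((𝔽._∈? ℓ) ∩? (w 𝔽.⊥?)) + q * 0 ≡ q + q * q * 0
      outside x∈ ¬seen = trans (cong₂ _+_ (ℕ.*-cancelˡ-≡ _ _ q (trans
          (𝔽.count-kernel (𝔽._∈? ℓ) (𝔽.line-subspace ℓ) (𝔽.b-linearˡ w) x∈ (λ e → ¬seen (seen⁺ e))) (𝔽.count-line ℓ)))
          (ℕ.*-zeroʳ q))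
        (cong (q +_) (sym (ℕ.*-zeroʳ (q * q))))
      by-cases : (d : Dec (Inside p ℓ)) → 𝔽.count ((𝔽._∈? ℓ) ∩? (w 𝔽.⊥?)) + q * ⟨ d ⟩ ≡ q + q * q * ⟨ d ⟩
      by-cases (yes (e₁ , e₂)) = trans (cong (_+ q * 1) (trans (count-cong (𝔽.vectors n) ((𝔽._∈? ℓ) ∩? (w 𝔽.⊥?))
          (𝔽._∈? ℓ) proj₁ (λ x∈ → x∈ , seen⁻ (inside⇒⊥ p ℓ (e₁ , e₂) (ι-onLine {ℓ} x∈)))) (𝔽.count-line ℓ)))
        (trans (ℕ.+-comm (q * q) (q * 1)) (cong₂ _+_ (ℕ.*-identityʳ q) (sym (ℕ.*-identityʳ (q * q)))))
      by-cases (no ¬i) = at-generator (seen? p (𝔽.gen₁ ℓ))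
        where
        at-generator : Dec (Seen p (𝔽.gen₁ ℓ)) → 𝔽.count ((𝔽._∈? ℓ) ∩? (w 𝔽.⊥?)) + q * 0 ≡ q + q * q * 0
        at-generator (no ne) = outside (𝔽.gen₁∈ ℓ) ne
        at-generator (yes e) = outside (𝔽.gen₂∈ ℓ) (λ e′ → ¬i (e , e′))

  Polar : 𝔽.Subspace n 2 → Pred (𝔽.Subspace n 2) 0ℓ
  Polar ℓ ℓ′ = ℓ′ ∈ 𝓛 × 𝔽.⟦ ℓ′ ⟧ ⊆ ℓ ^⊥

  polar-resp : ∀ ℓ → Polar ℓ Respects (Setoid._≈_ (Projective.lines F r))
  polar-resp ℓ {ℓ′} {ℓ″} e (ℓ′∈ , ℓ′⊥) = resp {ℓ′} {ℓ″} e ℓ′∈ , λ x∈ → ℓ′⊥ (proj₂ e x∈)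

  module _ (ℓ : 𝔽.Subspace n 2) {u v} (u∈ : u ∈ 𝔽.⟦ ℓ ⟧) (v∈ : v ∈ 𝔽.⟦ ℓ ⟧) (ind : 𝔽.Independent u v) {p} (p≡ : p ≡ complex u v) where
    polar⁻ : ∀ {ℓ′} → Polar ℓ ℓ′ → (𝓛 ∩ Inside p) ℓ′
    polar⁻ {ℓ′} (ℓ′∈ , ℓ′⊥) = ℓ′∈ , seen (𝔽.gen₁∈ ℓ′) , seen (𝔽.gen₂∈ ℓ′)
      where
      seen : ∀ {x} → x ∈ 𝔽.⟦ ℓ′ ⟧ → h (ιᵛ x) p ≡ 0#
      seen {x} x∈ = trans (cong (h (ιᵛ x)) p≡) (h-ι-complex≡0⁺ (ℓ′⊥ x∈ u∈) (ℓ′⊥ x∈ v∈))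

    polar⁺ : ∀ {ℓ′} → (𝓛 ∩ Inside p) ℓ′ → Polar ℓ ℓ′
    polar⁺ {ℓ′} (ℓ′∈ , inside) = ℓ′∈ , λ {x} x∈ {y} y∈ →
      let s , t , e = 𝔽.independent⇒spans ℓ u∈ v∈ ind y∈
          xu , xv = h-ι-complex≡0 (trans (cong (h (ιᵛ x)) (sym p≡)) (inside⇒⊥ p ℓ′ inside (ι-onLine {ℓ′} x∈)))
      in trans (cong (b x) e) (trans (𝔽.b-lcʳ s t u v x) (trans (cong₂ (λ c d → s 𝔽.· c 𝔽.⊕ t 𝔽.· d) xu xv)
          (𝔽.solve 2 (λ s t → s 𝔽.:* 𝔽.:0 𝔽.:+ t 𝔽.:* 𝔽.:0 𝔽.:= 𝔽.:0) refl s t)))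

    polar? : Decidable (Polar ℓ)
    polar? ℓ′ = map′ (polar⁺ {ℓ′}) (polar⁻ {ℓ′}) ((𝓛? ∩? inside? p) ℓ′)

    -- The polar subspace of ℓ is the part of p^⊥ in Σ, since u and v span ℓ. The number in the dual
    -- condition is thus the one occurring in `visible-off-Σ`.
    count-polar : 𝔽lines.count polar? ≡ insideLines p
    count-polar = trans (count-cong 𝔽.lines-finite polar? (𝓛? ∩? inside? p) (λ {ℓ′} → polar⁻ {ℓ′})
        (λ {ℓ′} → polar⁺ {ℓ′})) (sym (count-filter 𝓛? (inside? p) 𝔽lines.elements))

    HasCard⇒insideLines : ∀ {N} → HasCard (Projective.lines F r) (Polar ℓ) N → insideLines p ≡ N
    HasCard⇒insideLines card = trans (sym count-polar) (𝔽lines.HasCard⇒count polar?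
        (λ {ℓ′} {ℓ″} → polar-resp ℓ {ℓ′} {ℓ″}) card)

    insideLines⇒HasCard : ∀ {N} → insideLines p ≡ N → HasCard (Projective.lines F r) (Polar ℓ) N
    insideLines⇒HasCard e = 𝔽lines.count⇒HasCard polar? (λ {ℓ′} {ℓ″} → polar-resp ℓ {ℓ′} {ℓ″}) (trans count-polar e)

    -- A line of the cover whose extension contains p contains both u and v, hence has the same span
    -- as ℓ; 𝓛 respects that equality.
    covered⇒∈𝓛 : Covered p → ℓ ∈ 𝓛
    covered⇒∈𝓛 (ℓ′ , ℓ′∈ , on) = resp {ℓ′} {ℓ} (ℓ′⊆ , ⊆ℓ′) ℓ′∈
      where
      parts = complex-parts p≡
      u∈′ : u ∈ 𝔽.⟦ ℓ′ ⟧
      u∈′ = subst (_∈ 𝔽.⟦ ℓ′ ⟧) (proj₁ parts) (proj₁ on)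
      v∈′ : v ∈ 𝔽.⟦ ℓ′ ⟧
      v∈′ = subst (_∈ 𝔽.⟦ ℓ′ ⟧) (proj₂ parts) (proj₂ on)
      ℓ′⊆ : 𝔽.⟦ ℓ′ ⟧ ⊆ 𝔽.⟦ ℓ ⟧
      ℓ′⊆ = 𝔽.line-⊆ ℓ′ ℓ u∈′ v∈′ ind u∈ v∈
      ⊆ℓ′ : 𝔽.⟦ ℓ ⟧ ⊆ 𝔽.⟦ ℓ′ ⟧
      ⊆ℓ′ = 𝔽.line-⊆ ℓ ℓ′ u∈ v∈ ind u∈′ v∈′

    ∈𝓛⇒covered : ℓ ∈ 𝓛 → Covered p
    ∈𝓛⇒covered ℓ∈ = ℓ , ℓ∈ , subst (_∈ 𝔽.⟦ ℓ ⟧) (sym (proj₁ parts)) u∈ , subst (_∈ 𝔽.⟦ ℓ ⟧) (sym (proj₂ parts)) v∈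
      where
      parts = complex-parts p≡

  private
    q^2≢0 : ℕ.NonZero (q ^ 2)
    q^2≢0 = ℕ.m^n≢0 q 2 {{𝔽.order-nonZero}}

    q^[r-2] : q ^ (r ∸ 2) ≡ q ^ 2 * q ^ (r ∸ 4)
    q^[r-2] = ℕ.^-distribˡ-+-* q 2 (i * 2)

    -- The affine relation is solved for the number of lines, and by `solve-tight` for the number of
    -- points. The excess x is q^(r-4) for points of X and 0 for the others.
    solve-dual : ∀ {N N₂} x → N + q ^ 2 * dualNumber m ≡ tight + q ^ 2 * N₂ → N ≡ tight + q ^ 2 * x → N₂ ≡ dualNumber m + x
    solve-dual {N} {N₂} x e refl = ℕ.*-cancelˡ-≡ _ _ (q ^ 2) {{q^2≢0}} (ℕ.+-cancelˡ-≡ tight _ _ (trans (sym e)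
      (trans (ℕ.+-assoc tight _ _) (cong (tight +_) (trans (ℕ.+-comm (q ^ 2 * x) _)
          (sym (ℕ.*-distribˡ-+ (q ^ 2) (dualNumber m) x)))))))

    solve-tight : ∀ {N N₂} x → N + q ^ 2 * dualNumber m ≡ tight + q ^ 2 * N₂ → N₂ ≡ dualNumber m + x → N ≡ tight + q ^ 2 * x
    solve-tight {N} x e refl = ℕ.+-cancelʳ-≡ (q ^ 2 * dualNumber m) _ _ (trans e
      (trans (cong (tight +_) (trans (ℕ.*-distribˡ-+ (q ^ 2) (dualNumber m) x) (ℕ.+-comm _ (q ^ 2 * x))))
          (sym (ℕ.+-assoc tight _ _))))

    zero-shift : ∀ {N} → N ≡ tight → N ≡ tight + q ^ 2 * 0
    zero-shift e = trans e (sym (trans (cong (tight +_) (ℕ.*-zeroʳ (q ^ 2))) (ℕ.+-identityʳ tight)))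

  complex-independent≢0 : ∀ {u v : 𝔽.Vector n} → 𝔽.Independent u v → complex u v ≢ 0ᵛ
  complex-independent≢0 ind e = 𝔽.independent⇒≢0ˡ ind (proj₁ (complex-injective (trans e (sym complex-0))))

  conjugate⇒isotropic : ∀ {u v} → b u u ≡ δ 𝔽.· b v v → h (complex u v) (complex u v) ≡ 0#
  conjugate⇒isotropic {u} {v} e = trans (h-self u v) (trans (cong ι (𝔽.≡⇒-≡0 e)) ι-0)

  tight⇒dual : IsTight (m * (q ^ 2 ∸ q) + q + 1) X → IsDualTypeI m 𝓛
  tight⇒dual T = record { inside = inside ; outside = outside }
    where
    module T = IsTight T
    inside : ∀ ℓ → ℓ ∈ 𝓛 → HasCard (Projective.lines F r) (Polar ℓ) (dualNumber m + q ^ (r ∸ 4))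
    inside ℓ ℓ∈ = insideLines⇒HasCard ℓ (𝔽.gen₁∈ ℓ) (𝔽.gen₂∈ ℓ) ind {p} refl
        (solve-dual (q ^ (r ∸ 4)) (visible-off-Σ P refl ind conjugate)
            (trans (HasCard⇒visible P (T.inside P (∈𝓗⁺ {P} (conjugate⇒isotropic conjugate))
            (∈X⁺ {P} (∈𝓛⇒covered ℓ (𝔽.gen₁∈ ℓ) (𝔽.gen₂∈ ℓ) ind refl ℓ∈)))) (cong (tight +_) q^[r-2])))
      where
      ind = 𝔽.gens-independent ℓ
      p : Vector n
      p = complex (𝔽.gen₁ ℓ) (𝔽.gen₂ ℓ)
      P : Subspace n 1
      P = mkPoint p (complex-independent≢0 ind)
      -- A line of the cover is totally singular, so any basis will do: both sides are 0.
      conjugate : b (𝔽.gen₁ ℓ) (𝔽.gen₁ ℓ) ≡ δ 𝔽.· b (𝔽.gen₂ ℓ) (𝔽.gen₂ ℓ)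
      conjugate = trans (cover-b≡0 {ℓ} ℓ∈ (𝔽.gen₁∈ ℓ) (𝔽.gen₁∈ ℓ))
          (trans (sym (𝔽.zeroʳ δ)) (cong (δ 𝔽.·_) (sym (cover-b≡0 {ℓ} ℓ∈ (𝔽.gen₂∈ ℓ) (𝔽.gen₂∈ ℓ)))))
    outside : ∀ ℓ → ℓ ∉ 𝓛 → MeetsQuadricIn ℓ 0 ⊎ MeetsQuadricIn ℓ 2 ⊎ MeetsQuadricIn ℓ (q + 1) → HasCard
        (Projective.lines F r) (Polar ℓ) (dualNumber m)
    outside ℓ ℓ∉ meets = conclude (conjugate-pair ≢1)
      where
      open PolarGeometry.OnLine F Q 2≢0ᶠ δ δ-nonsquare ℓ
      meets⇒count : ∀ {N} → MeetsQuadricIn ℓ N → 𝔽points.count pointOn? ≡ N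
      meets⇒count = 𝔽points.HasCard⇒count pointOn? (λ {P} {P′} → pointOn-resp {P} {P′})
      -- All of 0, 2 and q + 1 differ from 1, so ℓ is not tangent and a point of the Hermitian
      -- variety off Σ lies on its extension.
      ≢1 : 𝔽points.count pointOn? ≢ 1
      ≢1 e = [ (λ c → 0≢1ℕ (trans (sym (meets⇒count c)) e)) , [ (λ c → 2≢1ℕ (trans (sym (meets⇒count c)) e)) ,
          (λ c → q+1≢1 (trans (sym (meets⇒count c)) e)) ]′ ]′ meets
        where
        0≢1ℕ : 0 ≢ 1
        0≢1ℕ ()
        2≢1ℕ : 2 ≢ 1
        2≢1ℕ ()
        q+1≢1 : q + 1 ≢ 1
        q+1≢1 e = ℕ.<⇒≢ (ℕ.≤-trans (s≤s z≤n) 𝔽.2≤order) (sym (ℕ.+-cancelʳ-≡ 1 q 0 e))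
      conclude : ConjugatePair → HasCard (Projective.lines F r) (Polar ℓ) (dualNumber m)
      conclude (u , v , u∈ , v∈ , ind , conjugate) = insideLines⇒HasCard ℓ u∈ v∈ ind {p} refl
          (trans (solve-dual 0 (visible-off-Σ P refl ind conjugate)
              (zero-shift (HasCard⇒visible P (T.outside P (∈𝓗⁺ {P} (conjugate⇒isotropic conjugate))
              (λ P∈ → ℓ∉ (covered⇒∈𝓛 ℓ u∈ v∈ ind refl (∈X⁻ {P} P∈))))))) (ℕ.+-identityʳ _))
        where
        p : Vector n
        p = complex u v
        P : Subspace n 1
        P = mkPoint p (complex-independent≢0 ind)

  dual⇒tight : IsDualTypeI m 𝓛 → IsTight (m * (q ^ 2 ∸ q) + q + 1) X
  dual⇒tight D = record { onVariety = proj₁ ; inside = inside ; outside = outside }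
    where
    module D = IsDualTypeI D

    -- For a generator c w the Hermitian value is b(w, w) multiplied by c and its conjugate, both
    -- nonzero.
    real-singular : ∀ P {c w} → gen P ≡ c ·ᵛ ιᵛ w → h (gen P) (gen P) ≡ 0# → 𝔽.Singular w
    real-singular P {c} {w} p≡ e = 𝔽.b≡0⇒singular (ι≡0 (trans (sym (h-ι w w))
        (·≡0 c≢0 (trans (sym (linear-· (h-linear (ιᵛ w)) c (ιᵛ w)))
        (·≡0 conj-c≢0 (trans (sym (h-·ʳ (c ·ᵛ ιᵛ w) c (ιᵛ w))) (trans (cong (λ z → h z z) (sym p≡)) e)))))))
      where
      c≢0 : c ≢ 0#
      c≢0 c≡0 = gen≢0 P (trans p≡ (trans (cong (_·ᵛ ιᵛ w) c≡0) (0·ᵛ _)))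
      conj-c≢0 : conj c ≢ 0#
      conj-c≢0 z = c≢0 (trans (sym (conj-conj c)) (trans (cong conj z) conj-0))

    module Off (P : Subspace n 1) (P∈𝓗 : P ∈ 𝓗) (ind : 𝔽.Independent (Re (gen P)) (Im (gen P))) where
      u = Re (gen P)
      v = Im (gen P)
      p≡ : gen P ≡ complex u v
      p≡ = sym (complex-Re-Im (gen P))
      ℓ : 𝔽.Subspace n 2
      ℓ = 𝔽.mkLine u v ind
      conjugate : b u u ≡ δ 𝔽.· b v v
      conjugate = 𝔽.-≡0 (ι≡0 (trans (sym (h-self u v)) (trans (cong₂ h (sym p≡) (sym p≡)) (∈𝓗⁻ {P} P∈𝓗))))
      visible≡ : visible P + q ^ 2 * dualNumber m ≡ tight + q ^ 2 * insideLines (gen P)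
      visible≡ = visible-off-Σ P p≡ ind conjugate
      open PolarGeometry.OnLine F Q 2≢0ᶠ δ δ-nonsquare ℓ using (pointOn?; pointOn-resp; conjugate-count)
      -- That P lies on the Hermitian variety is what places ℓ among the types of lines of which the
      -- dual condition speaks.
      meets : MeetsQuadricIn ℓ 0 ⊎ MeetsQuadricIn ℓ 2 ⊎ MeetsQuadricIn ℓ (q + 1)
      meets = [ (λ e → inj₁ (card e)) , [ (λ e → inj₂ (inj₁ (card e))) , (λ e → inj₂ (inj₂ (card e))) ]′ ]′
          (conjugate-count (𝔽.gen₁∈ ℓ) (𝔽.gen₂∈ ℓ) ind conjugate)
        where
        card : ∀ {N} → 𝔽points.count pointOn? ≡ N → MeetsQuadricIn ℓ N
        card = 𝔽points.count⇒HasCard pointOn? (λ {P} {P′} → pointOn-resp {P} {P′})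

    inside : ∀ P → P ∈ 𝓗 → P ∈ X → HasCard (Projective.points K r) (SeenFrom P) (tight + q ^ (r ∸ 2))
    inside P P∈𝓗 P∈X = visible⇒HasCard P ([ off , (λ (c , w , w≢0 , p≡) → visible-on-Σ P p≡ w≢0
        (real-singular P p≡ (∈𝓗⁻ {P} P∈𝓗))) ]′ (independent-or-real (gen≢0 P)))
      where
      off : 𝔽.Independent (Re (gen P)) (Im (gen P)) → visible P ≡ tight + q ^ (r ∸ 2)
      off ind = trans (solve-tight (q ^ (r ∸ 4)) visible≡ (HasCard⇒insideLines ℓ (𝔽.gen₁∈ ℓ) (𝔽.gen₂∈ ℓ) ind p≡
          (D.inside ℓ (covered⇒∈𝓛 ℓ (𝔽.gen₁∈ ℓ) (𝔽.gen₂∈ ℓ) ind p≡ (∈X⁻ {P} P∈X))))) (cong (tight +_) (sym q^[r-2]))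
        where open Off P P∈𝓗 ind

    outside : ∀ P → P ∈ 𝓗 → P ∉ X → HasCard (Projective.points K r) (SeenFrom P) tight
    -- A point of Σ on the Hermitian variety is singular and therefore covered, so only points off Σ
    -- can lie outside X.
    outside P P∈𝓗 P∉X = visible⇒HasCard P ([ off , (λ (c , w , w≢0 , p≡) → contradiction
        (∈X⁺ {P} (realSingular⇒covered (real⇒realSingular p≡ w≢0 (real-singular P p≡ (∈𝓗⁻ {P} P∈𝓗))))) P∉X) ]′
        (independent-or-real (gen≢0 P)))
      where
      off : 𝔽.Independent (Re (gen P)) (Im (gen P)) → visible P ≡ tight
      off ind = trans (solve-tight 0 visible≡ (trans (HasCard⇒insideLines ℓ (𝔽.gen₁∈ ℓ) (𝔽.gen₂∈ ℓ) ind p≡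
          (D.outside ℓ (λ ℓ∈ → P∉X (∈X⁺ {P} (∈𝓛⇒covered ℓ (𝔽.gen₁∈ ℓ) (𝔽.gen₂∈ ℓ) ind p≡ ℓ∈))) meets))
              (sym (ℕ.+-identityʳ _))))
          (trans (cong (tight +_) (ℕ.*-zeroʳ (q ^ 2))) (ℕ.+-identityʳ tight))
        where open Off P P∈𝓗 ind

theorem4p9 : (r q m : ℕ) → 4 ≤ r → 2 ∣ r → IsOddPrimePower q →
    (F : FiniteField q) (K : FiniteField (q ^ 2)) (emb : FieldEmbedding F K) →
    (Q : Projective.QuadraticForm F (suc r)) → Projective.Nondegenerate F Q →
    (𝓛 : Pred (Projective.Line F r) 0ℓ) → 𝓛 Respects (Setoid._≈_ (Projective.lines F r)) →
    Parabolic.IsCover F Q m 𝓛 →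
    Hermitian.IsTight F K emb Q (m * (q ^ 2 ∸ q) + q + 1) (Hermitian.extendedPoints F K emb Q 𝓛)
      ⇔ Parabolic.IsDualTypeI F Q m 𝓛
theorem4p9 r q m 4≤r (divides zero refl) pp F K emb Q nondeg 𝓛 resp cover = contradiction 4≤r λ ()
theorem4p9 r q m 4≤r (divides (suc zero) refl) pp F K emb Q nondeg 𝓛 resp cover = contradiction 4≤r λ { (s≤s (s≤s ())) }
-- The even number (2 + i) * 2 computes to 4 + i * 2, the shape of the dimension in `TightCover`.
theorem4p9 r q m 4≤r (divides (suc (suc i)) refl) pp F K emb Q nondeg 𝓛 resp cover = mk⇔ tight⇒dual dual⇒tight
  where open TightCover i pp F K emb Q nondeg m 𝓛 resp cover
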